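{- Let $q\ge5$. The imaginary chords of the twisted cubic $\mathcal{C}$ form one orbit under $G_q$, and the subgroup of $G_q$ fixing an imaginary chord has size $2(q+1)$. For $q$ odd, let $\rho$ be a non-square in $\mathbb{F}_q$; the line $\ell_1$ through $P(1,0,\rho,0)$ and $P(0,1,0,\rho)$ is an imaginary chord, and every element of the subgroup of $G_q$ fixing $\ell_1$ has a matrix of the form $\begin{pmatrix}\alpha d^3&\alpha\rho bd^2&\alpha\rho^2b^2d&\alpha\rho^3b^3\\ 3bd^2&d^3+2\rho b^2d&\rho^2b^3+2\rho bd^2&3\rho^2b^2d\\ 3\alpha b^2d&\alpha\rho b^3+2\alpha bd^2&\alpha d^3+2\alpha\rho b^2d&3\alpha\rho bd^2\\ b^3&b^2d&bd^2&d^3\end{pmatrix}$, with $\alpha\in\{ -1,1\}$ and $b,d\in\mathbb{F}_q$ not both $0$. For $q$ even, let $\eta\in\mathbb{F}_q$ have absolute trace $1$; the line $\ell_2$ through $P(\eta+1,1,1,0)$ and $P(\eta,\eta,0,1)$ is an imaginary chord, and every element of the subgroup of $G_q$ fixing $\ell_2$ has a matrix of the form $\begin{pmatrix}A^3&cA^2&c^2A&c^3\\ A^2B&dA^2&c^2B&c^2d\\ AB^2&cB^2&Ad^2&cd^2\\ B^3&dB^2&d^2B&d^3\end{pmatrix}$, where $A=\alpha c+d$, $B=\eta c+(\alpha+1)d$, $\alpha\in\{0,1\}$, and $c,d\in\mathbb{F}_q$ not both $0$.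
   Context: $\mathrm{PG}(3,q)$ has points $P(x_0,x_1,x_2,x_3)$. For $t\in\mathbb{F}_{q^2}$ let $P_t=P(t^3,t^2,t,1)$, and $P_\infty=P(1,0,0,0)$; the twisted cubic is $\mathcal{C}=\{P_t:t\in\mathbb{F}_q\cup\{\infty\}\}$. An imaginary chord is a line of $\mathrm{PG}(3,q)$ which, extended to $\mathrm{PG}(3,q^2)$, passes through $P_t$ and $P_{t^q}$ for some $t\in\mathbb{F}_{q^2}\setminus\mathbb{F}_q$. $G_q$ is the group of projectivities of $\mathrm{PG}(3,q)$ mapping $\mathcal{C}$ to itself; for $q\ge5$ its elements are the maps $x\mapsto xM$ on row coordinate vectors, with $M=\begin{pmatrix} a^3&a^2c&ac^2&c^3\\ 3a^2b&a^2d+2abc&bc^2+2acd&3c^2d\\ 3ab^2&b^2c+2abd&ad^2+2bcd&3cd^2\\ b^3&b^2d&bd^2&d^3\end{pmatrix}$, $a,b,c,d\in\mathbb{F}_q$, $ad-bc\neq0$, up to a nonzero scalar. For $q=2^h$, the absolute trace of $\eta$ is $\eta+\eta^2+\eta^{4}+\dots+\eta^{2^{h-1}}$. -}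

module Defs where

open import Level using (Level; _⊔_; suc)
open import Algebra.Bundles using (CommutativeRing; Semiring)
import Algebra.Definitions as Definitions
import Algebra.Definitions.RawSemiring as RawSemiringDefinitions
import Algebra.Properties.Semiring.Sum as SemiringSum
open import Data.Bool.Base using (if_then_else_)
open import Data.Fin.Base using (Fin; toℕ)
open import Data.Fin.Patterns using (0F; 1F; 2F; 3F)
open import Data.Fin.Properties using (_≟_)
open import Data.Maybe.Base using (Maybe; just; nothing)
open import Data.Nat.Base using (ℕ) renaming (_^_ to _^ℕ_)
open import Data.Product.Base using (∃; ∃₂; _×_; _,_; proj₁; proj₂)
open import Data.Vec.Functional using (Vector; []; _∷_)
open import Function.Base using (_∘_)
open import Function.Bundles using (Inverse; _⇔_)
open import Relation.Binary.Bundles using (Setoid)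
import Relation.Binary.Construct.On as On
open import Relation.Binary.PropositionalEquality.Properties using () renaming (setoid to ≡-setoid)
open import Relation.Nullary.Decidable.Core using (does)
open import Relation.Nullary.Negation.Core using (¬_)

HasSize : ∀ {a b} → Setoid a b → ℕ → Set (a ⊔ b)
HasSize S n = Inverse S (≡-setoid (Fin n))

record Field c ℓ : Set (suc (c ⊔ ℓ)) where
  field
    commutativeRing : CommutativeRing c ℓ
  open CommutativeRing commutativeRing public
  field
    1≉0     : ¬ (1# ≈ 0#)
    inverse : ∀ x → ¬ (x ≈ 0#) → ∃ λ y → x * y ≈ 1#

module ProjectiveSpace {c ℓ} (F : Field c ℓ) where

  open Field F
  open RawSemiringDefinitions (Semiring.rawSemiring semiring) public
    using (sum; _^_) renaming (_×_ to _·_)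
  open Definitions using (Invertible)
  open SemiringSum semiring
    using (sum-cong-≋; sum-replicate-zero; *-distribˡ-sum; *-distribʳ-sum; ∑-comm)
  open import Relation.Binary.Reasoning.Setoid setoid

  Vec₄ : Set c
  Vec₄ = Vector Carrier 4

  record Point : Set (c ⊔ ℓ) where
    constructor point
    field
      coords  : Vec₄
      nonzero : ¬ (∀ i → coords i ≈ 0#)
  open Point public

  infix 4 _∼_ _∈ˡ_ _≈ᴹ_ _∼ᴹ_

  _∼_ : Point → Point → Set (c ⊔ ℓ)
  x ∼ y = ∃ λ k → ¬ (k ≈ 0#) × (∀ i → coords x i ≈ k * coords y i)

  -- A line is given by two distinct points on it; two lines with the same
  -- points count as the same line (see `Carries`).
  record Line : Set (c ⊔ ℓ) where
    constructor line
    field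
      P₁ P₂    : Point
      distinct : ¬ (P₁ ∼ P₂)
  open Line public

  InSpan : Vec₄ → Vec₄ → Vec₄ → Set (c ⊔ ℓ)
  InSpan u v x = ∃₂ λ a b → ∀ i → x i ≈ a * u i + b * v i

  _∈ˡ_ : Point → Line → Set (c ⊔ ℓ)
  x ∈ˡ l = InSpan (coords (P₁ l)) (coords (P₂ l)) (coords x)

  Matrix : Set c
  Matrix = Vector Vec₄ 4

  _≈ᴹ_ : Matrix → Matrix → Set ℓ
  M ≈ᴹ N = ∀ i j → M i j ≈ N i j

  _∼ᴹ_ : Matrix → Matrix → Set (c ⊔ ℓ)
  M ∼ᴹ N = ∃ λ k → ¬ (k ≈ 0#) × (∀ i j → M i j ≈ k * N i j)

  1ᴹ : Matrix
  1ᴹ i j = if does (i ≟ j) then 1# else 0#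

  infixl 7 _*ᴹ_ _*ᵛ_

  _*ᵛ_ : Vec₄ → Matrix → Vec₄
  (x *ᵛ M) j = sum (λ i → x i * M i j)

  _*ᴹ_ : Matrix → Matrix → Matrix
  (M *ᴹ N) i = M i *ᵛ N

  record Projectivity : Set (c ⊔ ℓ) where
    constructor projectivity
    field
      matrix     : Matrix
      invertible : Invertible _≈ᴹ_ 1ᴹ _*ᴹ_ matrix
  open Projectivity public

  private
    *ᵛ-1ᴹ : ∀ x j → (x *ᵛ 1ᴹ) j ≈ x j
    *ᵛ-1ᴹ x = λ where
        0F → trans (+-cong (*-identityʳ _) (z³ _ _ _)) (+-identityʳ _)
        1F → trans (z+ _ _) (trans (+-cong (*-identityʳ _) (z² _ _)) (+-identityʳ _))
        2F → trans (z+ _ _) (trans (z+ _ _) (trans (+-cong (*-identityʳ _) (z¹ _)) (+-identityʳ _)))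
        3F → trans (z+ _ _) (trans (z+ _ _) (trans (z+ _ _) (trans (+-identityʳ _) (*-identityʳ _))))
      where
      z+ : ∀ a b → a * 0# + b ≈ b
      z+ a b = trans (+-congʳ (zeroʳ a)) (+-identityˡ b)
      z¹ : ∀ a → a * 0# + 0# ≈ 0#
      z¹ a = z+ a 0#
      z² : ∀ a b → a * 0# + (b * 0# + 0#) ≈ 0#
      z² a b = trans (z+ a _) (z¹ b)
      z³ : ∀ a b d → a * 0# + (b * 0# + (d * 0# + 0#)) ≈ 0#
      z³ a b d = trans (z+ a _) (z² b d)

    *ᵛ-assoc : ∀ x M N j → (x *ᵛ (M *ᴹ N)) j ≈ ((x *ᵛ M) *ᵛ N) j
    *ᵛ-assoc x M N j = begin
      sum (λ i → x i * sum (λ k → M i k * N k j))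
        ≈⟨ sum-cong-≋ (λ i → *-distribˡ-sum (x i) (λ k → M i k * N k j)) ⟩
      sum (λ i → sum (λ k → x i * (M i k * N k j)))
        ≈⟨ ∑-comm (λ i k → x i * (M i k * N k j)) ⟩
      sum (λ k → sum (λ i → x i * (M i k * N k j)))
        ≈⟨ sum-cong-≋ (λ k → sum-cong-≋ (λ i → sym (*-assoc (x i) (M i k) (N k j)))) ⟩
      sum (λ k → sum (λ i → x i * M i k * N k j))
        ≈⟨ sum-cong-≋ (λ k → sym (*-distribʳ-sum (N k j) (λ i → x i * M i k))) ⟩
      sum (λ k → sum (λ i → x i * M i k) * N k j) ∎

    *ᵛ-nonzero : ∀ M → Invertible _≈ᴹ_ 1ᴹ _*ᴹ_ M → ∀ x →
                 (∀ j → (x *ᵛ M) j ≈ 0#) → ∀ j → x j ≈ 0#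
    *ᵛ-nonzero M (N , _ , MN≈1) x xM≈0 j = begin
      x j                  ≈⟨ *ᵛ-1ᴹ x j ⟨
      (x *ᵛ 1ᴹ) j          ≈⟨ sum-cong-≋ (λ i → *-congˡ {x i} (sym (MN≈1 i j))) ⟩
      (x *ᵛ (M *ᴹ N)) j    ≈⟨ *ᵛ-assoc x M N j ⟩
      ((x *ᵛ M) *ᵛ N) j    ≈⟨ sum-cong-≋ (λ k → trans (*-congʳ {N k j} (xM≈0 k)) (zeroˡ (N k j))) ⟩
      sum {4} (λ _ → 0#)   ≈⟨ sum-replicate-zero 4 ⟩
      0#                   ∎

    ∼ᴹ-refl : ∀ {M} → M ∼ᴹ M
    ∼ᴹ-refl = 1# , 1≉0 , λ _ _ → sym (*-identityˡ _)

    ∼ᴹ-sym : ∀ {M N} → M ∼ᴹ N → N ∼ᴹ M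
    ∼ᴹ-sym {M} {N} (k , k≉0 , M≈kN) = k⁻¹ , k⁻¹≉0 , λ i j → begin
        N i j               ≈⟨ *-identityˡ _ ⟨
        1# * N i j          ≈⟨ *-congʳ (trans (*-comm k⁻¹ k) kk⁻¹≈1) ⟨
        k⁻¹ * k * N i j     ≈⟨ *-assoc _ _ _ ⟩
        k⁻¹ * (k * N i j)   ≈⟨ *-congˡ (M≈kN i j) ⟨
        k⁻¹ * M i j         ∎
      where
      k⁻¹ = proj₁ (inverse k k≉0)
      kk⁻¹≈1 = proj₂ (inverse k k≉0)
      k⁻¹≉0 : ¬ (k⁻¹ ≈ 0#)
      k⁻¹≉0 e = 1≉0 (trans (sym kk⁻¹≈1) (trans (*-congˡ e) (zeroʳ k)))

    ∼ᴹ-trans : ∀ {L M N} → L ∼ᴹ M → M ∼ᴹ N → L ∼ᴹ N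
    ∼ᴹ-trans (k , k≉0 , L≈kM) (m , m≉0 , M≈mN) =
      k * m , km≉0 , λ i j → trans (L≈kM i j) (trans (*-congˡ (M≈mN i j)) (sym (*-assoc k m _)))
      where
      k⁻¹ = proj₁ (inverse k k≉0)
      km≉0 : ¬ (k * m ≈ 0#)
      km≉0 e = m≉0 (begin
        m               ≈⟨ *-identityˡ m ⟨
        1# * m          ≈⟨ *-congʳ (trans (*-comm k⁻¹ k) (proj₂ (inverse k k≉0))) ⟨
        k⁻¹ * k * m     ≈⟨ *-assoc _ _ _ ⟩
        k⁻¹ * (k * m)   ≈⟨ *-congˡ e ⟩
        k⁻¹ * 0#        ≈⟨ zeroʳ k⁻¹ ⟩
        0#              ∎)

  projectivitySetoid : Setoid (c ⊔ ℓ) (c ⊔ ℓ)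
  projectivitySetoid = record
    { Carrier       = Projectivity
    ; _≈_           = λ g h → matrix g ∼ᴹ matrix h
    ; isEquivalence = record
      { refl  = ∼ᴹ-refl
      ; sym   = ∼ᴹ-sym
      ; trans = ∼ᴹ-trans
      }
    }

  act : Projectivity → Point → Point
  act (projectivity M inv) (point x x≉0) = point (x *ᵛ M) (x≉0 ∘ *ᵛ-nonzero M inv x)

  -- Since g is a bijection on points, this says g(S) = T as point sets.
  Carries : ∀ {a b} → Projectivity → (Point → Set a) → (Point → Set b) → Set (c ⊔ ℓ ⊔ a ⊔ b)
  Carries g S T = ∀ x → S x ⇔ T (act g x)

  CarriesLine : Projectivity → Line → Line → Set (c ⊔ ℓ)
  CarriesLine g l m = Carries g (_∈ˡ l) (_∈ˡ m)

  P : Carrier → Point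
  P t = point (t ^ 3 ∷ t ^ 2 ∷ t ∷ 1# ∷ []) (λ z → 1≉0 (z 3F))

  P∞ : Point
  P∞ = point (1# ∷ 0# ∷ 0# ∷ 0# ∷ []) (λ z → 1≉0 (z 0F))

  -- `nothing` is the parameter ∞.
  cubicPoint : Maybe Carrier → Point
  cubicPoint (just t) = P t
  cubicPoint nothing  = P∞

  OnCubic : Point → Set (c ⊔ ℓ)
  OnCubic x = ∃ λ t → x ∼ cubicPoint t

  InG : Projectivity → Set (c ⊔ ℓ)
  InG g = Carries g OnCubic OnCubic

  InStabilizer : Line → Projectivity → Set (c ⊔ ℓ)
  InStabilizer l g = InG g × CarriesLine g l l

  stabilizerSetoid : Line → Setoid (c ⊔ ℓ) (c ⊔ ℓ)
  stabilizerSetoid l = On.setoid {B = ∃ (InStabilizer l)} projectivitySetoid proj₁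

  IsOrbit : ∀ {a} → (Line → Set a) → Set (c ⊔ ℓ ⊔ a)
  IsOrbit S = ∃ λ l → ∀ m → S m ⇔ (∃ λ g → InG g × CarriesLine g l m)

  NonSquare : Carrier → Set (c ⊔ ℓ)
  NonSquare ρ = ¬ (∃ λ x → x * x ≈ ρ)

  -- The absolute trace of η when the field has 2 ^ h elements.
  trace : ℕ → Carrier → Carrier
  trace h η = sum {h} (λ i → η ^ (2 ^ℕ toℕ i))

  private
    coordsDiffer : ∀ x y i → coords x i ≈ 1# → coords y i ≈ 0# → ¬ (x ∼ y)
    coordsDiffer x y i x≈1 y≈0 (k , _ , x≈ky) =
      1≉0 (trans (sym x≈1) (trans (x≈ky i) (trans (*-congˡ y≈0) (zeroʳ k))))

  ℓ₁ : Carrier → Line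
  ℓ₁ ρ = line x y (coordsDiffer x y 0F refl refl)
    where
    x = point (1# ∷ 0# ∷ ρ ∷ 0# ∷ []) (λ z → 1≉0 (z 0F))
    y = point (0# ∷ 1# ∷ 0# ∷ ρ ∷ []) (λ z → 1≉0 (z 1F))

  ℓ₂ : Carrier → Line
  ℓ₂ η = line x y (coordsDiffer x y 2F refl refl)
    where
    x = point (η + 1# ∷ 1# ∷ 1# ∷ 0# ∷ []) (λ z → 1≉0 (z 1F))
    y = point (η ∷ η ∷ 0# ∷ 1# ∷ [])       (λ z → 1≉0 (z 3F))

  oddForm : (ρ α b d : Carrier) → Matrix
  oddForm ρ α b d =
      (α * d ^ 3 ∷ α * ρ * b * d ^ 2 ∷ α * ρ ^ 2 * b ^ 2 * d ∷ α * ρ ^ 3 * b ^ 3 ∷ [])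
    ∷ (3 · (b * d ^ 2) ∷ d ^ 3 + 2 · (ρ * b ^ 2 * d) ∷ ρ ^ 2 * b ^ 3 + 2 · (ρ * b * d ^ 2) ∷ 3 · (ρ ^ 2 * b ^ 2 * d) ∷ [])
    ∷ (3 · (α * b ^ 2 * d) ∷ α * ρ * b ^ 3 + 2 · (α * b * d ^ 2) ∷ α * d ^ 3 + 2 · (α * ρ * b ^ 2 * d) ∷ 3 · (α * ρ * b * d ^ 2) ∷ [])
    ∷ (b ^ 3 ∷ b ^ 2 * d ∷ b * d ^ 2 ∷ d ^ 3 ∷ [])
    ∷ []

  evenForm : (η α c d : Carrier) → Matrix
  evenForm η α c d =
      (A ^ 3 ∷ c * A ^ 2 ∷ c ^ 2 * A ∷ c ^ 3 ∷ [])
    ∷ (A ^ 2 * B ∷ d * A ^ 2 ∷ c ^ 2 * B ∷ c ^ 2 * d ∷ [])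
    ∷ (A * B ^ 2 ∷ c * B ^ 2 ∷ A * d ^ 2 ∷ c * d ^ 2 ∷ [])
    ∷ (B ^ 3 ∷ d * B ^ 2 ∷ d ^ 2 * B ∷ d ^ 3 ∷ [])
    ∷ []
    where
    A = α * c + d
    B = η * c + (α + 1#) * d

-- F is the field with q elements, embedded by ι in the field K with q ^ 2 elements.
module ImaginaryChords {c ℓ c′ ℓ′} (q : ℕ) (F : Field c ℓ) (K : Field c′ ℓ′)
                       (ι : Field.Carrier F → Field.Carrier K) where

  private
    module F = ProjectiveSpace F
    module K = ProjectiveSpace K
    open Field K using (Carrier; _≈_)

  InSubfield : Carrier → Set (c ⊔ ℓ′)
  InSubfield t = ∃ λ a → ι a ≈ t

  OnExtension : K.Point → F.Line → Set (c′ ⊔ ℓ′)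
  OnExtension x l = K.InSpan (ι ∘ F.coords (F.P₁ l)) (ι ∘ F.coords (F.P₂ l)) (K.coords x)

  IsImaginaryChord : F.Line → Set (c ⊔ c′ ⊔ ℓ′)
  IsImaginaryChord l =
    ∃ λ t → ¬ InSubfield t × OnExtension (K.P t) l × OnExtension (K.P (t K.^ q)) l

module Submission where

-- A projectivity g preserving the cubic is composed with an element of PGL(2,q) so that it fixes
-- P(∞), P(0) and P(1); the equations x₀x₂ = x₁² and x₁x₃ = x₂² then become polynomial identities of
-- degree 3 valid at the q - 1 ≥ 4 nonzero parameters, which force the identity. Hence G_q ≅ PGL(2,q)
-- acting on parameters.
--
-- Counting gives K = F ⊕ F t for every t ∉ F. The polynomial (X + 1)^q - X^q - 1 has degree less than
-- q and q roots in F, so x ↦ x^q is additive and t^q is the other root of the minimal polynomial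
-- X² - T X + N of t. The chord of t therefore has equations x₀ = T x₁ - N x₂, x₁ = T x₂ - N x₃, and
-- g = (a, b; c, d) maps it to the chord of s if and only if (at + b) / (ct + d) is s or s^q. Affine
-- maps give transitivity; the stabiliser consists of the g with at + b = t (ct + d) or
-- at + b = t^q (ct + d), so that (c : d) ∈ PG(1,q) and the choice of t or t^q determine g.

open import Defs
open import Algebra.Bundles using (CommutativeMonoid; CommutativeRing; RawSemiring; Semiring)
import Algebra.Definitions.RawSemiring as RawSemiringDefinitions
open import Algebra.Morphism.Structures using (IsRingHomomorphism)
import Algebra.Properties.CommutativeMonoid.Mult as CommutativeMonoidMult
import Algebra.Properties.CommutativeMonoid.Sum as CommutativeMonoidSum
import Algebra.Properties.Ring as RingProperties
import Algebra.Properties.Semiring.Exp as Exp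
import Algebra.Properties.Semiring.Mult as Mult
import Algebra.Properties.Semiring.Mult.TCOptimised as TCMult
import Algebra.Properties.Semiring.Sum as SemiringSum
import Algebra.Solver.Ring as RingSolver
open import Algebra.Solver.Ring.AlmostCommutativeRing
  using (AlmostCommutativeRing; fromCommutativeRing; _-Raw-AlmostCommutative⟶_)
open import Data.Fin.Base
  using (Fin; zero; suc; toℕ; punchIn; punchOut; inject≤; _<_; remQuot; combine; splitAt; join)
  renaming (_≤_ to _≤ᶠ_)
open import Data.Fin.Patterns using (0F; 1F; 2F; 3F)
open import Data.Fin.Permutation using (Permutation′; permutation)
open import Data.Fin.Properties
  using (any?; ¬∀⟶∃¬; <⇒notInjective; injective⇒≤; suc-injective; punchIn-injective; punchInᵢ≢i; punchOut-injective;
         inject≤-injective; ≤-antisym; ≤-reflexive; <-asym; _≤?_; combine-remQuot; remQuot-combine; join-splitAt; splitAt-join)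
  renaming (_≟_ to _≟ᶠ_)
import Data.Integer.Base as ℤ
import Data.Integer.Properties as ℤₚ
open import Data.Maybe.Base using (Maybe; just; nothing)
open import Data.Nat.Base as ℕ using (ℕ; zero; suc; _≤_; s≤s) renaming (_+_ to _+ℕ_; _*_ to _*ℕ_; _^_ to _^ℕ_)
open import Data.Nat.Divisibility using (∣-refl; ∣m∣n⇒∣m+n)
open import Data.Nat.Divisibility.Core using (_∣_; divides)
import Data.Nat.Properties as ℕₚ
open import Data.Product.Base using (∃; ∃₂; _×_; _,_; proj₁; proj₂)
import Data.Sum.Base as Sum
open import Data.Sum.Base using (_⊎_; inj₁; inj₂; [_,_]′)
import Data.Vec.Base as Vec
open import Data.Vec.Relation.Unary.All as All using (All)
open import Function.Base using (_∘_)
open import Function.Bundles using (Equivalence; Inverse; _⇔_; mk⇔)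
import Level
open import Relation.Binary.Bundles using (Setoid)
open import Relation.Binary.PropositionalEquality as ≡ using (_≡_)
open import Relation.Nullary.Decidable using (decidable-stable)
open import Relation.Nullary.Decidable.Core using (Dec; yes; no; map′)
open import Relation.Nullary.Negation.Core using (¬_; contradiction)

-- All that is known of the two fields is their sizes and the homomorphism `ι`: neither is given as
-- a concrete extension, and q comes with a factorisation only in the even case, as 2^h. Existence
-- in `K` must therefore come from counting. The hard instance is that `ℓ₁ ρ` and `ℓ₂ η` are
-- imaginary chords: this asks for a root in `K`, outside F, of X² - 1/ρ or of X² - X - η, while `K`
-- only supplies an arbitrary t outside F with an unrelated minimal polynomial. Normalising that
-- polynomial yields some ε in F that is no square, respectively not of the form z² - z. The maps x²
-- and ε x², respectively x² + x and x² + x + ε, identify only the members of a pair and have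
-- disjoint images apart from 0 in the first case, so their images together fill F. Hence ρ = ε x²
-- and η = x² + x + ε for some x, and the wanted root is a multiple or a translate of the normalised
-- t. The matrices of the statement are the general stabiliser elements for (T, N) = (0, -1/ρ) and
-- (1, -η).

-- A ring solver with integer coefficients.

module IntegerSolver {c ℓ} (R : CommutativeRing c ℓ) where
  open import Data.Integer.Base using (ℤ; +_; -[1+_]; _⊖_)

  open CommutativeRing R
  open RingProperties ring
    using (-0#≈0#; -‿involutive; -‿distribˡ-*; -‿distribʳ-*; -‿anti-homo-+)
  -- With this multiple, `1 · 1#` computes to `1#`, so the solver's constant `:1` denotes `1#`
  -- itself and not `1# + 0#`.
  open TCMult semiring using (×-homo-+; ×1-homo-*) renaming (_×_ to _·_)
  open import Relation.Binary.Reasoning.Setoid setoid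

  private
    ⟦_⟧ᶻ : ℤ → Carrier
    ⟦ + n ⟧ᶻ      = n · 1#
    ⟦ -[1+ n ] ⟧ᶻ = - (suc n · 1#)

    -‿+-distrib : ∀ x y → - (x + y) ≈ - x + - y
    -‿+-distrib x y = trans (-‿anti-homo-+ x y) (+-comm _ _)

    cancel-1 : ∀ x y → (1# + x) - (1# + y) ≈ x - y
    cancel-1 x y = begin
      (1# + x) + - (1# + y)    ≈⟨ +-cong (+-comm _ _) (-‿+-distrib 1# y) ⟩
      (x + 1#) + (- 1# + - y)  ≈⟨ +-assoc _ _ _ ⟩
      x + (1# + (- 1# + - y))  ≈⟨ +-congˡ (sym (+-assoc _ _ _)) ⟩
      x + ((1# + - 1#) + - y)  ≈⟨ +-congˡ (+-congʳ (-‿inverseʳ 1#)) ⟩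
      x + (0# + - y)           ≈⟨ +-congˡ (+-identityˡ _) ⟩
      x + - y                  ∎

    ⊖-homo : ∀ m n → ⟦ m ⊖ n ⟧ᶻ ≈ m · 1# - n · 1#
    ⊖-homo m       zero    = sym (trans (+-congˡ -0#≈0#) (+-identityʳ _))
    ⊖-homo zero    (suc n) = sym (+-identityˡ _)
    ⊖-homo (suc m) (suc n) = begin
      ⟦ suc m ⊖ suc n ⟧ᶻ       ≡⟨ ≡.cong ⟦_⟧ᶻ (ℤₚ.[1+m]⊖[1+n]≡m⊖n m n) ⟩
      ⟦ m ⊖ n ⟧ᶻ               ≈⟨ ⊖-homo m n ⟩
      m · 1# - n · 1#          ≈⟨ cancel-1 _ _ ⟨
      (1# + m · 1#) - (1# + n · 1#)
        ≈⟨ +-cong (×-homo-+ 1# 1 m) (-‿cong (×-homo-+ 1# 1 n)) ⟨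
      suc m · 1# - suc n · 1#  ∎

    +-homo : ∀ i j → ⟦ i ℤ.+ j ⟧ᶻ ≈ ⟦ i ⟧ᶻ + ⟦ j ⟧ᶻ
    +-homo (+ m)      (+ n)      = ×-homo-+ 1# m n
    +-homo (+ m)      -[1+ n ]   = ⊖-homo m (suc n)
    +-homo -[1+ m ]   (+ n)      = trans (⊖-homo n (suc m)) (+-comm _ _)
    +-homo -[1+ m ]   -[1+ n ]   = begin
      - (suc (suc (m ℕ.+ n)) · 1#)   ≡⟨ ≡.cong (λ k → - (suc k · 1#)) (ℕₚ.+-suc m n) ⟨
      - ((suc m ℕ.+ suc n) · 1#)     ≈⟨ -‿cong (×-homo-+ 1# (suc m) (suc n)) ⟩
      - (suc m · 1# + suc n · 1#)    ≈⟨ -‿+-distrib _ _ ⟩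
      - (suc m · 1#) - suc n · 1#    ∎

    -‿homo : ∀ i → ⟦ ℤ.- i ⟧ᶻ ≈ - ⟦ i ⟧ᶻ
    -‿homo (+ zero)  = sym -0#≈0#
    -‿homo (+ suc n) = refl
    -‿homo -[1+ n ]  = sym (-‿involutive _)

    +*-homo : ∀ m j → ⟦ + m ℤ.* j ⟧ᶻ ≈ m · 1# * ⟦ j ⟧ᶻ
    +*-homo m (+ n) = begin
      ⟦ + m ℤ.* + n ⟧ᶻ     ≡⟨ ≡.cong ⟦_⟧ᶻ (ℤₚ.pos-* m n) ⟨
      (m ℕ.* n) · 1#       ≈⟨ ×1-homo-* m n ⟩
      m · 1# * n · 1#      ∎
    +*-homo m -[1+ n ] = begin
      ⟦ + m ℤ.* ℤ.- (+ suc n) ⟧ᶻ    ≡⟨ ≡.cong ⟦_⟧ᶻ (ℤₚ.neg-distribʳ-* (+ m) (+ suc n)) ⟨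
      ⟦ ℤ.- (+ m ℤ.* + suc n) ⟧ᶻ    ≈⟨ -‿homo (+ m ℤ.* + suc n) ⟩
      - ⟦ + m ℤ.* + suc n ⟧ᶻ        ≈⟨ -‿cong (+*-homo m (+ suc n)) ⟩
      - (m · 1# * suc n · 1#)       ≈⟨ -‿distribʳ-* _ _ ⟩
      m · 1# * - (suc n · 1#)       ∎

    *-homo : ∀ i j → ⟦ i ℤ.* j ⟧ᶻ ≈ ⟦ i ⟧ᶻ * ⟦ j ⟧ᶻ
    *-homo (+ m)    j = +*-homo m j
    *-homo -[1+ m ] j = begin
      ⟦ ℤ.- (+ suc m) ℤ.* j ⟧ᶻ      ≡⟨ ≡.cong ⟦_⟧ᶻ (ℤₚ.neg-distribˡ-* (+ suc m) j) ⟨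
      ⟦ ℤ.- (+ suc m ℤ.* j) ⟧ᶻ      ≈⟨ -‿homo (+ suc m ℤ.* j) ⟩
      - ⟦ + suc m ℤ.* j ⟧ᶻ          ≈⟨ -‿cong (+*-homo (suc m) j) ⟩
      - (suc m · 1# * ⟦ j ⟧ᶻ)       ≈⟨ -‿distribˡ-* _ _ ⟩
      - (suc m · 1#) * ⟦ j ⟧ᶻ       ∎

    almostCommutativeRing : AlmostCommutativeRing c ℓ
    almostCommutativeRing = fromCommutativeRing R

    homomorphism : ℤ.+-*-rawRing -Raw-AlmostCommutative⟶ almostCommutativeRing
    homomorphism = record
      { ⟦_⟧    = ⟦_⟧ᶻ
      ; +-homo = +-homo
      ; *-homo = *-homo
      ; -‿homo = -‿homo
      ; 0-homo = refl
      ; 1-homo = refl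
      }

    -- Equality in the ring is not decided by computation, equality of integers is; comparing
    -- coefficients in ℤ is what makes terms such as x - x cancel in normal forms.
    coeff≟ : ∀ i j → Maybe (⟦ i ⟧ᶻ ≈ ⟦ j ⟧ᶻ)
    coeff≟ i j with i ℤₚ.≟ j
    ... | yes i≡j = just (reflexive (≡.cong ⟦_⟧ᶻ i≡j))
    ... | no  _   = nothing

  open RingSolver ℤ.+-*-rawRing almostCommutativeRing homomorphism coeff≟ public
    using (Polynomial; con; solve; _:=_; _:+_; _:*_; _:-_; :-_)

  :0 :1 : ∀ {n} → Polynomial n
  :0 = con (+ 0)
  :1 = con (+ 1)

-- Counting and summation over finite setoids.

-- If `j` were missed, deleting it from the codomain would leave an injection of `suc n` elements
-- into `n`.
injective⇒surjective : ∀ {n} (f : Fin n → Fin n) → (∀ {i j} → f i ≡ f j → i ≡ j) → ∀ j → ∃ λ i → f i ≡ j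
injective⇒surjective {suc n} f f-inj j with any? (λ i → f i ≟ᶠ j)
... | yes j∈f = j∈f
... | no  j∉f = contradiction (λ {i} {k} → avoid-injective {i} {k}) (<⇒notInjective (ℕₚ.n<1+n n))
  where
  j≢f : ∀ i → ¬ (j ≡ f i)
  j≢f i j≡fi = j∉f (i , ≡.sym j≡fi)
  avoid : Fin (suc n) → Fin n
  avoid i = punchOut (j≢f i)
  avoid-injective : ∀ {i k} → avoid i ≡ avoid k → i ≡ k
  avoid-injective {i} {k} e = f-inj (punchOut-injective (j≢f i) (j≢f k) e)

module Finite {a ℓ} (S : Setoid a ℓ) {n} (size : HasSize S n) where
  open Setoid S
  open Inverse size public using () renaming (to to index; from to element; to-cong to index-cong)

  element-index : ∀ x → element (index x) ≈ x
  element-index x = Inverse.inverseʳ size ≡.refl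

  index-element : ∀ i → index (element i) ≡ i
  index-element i = Inverse.inverseˡ size refl

  index-injective : ∀ {x y} → index x ≡ index y → x ≈ y
  index-injective {x} {y} e =
    trans (sym (element-index x)) (trans (reflexive (≡.cong element e)) (element-index y))

  element-injective : ∀ {i j} → element i ≈ element j → i ≡ j
  element-injective {i} {j} e =
    ≡.trans (≡.sym (index-element i)) (≡.trans (index-cong e) (index-element j))

  infix 4 _≟_
  _≟_ : ∀ x y → Dec (x ≈ y)
  x ≟ y = map′ index-injective index-cong (index x ≟ᶠ index y)

  injective⇒enumerates : (f : Fin n → Carrier) → (∀ {i j} → f i ≈ f j → i ≡ j) → ∀ x → ∃ λ i → f i ≈ x
  injective⇒enumerates f f-inj x =
    let i , e = injective⇒surjective (index ∘ f) (f-inj ∘ index-injective) (index x)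
    in i , index-injective e

  -- Two maps that are two-to-one along the same involution σ and have disjoint images together
  -- cover S: using f on one half of each σ-pair and g on the other half gives an injection S → S.
  two-to-one-cover :
    (σ f g : Carrier → Carrier) →
    (∀ {x y} → x ≈ y → σ x ≈ σ y) → (∀ x → σ (σ x) ≈ x) →
    (∀ {x y} → x ≈ y → f x ≈ f y) → (∀ {x y} → x ≈ y → g x ≈ g y) →
    (∀ x y → f x ≈ f y → x ≈ y ⊎ x ≈ σ y) →
    (∀ x y → g x ≈ g y → x ≈ y ⊎ x ≈ σ y) →
    (∀ x y → ¬ (y ≈ σ y) → ¬ (f x ≈ g y)) →
    ∀ z → (∃ λ x → f x ≈ z) ⊎ (∃ λ x → g x ≈ z)
  two-to-one-cover σ f g σ-cong σ-invol f-cong g-cong f-fibre g-fibre disjoint z = split (injective⇒enumerates ψ ψ-inj z)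
    where
    -- The order on indices picks a representative of each pair x, σ x. Fixed points of σ lie in
    -- this half, so `g` is applied only to points moved by σ, as `disjoint` requires.
    Half : Carrier → Set
    Half x = index x ≤ᶠ index (σ x)

    half? : ∀ x → Dec (Half x)
    half? x = index x ≤? index (σ x)

    choose : ∀ x → Dec (Half x) → Carrier
    choose x (yes _) = f x
    choose x (no _)  = g x

    ψ : Fin n → Carrier
    ψ i = choose (element i) (half? (element i))

    split : (∃ λ i → ψ i ≈ z) → (∃ λ x → f x ≈ z) ⊎ (∃ λ x → g x ≈ z)
    split (i , e) with half? (element i)
    ... | yes _ = inj₁ (element i , e)
    ... | no  _ = inj₂ (element i , e)

    σ-moves : ∀ x → ¬ Half x → ¬ (x ≈ σ x)
    σ-moves x x> e = x> (≤-reflexive (index-cong e))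

    swap : ∀ {x y} → x ≈ σ y → σ x ≈ y
    swap {x} {y} e = trans (σ-cong e) (σ-invol y)

    choose-injective : ∀ x y hx hy → choose x hx ≈ choose y hy → x ≈ y
    choose-injective x y (yes x≤) (yes y≤) e with f-fibre x y e
    ... | inj₁ x≈y  = x≈y
    -- Both members of a pair lie in the half, so each index is at most the other.
    ... | inj₂ x≈σy = index-injective (≤-antisym
            (≡.subst (λ j → index x ≤ᶠ j) (index-cong (swap x≈σy)) x≤)
            (≡.subst (λ j → index y ≤ᶠ j) (≡.sym (index-cong x≈σy)) y≤))
    choose-injective x y (no x>)  (no y>)  e with g-fibre x y e
    ... | inj₁ x≈y  = x≈y
    ... | inj₂ x≈σy = contradiction
            (≡.subst (λ j → j < index x) (index-cong (swap x≈σy)) (ℕₚ.≰⇒> x>))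
            (<-asym (≡.subst (λ j → j < index y) (≡.sym (index-cong x≈σy)) (ℕₚ.≰⇒> y>)))
    choose-injective x y (yes _)  (no y>)  e = contradiction e (disjoint x y (σ-moves y y>))
    choose-injective x y (no x>)  (yes _)  e = contradiction (sym e) (disjoint y x (σ-moves x x>))

    ψ-inj : ∀ {i j} → ψ i ≈ ψ j → i ≡ j
    ψ-inj e = element-injective (choose-injective _ _ (half? _) (half? _) e)

-- Stated for a commutative monoid to serve both the addition and the multiplication of a field; in
-- the second case `∑` and `sum` denote products, and `sum-replicate` turns a constant product into
-- a power.
module FiniteSum {m ℓ′} (M : CommutativeMonoid m ℓ′) {a ℓ} {S : Setoid a ℓ} {n} (size : HasSize S n) where
  open CommutativeMonoid M
  private module S = Setoid S
  open CommutativeMonoidSum M public using (sum; sum-permute; sum-cong-≋; ∑-distrib-+; sum-replicate)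
  open Finite S size

  ∑ : (S.Carrier → Carrier) → Carrier
  ∑ f = sum (f ∘ element)

  ∑-bijection : (φ : Inverse S S) (f : S.Carrier → Carrier) → (∀ {x y} → x S.≈ y → f x ≈ f y) →
                ∑ f ≈ ∑ (f ∘ Inverse.to φ)
  ∑-bijection φ f f-cong = trans
    (sum-permute (f ∘ element) π)
    (sum-cong-≋ (λ i → f-cong (element-index (φ.to (element i)))))
    where
    module φ = Inverse φ
    π : Permutation′ n
    π = permutation (index ∘ φ.to ∘ element) (index ∘ φ.from ∘ element)
      (λ i → ≡.trans (index-cong (S.trans (φ.to-cong (element-index _)) (φ.inverseˡ S.refl))) (index-element i))
      (λ i → ≡.trans (index-cong (S.trans (φ.from-cong (element-index _)) (φ.inverseʳ S.refl))) (index-element i))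

enumeration⇒HasSize : ∀ {a ℓ} (S : Setoid a ℓ) {n} (f : Fin n → Setoid.Carrier S) →
  (∀ i j → Setoid._≈_ S (f i) (f j) → i ≡ j) → (∀ x → ∃ λ i → Setoid._≈_ S (f i) x) → HasSize S n
enumeration⇒HasSize S f f-inj f-surj = record
  { to        = λ x → proj₁ (f-surj x)
  ; from      = f
  ; to-cong   = λ {x} {y} x≈y → f-inj _ _ (trans (proj₂ (f-surj x)) (trans x≈y (sym (proj₂ (f-surj y)))))
  ; from-cong = λ { ≡.refl → refl }
  ; inverse   = (λ {i} y≈fi → f-inj _ _ (trans (proj₂ (f-surj _)) y≈fi))
              , (λ { {x} ≡.refl → proj₂ (f-surj x) })
  }
  where open Setoid S

-- Field arithmetic.

module FieldProperties {c ℓ} (F : Field c ℓ) where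
  open Field F hiding (zero)
  open RingProperties ring public using (x∙y⁻¹≈ε⇒x≈y; x≈y⇒x∙y⁻¹≈ε; -0#≈0#)
  open IntegerSolver commutativeRing public
  open Exp semiring public using (_^_; ^-congˡ; ^-assocʳ)
  open CommutativeMonoidMult *-commutativeMonoid public using () renaming (×-distrib-+ to ^-distrib-*)
  open import Relation.Binary.Reasoning.Setoid setoid

  -‿≈0⇒≈ : ∀ {x y} → x - y ≈ 0# → x ≈ y
  -‿≈0⇒≈ = x∙y⁻¹≈ε⇒x≈y _ _

  ≈⇒-‿≈0 : ∀ {x y} → x ≈ y → x - y ≈ 0#
  ≈⇒-‿≈0 = x≈y⇒x∙y⁻¹≈ε

  *≈0⇒≈0 : ∀ {x y} → ¬ (x ≈ 0#) → x * y ≈ 0# → y ≈ 0#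
  *≈0⇒≈0 {x} {y} x≉0 xy≈0 = let x⁻¹ , xx⁻¹≈1 = inverse x x≉0 in begin
    y                ≈⟨ *-identityˡ y ⟨
    1# * y           ≈⟨ *-congʳ xx⁻¹≈1 ⟨
    x * x⁻¹ * y      ≈⟨ solve 3 (λ x y z → x :* z :* y := z :* (x :* y)) refl x y x⁻¹ ⟩
    x⁻¹ * (x * y)    ≈⟨ *-congˡ xy≈0 ⟩
    x⁻¹ * 0#         ≈⟨ zeroʳ x⁻¹ ⟩
    0#               ∎

  *-≉0 : ∀ {x y} → ¬ (x ≈ 0#) → ¬ (y ≈ 0#) → ¬ (x * y ≈ 0#)
  *-≉0 x≉0 y≉0 = y≉0 ∘ *≈0⇒≈0 x≉0

  factorˡ-≉0 : ∀ {x y} → ¬ (x * y ≈ 0#) → ¬ (x ≈ 0#)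
  factorˡ-≉0 {x} {y} xy≉0 x≈0 = xy≉0 (trans (*-congʳ x≈0) (zeroˡ y))

  factorʳ-≉0 : ∀ {x y} → ¬ (x * y ≈ 0#) → ¬ (y ≈ 0#)
  factorʳ-≉0 {x} {y} xy≉0 y≈0 = xy≉0 (trans (*-congˡ y≈0) (zeroʳ x))

  *-cancelˡ : ∀ {x y z} → ¬ (x ≈ 0#) → x * y ≈ x * z → y ≈ z
  *-cancelˡ {x} {y} {z} x≉0 xy≈xz = -‿≈0⇒≈ (*≈0⇒≈0 x≉0 (trans
    (solve 3 (λ x y z → x :* (y :- z) := x :* y :- x :* z) refl x y z)
    (≈⇒-‿≈0 xy≈xz)))

  ^3-≉0 : ∀ {k} → ¬ (k ≈ 0#) → ¬ (k ^ 3 ≈ 0#)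
  ^3-≉0 k≉0 = *-≉0 k≉0 (*-≉0 k≉0 (*-≉0 k≉0 1≉0))

  infix 9 _⁻¹[_]
  _⁻¹[_] : ∀ x → ¬ (x ≈ 0#) → Carrier
  x ⁻¹[ x≉0 ] = proj₁ (inverse x x≉0)

  *-inverse : ∀ {x} (x≉0 : ¬ (x ≈ 0#)) → x * x ⁻¹[ x≉0 ] ≈ 1#
  *-inverse x≉0 = proj₂ (inverse _ x≉0)

  ⁻¹-≉0 : ∀ {x} (x≉0 : ¬ (x ≈ 0#)) → ¬ (x ⁻¹[ x≉0 ] ≈ 0#)
  ⁻¹-≉0 x≉0 = factorʳ-≉0 (λ e → 1≉0 (trans (sym (*-inverse x≉0)) e))

  -- Reduces an equation that holds modulo l ≈ r to a ring identity.
  modulo : ∀ k {l r x y} → l ≈ r → x ≈ y + k * (l - r) → x ≈ y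
  modulo k {l} {r} {x} {y} l≈r e = begin
    x                ≈⟨ e ⟩
    y + k * (l - r)  ≈⟨ +-congˡ (*-congˡ (≈⇒-‿≈0 l≈r)) ⟩
    y + k * 0#       ≈⟨ +-congˡ (zeroʳ k) ⟩
    y + 0#           ≈⟨ +-identityʳ y ⟩
    y                ∎


-- Polynomials as coefficient vectors, and the bound on their number of roots.

module Polynomials {c ℓ} (F : Field c ℓ) where
  open import Data.Vec.Base using (Vec; []; _∷_; _∷ʳ_; replicate)
  open import Data.Vec.Relation.Unary.All using ([]; _∷_)
  open Field F hiding (zero)
  open FieldProperties F
  open import Relation.Binary.Reasoning.Setoid setoid

  eval : ∀ {n} → Vec Carrier n → Carrier → Carrier
  eval []       x = 0#
  eval (p ∷ ps) x = p + x * eval ps x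

  -- The quotient of the division by X - a.
  quotient : ∀ {n} → Carrier → Vec Carrier (suc n) → Vec Carrier n
  quotient {zero}  a (p ∷ [])  = []
  quotient {suc _} a (p ∷ ps)  = eval ps a ∷ quotient a ps

  eval-quotient : ∀ {n} a (ps : Vec Carrier (suc n)) x →
                  eval ps x ≈ eval ps a + (x - a) * eval (quotient a ps) x
  eval-quotient {zero} a (p ∷ []) x =
    solve 3 (λ a p x → p :+ x :* :0 := p :+ a :* :0 :+ (x :- a) :* :0) refl a p x
  eval-quotient {suc _} a (p ∷ ps) x = begin
    p + x * eval ps x
      ≈⟨ +-congˡ (*-congˡ (eval-quotient a ps x)) ⟩
    p + x * (eval ps a + (x - a) * eval (quotient a ps) x)
      ≈⟨ solve 5 (λ p x a e f → p :+ x :* (e :+ (x :- a) :* f) := p :+ a :* e :+ (x :- a) :* (e :+ x :* f))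
           refl p x a (eval ps a) (eval (quotient a ps) x) ⟩
    p + a * eval ps a + (x - a) * (eval ps a + x * eval (quotient a ps) x) ∎

  -- With zero quotient the polynomial is the constant `eval ps a`. The zero polynomial is meant
  -- coefficientwise, because on a finite field a function can vanish without its coefficients doing
  -- so.
  quotient-zero : ∀ {n} a (ps : Vec Carrier (suc n)) → eval ps a ≈ 0# →
                  All (_≈ 0#) (quotient a ps) → All (_≈ 0#) ps
  quotient-zero {zero} a (p ∷ []) root [] =
    trans (solve 2 (λ a p → p := p :+ a :* :0) refl a p) root ∷ []
  quotient-zero {suc _} a (p ∷ ps) root (ps[a]≈0 ∷ zs) =
    modulo (- a) ps[a]≈0 (trans (solve 3 (λ a p e → p := p :+ a :* e :+ :- a :* (e :- :0)) refl a p (eval ps a)) (+-congʳ root))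
      ∷ quotient-zero a ps ps[a]≈0 zs

  -- A vector of length `n` has degree below `n`, so `n` roots suffice: splitting off X - r₀ leaves
  -- a shorter vector that still vanishes at the other roots, as these differ from r₀.
  roots⇒zero : ∀ {n} (ps : Vec Carrier n) (r : Fin n → Carrier) → (∀ {i j} → r i ≈ r j → i ≡ j) →
               (∀ i → eval ps (r i) ≈ 0#) → All (_≈ 0#) ps
  roots⇒zero {zero}  []       r r-inj roots = []
  roots⇒zero {suc n} ps       r r-inj roots = quotient-zero a ps (roots zero)
    (roots⇒zero (quotient a ps) (r ∘ suc) (suc-injective ∘ r-inj) λ i → *≈0⇒≈0 (r-a≉0 i) (begin
      (r (suc i) - a) * eval (quotient a ps) (r (suc i))
        ≈⟨ +-identityˡ _ ⟨
      0# + (r (suc i) - a) * eval (quotient a ps) (r (suc i))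
        ≈⟨ +-congʳ (roots zero) ⟨
      eval ps a + (r (suc i) - a) * eval (quotient a ps) (r (suc i))
        ≈⟨ eval-quotient a ps (r (suc i)) ⟨
      eval ps (r (suc i))
        ≈⟨ roots (suc i) ⟩
      0# ∎))
    where
    a = r zero
    r-a≉0 : ∀ i → ¬ (r (suc i) - a ≈ 0#)
    r-a≉0 i e with () ← r-inj (-‿≈0⇒≈ e)

  eval-zero : ∀ {n} {ps : Vec Carrier n} x → All (_≈ 0#) ps → eval ps x ≈ 0#
  eval-zero x []       = refl
  eval-zero x (z ∷ zs) = trans (+-cong z (trans (*-congˡ (eval-zero x zs)) (zeroʳ x))) (+-identityʳ 0#)

  eval-∷ʳ : ∀ {n} (ps : Vec Carrier n) p x → eval (ps ∷ʳ p) x ≈ eval ps x + p * x ^ n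
  eval-∷ʳ []       p x = solve 2 (λ p x → p :+ x :* :0 := :0 :+ p :* :1) refl p x
  eval-∷ʳ {suc n} (p′ ∷ ps) p x = trans (+-congˡ (*-congˡ (eval-∷ʳ ps p x)))
    (solve 5 (λ p′ x e p y → p′ :+ x :* (e :+ p :* y) := p′ :+ x :* e :+ p :* (x :* y)) refl p′ x (eval ps x) p (x ^ n))

  last-zero : ∀ {n} (ps : Vec Carrier n) {p} → All (_≈ 0#) (ps ∷ʳ p) → p ≈ 0#
  last-zero []       (z ∷ []) = z
  last-zero (_ ∷ ps) (_ ∷ zs) = last-zero ps zs

  eval-replicate-0 : ∀ n x → eval (replicate n 0#) x ≈ 0#
  eval-replicate-0 zero    x = refl
  eval-replicate-0 (suc n) x = trans (+-identityˡ _) (trans (*-congˡ (eval-replicate-0 n x)) (zeroʳ x))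

  -- Binomial expansion without binomial coefficients: if (x + 1)^n = x^n + p, then (x + 1)^(n+1) =
  -- x^(n+1) + (x + 1) p + x^n. The length of the vector records that the difference has degree
  -- below n.
  [x+1]^n-x^n : ∀ n → ∃ λ (ps : Vec Carrier n) → ∀ x → (x + 1#) ^ n ≈ x ^ n + eval ps x
  [x+1]^n-x^n zero    = [] , λ x → sym (+-identityʳ 1#)
  [x+1]^n-x^n (suc n) with ps , e ← [x+1]^n-x^n n = add-x^n (times-x+1 ps) , λ x → begin
    (x + 1#) * (x + 1#) ^ n               ≈⟨ *-congˡ (e x) ⟩
    (x + 1#) * (x ^ n + eval ps x)
      ≈⟨ solve 3 (λ x y e → (x :+ :1) :* (y :+ e) := x :* y :+ ((x :+ :1) :* e :+ y)) refl x (x ^ n) (eval ps x) ⟩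
    x * x ^ n + ((x + 1#) * eval ps x + x ^ n)
      ≈⟨ +-congˡ (trans (+-congʳ (sym (eval-times-x+1 ps x))) (sym (eval-add-x^n (times-x+1 ps) x))) ⟩
    x * x ^ n + eval (add-x^n (times-x+1 ps)) x ∎
    where
    add-x^n : ∀ {n} → Vec Carrier (suc n) → Vec Carrier (suc n)
    add-x^n {zero}  (p ∷ []) = (p + 1#) ∷ []
    add-x^n {suc n} (p ∷ ps) = p ∷ add-x^n ps

    eval-add-x^n : ∀ {n} (ps : Vec Carrier (suc n)) x → eval (add-x^n ps) x ≈ eval ps x + x ^ n
    eval-add-x^n {zero}  (p ∷ []) x = solve 2 (λ p x → p :+ :1 :+ x :* :0 := p :+ x :* :0 :+ :1) refl p x
    eval-add-x^n {suc n} (p ∷ ps) x = trans (+-congˡ (*-congˡ (eval-add-x^n ps x)))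
      (solve 4 (λ p x e y → p :+ x :* (e :+ y) := p :+ x :* e :+ x :* y) refl p x (eval ps x) (x ^ n))

    carry : ∀ {n} → Carrier → Vec Carrier n → Vec Carrier (suc n)
    carry k []       = k ∷ []
    carry k (p ∷ ps) = (k + p) ∷ carry p ps

    eval-carry : ∀ {n} k (ps : Vec Carrier n) x → eval (carry k ps) x ≈ k + (x + 1#) * eval ps x
    eval-carry k []       x = solve 2 (λ k x → k :+ x :* :0 := k :+ (x :+ :1) :* :0) refl k x
    eval-carry k (p ∷ ps) x = trans (+-congˡ (*-congˡ (eval-carry p ps x)))
      (solve 4 (λ k p x e → k :+ p :+ x :* (p :+ (x :+ :1) :* e) := k :+ (x :+ :1) :* (p :+ x :* e)) refl k p x (eval ps x))

    times-x+1 : ∀ {n} → Vec Carrier n → Vec Carrier (suc n)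
    times-x+1 = carry 0#

    eval-times-x+1 : ∀ {n} (ps : Vec Carrier n) x → eval (times-x+1 ps) x ≈ (x + 1#) * eval ps x
    eval-times-x+1 ps x = trans (eval-carry 0# ps x) (+-identityˡ _)

-- The identities q · 1 = 0 and x^q = x in a field with q elements.

module _ {c ℓ} (M : CommutativeMonoid c ℓ) where
  open CommutativeMonoid M
  open CommutativeMonoidSum M

  sum-single : ∀ {n} (t : Fin n → Carrier) i → (∀ j → ¬ (j ≡ i) → t j ≈ ε) → sum t ≈ t i
  sum-single {suc n} t i t≈ε = trans (sum-remove {i = i} t) (trans
    (∙-congˡ (trans (sum-cong-≋ (λ j → t≈ε (punchIn i j) (punchInᵢ≢i i j))) (sum-replicate-zero n)))
    (identityʳ _))

module FiniteField {c ℓ} (F : Field c ℓ) {q} (size : HasSize (Field.setoid F) q) where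
  open Field F hiding (zero)
  open FieldProperties F
  open Finite setoid size
  open ProjectiveSpace F using (_·_)
  open import Relation.Binary.Reasoning.Setoid setoid

  -- Translation by 1 permutes the field, so the sum s of all elements satisfies s = q · 1 + s.
  q·1≈0 : q · 1# ≈ 0#
  q·1≈0 = modulo (- 1#) (begin
      ∑ (λ x → x)                      ≈⟨ ∑-bijection translation (λ x → x) (λ e → e) ⟩
      ∑ (1# +_)                        ≈⟨ ∑-distrib-+ (λ _ → 1#) element ⟩
      sum (λ (_ : Fin q) → 1#) + ∑ (λ x → x)  ≈⟨ +-congʳ (sum-replicate q) ⟩
      q · 1# + ∑ (λ x → x)             ∎)
    (solve 2 (λ s n → n := :0 :+ :- :1 :* (s :- (n :+ s))) refl (∑ (λ x → x)) (q · 1#))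
    where
    open FiniteSum +-commutativeMonoid size
    translation : Inverse setoid setoid
    translation = record
      { to = 1# +_ ; from = - 1# +_ ; to-cong = +-congˡ ; from-cong = +-congˡ
      ; inverse = (λ {x} e → trans (+-congˡ e) (solve 1 (λ x → :1 :+ (:- :1 :+ x) := x) refl x))
                , (λ {x} e → trans (+-congˡ e) (solve 1 (λ x → :- :1 :+ (:1 :+ x) := x) refl x))
      }

  -- Comparing the product of the nonzero elements with that of their multiples by x.
  x^q≈x : ∀ x → x ^ q ≈ x
  x^q≈x x with x ≟ 0#
  -- The index of zero is an element of `Fin q` and so excludes q = 0, where the power would be 1.
  ... | yes x≈0 = trans (^-congˡ q x≈0) (trans (0^q (index 0#)) (sym x≈0))
    where
    0^q : ∀ {n} → Fin n → 0# ^ n ≈ 0#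
    0^q {suc n} _ = zeroˡ (0# ^ n)
  ... | no  x≉0 = *-cancelˡ ∑w≉0 (begin
      ∑ w * x ^ q                             ≈⟨ *-comm _ _ ⟩
      x ^ q * ∑ w                             ≈⟨ *-congʳ (sum-replicate q) ⟨
      sum (λ (_ : Fin q) → x) * ∑ w           ≈⟨ ∑-distrib-+ (λ _ → x) (w ∘ element) ⟨
      ∑ (λ y → x * w y)                       ≈⟨ sum-cong-≋ (λ i → shift (element i)) ⟩
      ∑ (λ y → w (x * y) * u y)               ≈⟨ ∑-distrib-+ (λ i → w (x * element i)) (u ∘ element) ⟩
      ∑ (λ y → w (x * y)) * ∑ u               ≈⟨ *-cong (∑-bijection scaling w w-cong) (sym ∑u≈x) ⟨
      ∑ w * x                                 ∎)
    where
    open FiniteSum *-commutativeMonoid size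

    -- The factor at zero is replaced by 1, so that the product of `w` over the whole field is the
    -- product of its nonzero elements.
    wᵈ : ∀ y → Dec (y ≈ 0#) → Carrier
    wᵈ y (yes _) = 1#
    wᵈ y (no _)  = y

    w : Carrier → Carrier
    w y = wᵈ y (y ≟ 0#)

    -- Multiplication by x leaves zero in place, where x * w 0 = x but w (x * 0) = 1; `u` carries
    -- this single extra factor, whence its product is x.
    uᵈ : ∀ {y} → Dec (y ≈ 0#) → Carrier
    uᵈ (yes _) = x
    uᵈ (no _)  = 1#

    u : Carrier → Carrier
    u y = uᵈ (y ≟ 0#)

    w-cong : ∀ {y z} → y ≈ z → w y ≈ w z
    w-cong {y} {z} y≈z with y ≟ 0# | z ≟ 0#
    ... | yes _   | yes _   = refl
    ... | no _    | no _    = y≈z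
    ... | yes y≈0 | no z≉0  = contradiction (trans (sym y≈z) y≈0) z≉0
    ... | no y≉0  | yes z≈0 = contradiction (trans y≈z z≈0) y≉0

    shift : ∀ y → x * w y ≈ w (x * y) * u y
    shift y with y ≟ 0# | x * y ≟ 0#
    ... | yes _   | yes _    = *-comm x 1#
    ... | no _    | no _     = sym (*-identityʳ _)
    ... | yes y≈0 | no xy≉0  = contradiction y≈0 (factorʳ-≉0 xy≉0)
    ... | no y≉0  | yes xy≈0 = contradiction xy≈0 (*-≉0 x≉0 y≉0)

    w≉0 : ∀ y → ¬ (w y ≈ 0#)
    w≉0 y with y ≟ 0#
    ... | yes _  = 1≉0
    ... | no y≉0 = y≉0

    ∏≉0 : ∀ {n} (t : Fin n → Carrier) → (∀ i → ¬ (t i ≈ 0#)) → ¬ (sum t ≈ 0#)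
    ∏≉0 {zero}  t t≉0 = 1≉0
    ∏≉0 {suc n} t t≉0 = *-≉0 (t≉0 zero) (∏≉0 (t ∘ suc) (t≉0 ∘ suc))

    ∑w≉0 : ¬ (∑ w ≈ 0#)
    ∑w≉0 = ∏≉0 (w ∘ element) (w≉0 ∘ element)

    u-zero : ∀ {y} → y ≈ 0# → u y ≈ x
    u-zero {y} y≈0 with y ≟ 0#
    ... | yes _  = refl
    ... | no y≉0 = contradiction y≈0 y≉0

    u-nonzero : ∀ {y} → ¬ (y ≈ 0#) → u y ≈ 1#
    u-nonzero {y} y≉0 with y ≟ 0#
    ... | yes y≈0 = contradiction y≈0 y≉0
    ... | no _    = refl

    ∑u≈x : ∑ u ≈ x
    ∑u≈x = trans
      (sum-single *-commutativeMonoid (u ∘ element) (index 0#) λ j j≢ → u-nonzero λ e →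
        j≢ (≡.trans (≡.sym (index-element j)) (index-cong e)))
      (u-zero (element-index 0#))

    x⁻¹ = x ⁻¹[ x≉0 ]

    scaling : Inverse setoid setoid
    scaling = record
      { to = x *_ ; from = x⁻¹ *_ ; to-cong = *-congˡ ; from-cong = *-congˡ
      ; inverse = (λ {y} e → trans (*-congˡ e) (unit (trans (sym (*-assoc x x⁻¹ y)) (*-congʳ (*-inverse x≉0)))))
                , (λ {y} e → trans (*-congˡ e) (unit (trans (sym (*-assoc x⁻¹ x y)) (*-congʳ (trans (*-comm x⁻¹ x) (*-inverse x≉0))))))
      }
      where
      unit : ∀ {y z} → z ≈ 1# * y → z ≈ y
      unit e = trans e (*-identityˡ _)

-- The cubic in homogeneous parameters and the symmetric cube of a 2×2 matrix.

-- Over a raw semiring, so that the same formulas also yield the solver's polynomials.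
module CubeFormulas {a ℓ} (R : RawSemiring a ℓ) where
  open import Data.Vec.Functional using (Vector; []; _∷_)
  open RawSemiring R renaming (Carrier to A)
  open RawSemiringDefinitions R using (_^_; sum) renaming (_×_ to _·_)

  -- Homogeneous parametrisation of the cubic: `P t` arises from (t, 1) and `P∞` from (1, 0).
  cube : A → A → Vector A 4
  cube s t = s ^ 3 ∷ s ^ 2 * t ∷ s * t ^ 2 ∷ t ^ 3 ∷ []

  -- The paper's matrix M of an element of G_q.
  sym³ : (a b c d : A) → Vector (Vector A 4) 4
  sym³ a b c d =
      cube a c
    ∷ (3 · (a ^ 2 * b) ∷ a ^ 2 * d + 2 · (a * b * c) ∷ b * c ^ 2 + 2 · (a * c * d) ∷ 3 · (c ^ 2 * d) ∷ [])
    ∷ (3 · (a * b ^ 2) ∷ b ^ 2 * c + 2 · (a * b * d) ∷ a * d ^ 2 + 2 · (b * c * d) ∷ 3 · (c * d ^ 2) ∷ [])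
    ∷ cube b d
    ∷ []

  infixl 7 _⊛_
  _⊛_ : Vector A 4 → Vector (Vector A 4) 4 → Vector A 4
  (x ⊛ N) j = sum (λ i → x i * N i j)

module TwistedCubic {c ℓ} (F : Field c ℓ) where
  open Field F hiding (zero)
  open FieldProperties F hiding (_^_)
  open ProjectiveSpace F
  open SemiringSum semiring using (sum-cong-≋; *-distribˡ-sum; *-distribʳ-sum; ∑-comm)
  open CubeFormulas (Semiring.rawSemiring semiring) public using (cube; sym³)
  open import Relation.Binary.Reasoning.Setoid setoid

  polynomialRawSemiring : ℕ → RawSemiring _ _
  polynomialRawSemiring n = record
    { Carrier = Polynomial n ; _≈_ = _≡_ ; _+_ = _:+_ ; _*_ = _:*_ ; 0# = :0 ; 1# = :1 }

  module Poly {n} = CubeFormulas (polynomialRawSemiring n)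

  *ᵛ-congˡ : ∀ {x y} N → (∀ i → x i ≈ y i) → ∀ j → (x *ᵛ N) j ≈ (y *ᵛ N) j
  *ᵛ-congˡ N x≈y j = sum-cong-≋ (λ i → *-congʳ {N i j} (x≈y i))

  *ᵛ-congʳ : ∀ x {M N} → M ≈ᴹ N → ∀ j → (x *ᵛ M) j ≈ (x *ᵛ N) j
  *ᵛ-congʳ x M≈N j = sum-cong-≋ (λ i → *-congˡ {x i} (M≈N i j))

  *ᵛ-scaleˡ : ∀ k x N j → ((λ i → k * x i) *ᵛ N) j ≈ k * (x *ᵛ N) j
  *ᵛ-scaleˡ k x N j = sym (trans (*-distribˡ-sum k (λ i → x i * N i j))
    (sum-cong-≋ (λ i → sym (*-assoc k (x i) (N i j)))))

  *ᵛ-scaleʳ : ∀ x k N j → (x *ᵛ (λ i j → k * N i j)) j ≈ k * (x *ᵛ N) j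
  *ᵛ-scaleʳ x k N j = sym (trans (*-distribˡ-sum k (λ i → x i * N i j))
    (sum-cong-≋ (λ i → solve 3 (λ k x n → k :* (x :* n) := x :* (k :* n)) refl k (x i) (N i j))))

  *ᵛ-assoc : ∀ x M N j → (x *ᵛ (M *ᴹ N)) j ≈ ((x *ᵛ M) *ᵛ N) j
  *ᵛ-assoc x M N j = begin
    sum (λ i → x i * sum (λ k → M i k * N k j))
      ≈⟨ sum-cong-≋ (λ i → *-distribˡ-sum (x i) (λ k → M i k * N k j)) ⟩
    sum (λ i → sum (λ k → x i * (M i k * N k j)))
      ≈⟨ ∑-comm (λ i k → x i * (M i k * N k j)) ⟩
    sum (λ k → sum (λ i → x i * (M i k * N k j)))
      ≈⟨ sum-cong-≋ (λ k → trans (*-distribʳ-sum (N k j) (λ i → x i * M i k))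
                                   (sum-cong-≋ (λ i → *-assoc (x i) (M i k) (N k j)))) ⟨
    sum (λ k → sum (λ i → x i * M i k) * N k j) ∎

  *ᵛ-1ᴹ : ∀ x j → (x *ᵛ 1ᴹ) j ≈ x j
  *ᵛ-1ᴹ x = λ where
      0F → solve 4 (λ x y z w → x :* :1 :+ (y :* :0 :+ (z :* :0 :+ (w :* :0 :+ :0))) := x) refl _ _ _ _
      1F → solve 4 (λ x y z w → x :* :0 :+ (y :* :1 :+ (z :* :0 :+ (w :* :0 :+ :0))) := y) refl (x 0F) _ _ _
      2F → solve 4 (λ x y z w → x :* :0 :+ (y :* :0 :+ (z :* :1 :+ (w :* :0 :+ :0))) := z) refl (x 0F) (x 1F) _ _
      3F → solve 4 (λ x y z w → x :* :0 :+ (y :* :0 :+ (z :* :0 :+ (w :* :1 :+ :0))) := w) refl (x 0F) (x 1F) (x 2F) _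

  *ᵛ-scalar : ∀ k x {N} → (∀ i j → N i j ≈ k * 1ᴹ i j) → ∀ j → (x *ᵛ N) j ≈ k * x j
  *ᵛ-scalar k x N≈k j = trans (*ᵛ-congʳ x N≈k j) (trans (*ᵛ-scaleʳ x k 1ᴹ j) (*-congˡ (*ᵛ-1ᴹ x j)))

  *ᵛ-combine : ∀ a x b y N j → ((λ i → a * x i + b * y i) *ᵛ N) j ≈ a * (x *ᵛ N) j + b * (y *ᵛ N) j
  *ᵛ-combine a x b y N j = solve 14 (λ a b x₀ x₁ x₂ x₃ y₀ y₁ y₂ y₃ n₀ n₁ n₂ n₃ →
      (a :* x₀ :+ b :* y₀) :* n₀ :+ ((a :* x₁ :+ b :* y₁) :* n₁ :+ ((a :* x₂ :+ b :* y₂) :* n₂ :+ ((a :* x₃ :+ b :* y₃) :* n₃ :+ :0)))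
      := a :* (x₀ :* n₀ :+ (x₁ :* n₁ :+ (x₂ :* n₂ :+ (x₃ :* n₃ :+ :0)))) :+ b :* (y₀ :* n₀ :+ (y₁ :* n₁ :+ (y₂ :* n₂ :+ (y₃ :* n₃ :+ :0)))))
    refl a b (x 0F) (x 1F) (x 2F) (x 3F) (y 0F) (y 1F) (y 2F) (y 3F) (N 0F j) (N 1F j) (N 2F j) (N 3F j)

  cube-cong : ∀ {s s′ t t′} → s ≈ s′ → t ≈ t′ → ∀ j → cube s t j ≈ cube s′ t′ j
  cube-cong s≈ t≈ = λ where
    0F → ^-congˡ 3 s≈
    1F → *-cong (^-congˡ 2 s≈) t≈
    2F → *-cong s≈ (^-congˡ 2 t≈)
    3F → ^-congˡ 3 t≈

  cube-scale : ∀ k s t j → cube (k * s) (k * t) j ≈ k ^ 3 * cube s t j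
  cube-scale k s t = λ where
      0F → solve 3 (λ k s t → Poly.cube (k :* s) (k :* t) 0F := k :* (k :* (k :* :1)) :* Poly.cube s t 0F) refl k s t
      1F → solve 3 (λ k s t → Poly.cube (k :* s) (k :* t) 1F := k :* (k :* (k :* :1)) :* Poly.cube s t 1F) refl k s t
      2F → solve 3 (λ k s t → Poly.cube (k :* s) (k :* t) 2F := k :* (k :* (k :* :1)) :* Poly.cube s t 2F) refl k s t
      3F → solve 3 (λ k s t → Poly.cube (k :* s) (k :* t) 3F := k :* (k :* (k :* :1)) :* Poly.cube s t 3F) refl k s t

  -- Column j of `sym³` lists the coefficients of the j-th monomial in the forms a s + b t and c s +
  -- d t, so on the cubic the matrix acts on parameters as the Möbius map (a t + b) / (c t + d).
  cube-sym³ : ∀ s t a b c d j → (cube s t *ᵛ sym³ a b c d) j ≈ cube (a * s + b * t) (c * s + d * t) j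
  cube-sym³ s t a b c d = λ where
      0F → solve 6 (λ s t a b c d → (Poly.cube s t Poly.⊛ Poly.sym³ a b c d) 0F := Poly.cube (a :* s :+ b :* t) (c :* s :+ d :* t) 0F) refl s t a b c d
      1F → solve 6 (λ s t a b c d → (Poly.cube s t Poly.⊛ Poly.sym³ a b c d) 1F := Poly.cube (a :* s :+ b :* t) (c :* s :+ d :* t) 1F) refl s t a b c d
      2F → solve 6 (λ s t a b c d → (Poly.cube s t Poly.⊛ Poly.sym³ a b c d) 2F := Poly.cube (a :* s :+ b :* t) (c :* s :+ d :* t) 2F) refl s t a b c d
      3F → solve 6 (λ s t a b c d → (Poly.cube s t Poly.⊛ Poly.sym³ a b c d) 3F := Poly.cube (a :* s :+ b :* t) (c :* s :+ d :* t) 3F) refl s t a b c d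

  cube-cubic : ∀ {N k a b c d} → (∀ i j → N i j ≈ k * sym³ a b c d i j) →
               ∀ s t j → (cube s t *ᵛ N) j ≈ k * cube (a * s + b * t) (c * s + d * t) j
  cube-cubic {N} {k} {a} {b} {c} {d} N≈ s t j = trans (*ᵛ-congʳ (cube s t) N≈ j)
    (trans (*ᵛ-scaleʳ (cube s t) k (sym³ a b c d) j) (*-congˡ (cube-sym³ s t a b c d j)))

  Nonzero² : Carrier → Carrier → Set ℓ
  Nonzero² s t = ¬ (s ≈ 0# × t ≈ 0#)

  det : (a b c d : Carrier) → Carrier
  det a b c d = a * d - b * c

  cube-sym³-adjugate : ∀ s t a b c d j →
    (cube s t *ᵛ sym³ d (- b) (- c) a) j ≈ cube (d * s - b * t) (a * t - c * s) j
  cube-sym³-adjugate s t a b c d j = trans (cube-sym³ s t d (- b) (- c) a j)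
    (cube-cong (solve 4 (λ s t b d → d :* s :+ :- b :* t := d :* s :- b :* t) refl s t b d)
               (solve 4 (λ s t a c → :- c :* s :+ a :* t := a :* t :- c :* s) refl s t a c) j)

  Nonzero²-map : ∀ {a b c d s t} → ¬ (det a b c d ≈ 0#) → Nonzero² s t → Nonzero² (a * s + b * t) (c * s + d * t)
  Nonzero²-map {a} {b} {c} {d} {s} {t} δ≉0 st≉0 (u≈0 , w≈0) = st≉0
    ( *≈0⇒≈0 δ≉0 (modulo d u≈0 (modulo (- b) w≈0
        (solve 6 (λ a b c d s t → (a :* d :- b :* c) :* s
            := :0 :+ d :* (a :* s :+ b :* t :- :0) :+ :- b :* (c :* s :+ d :* t :- :0)) refl a b c d s t)))
    , *≈0⇒≈0 δ≉0 (modulo (- c) u≈0 (modulo a w≈0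
        (solve 6 (λ a b c d s t → (a :* d :- b :* c) :* t
            := :0 :+ :- c :* (a :* s :+ b :* t :- :0) :+ a :* (c :* s :+ d :* t :- :0)) refl a b c d s t))))

  module _ (_≟_ : ∀ x y → Dec (x ≈ y)) where

    -- Injectivity of the parametrisation: for s ≠ 0 the ratio s : t is visible in the first two
    -- coordinates, otherwise t ≠ 0 and it is visible in the last two.
    cube-∝ : ∀ {k l s t s′ t′} → ¬ (k ≈ 0#) → Nonzero² s t →
             (∀ j → k * cube s t j ≈ l * cube s′ t′ j) → s * t′ ≈ s′ * t
    cube-∝ {k} {l} {s} {t} {s′} {t′} k≉0 st≉0 e with s ≟ 0#
    ... | no s≉0 = -‿≈0⇒≈ (*≈0⇒≈0 (*-≉0 k≉0 (*-≉0 s≉0 s≉0)) (modulo t′ (e 0F) (modulo (- s′) (e 1F)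
          (solve 6 (λ k l s t s′ t′ → k :* (s :* s) :* (s :* t′ :- s′ :* t)
              := :0 :+ t′ :* (k :* Poly.cube s t 0F :- l :* Poly.cube s′ t′ 0F)
                    :+ :- s′ :* (k :* Poly.cube s t 1F :- l :* Poly.cube s′ t′ 1F))
            refl k l s t s′ t′))))
    ... | yes s≈0 = -‿≈0⇒≈ (*≈0⇒≈0 (*-≉0 k≉0 (*-≉0 t≉0 t≉0)) (modulo t′ (e 2F) (modulo (- s′) (e 3F)
          (solve 6 (λ k l s t s′ t′ → k :* (t :* t) :* (s :* t′ :- s′ :* t)
              := :0 :+ t′ :* (k :* Poly.cube s t 2F :- l :* Poly.cube s′ t′ 2F)
                    :+ :- s′ :* (k :* Poly.cube s t 3F :- l :* Poly.cube s′ t′ 3F))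
            refl k l s t s′ t′))))
      where
      t≉0 : ¬ (t ≈ 0#)
      t≉0 t≈0 = st≉0 (s≈0 , t≈0)

    parallel : ∀ {s t s′ t′} → Nonzero² s′ t′ → s * t′ ≈ s′ * t → ∃ λ m → s ≈ m * s′ × t ≈ m * t′
    parallel {s} {t} {s′} {t′} st′≉0 e with s′ ≟ 0#
    ... | no s′≉0 = s * i
          , modulo (- s) (*-inverse s′≉0) (solve 3 (λ s s′ i → s := s :* i :* s′ :+ :- s :* (s′ :* i :- :1)) refl s s′ i)
          , modulo (- t) (*-inverse s′≉0) (modulo (- i) e
              (solve 5 (λ s s′ t t′ i → t := s :* i :* t′ :+ :- t :* (s′ :* i :- :1) :+ :- i :* (s :* t′ :- s′ :* t)) refl s s′ t t′ i))
      where i = s′ ⁻¹[ s′≉0 ]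
    ... | yes s′≈0 = t * i
          , modulo (- s) (*-inverse t′≉0) (modulo i e
              (solve 5 (λ s s′ t t′ i → s := t :* i :* s′ :+ :- s :* (t′ :* i :- :1) :+ i :* (s :* t′ :- s′ :* t)) refl s s′ t t′ i))
          , modulo (- t) (*-inverse t′≉0) (solve 3 (λ s s′ i → s := s :* i :* s′ :+ :- s :* (s′ :* i :- :1)) refl t t′ i)
      where
      t′≉0 : ¬ (t′ ≈ 0#)
      t′≉0 t′≈0 = st′≉0 (s′≈0 , t′≈0)
      i = t′ ⁻¹[ t′≉0 ]

-- The group of the cubic is PGL(2,q).

module CubicGroup {c ℓ} (F : Field c ℓ) {q} (size : HasSize (Field.setoid F) q) (5≤q : 5 ≤ q) where
  open Field F hiding (zero)
  open FieldProperties F hiding (_^_)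
  open ProjectiveSpace F
  open Finite setoid size
  open Polynomials F
  open TwistedCubic F
  open import Relation.Binary.Reasoning.Setoid setoid

  private
    -- From q ≥ 5: one nonzero parameter for each coefficient of a polynomial of degree at most 3.
    fourNonzero : ∃ λ (r : Fin 4 → Carrier) → (∀ {i j} → r i ≈ r j → i ≡ j) × (∀ i → ¬ (r i ≈ 0#))
    fourNonzero = go 5≤q element (index 0#) element-injective (element-index 0#)
      where
      go : ∀ {n} → 5 ≤ n → (e : Fin n → Carrier) (z : Fin n) → (∀ {i j} → e i ≈ e j → i ≡ j) → e z ≈ 0# →
           ∃ λ (r : Fin 4 → Carrier) → (∀ {i j} → r i ≈ r j → i ≡ j) × (∀ i → ¬ (r i ≈ 0#))
      go (s≤s 4≤n) e z e-inj ez≈0 = (λ i → e (punchIn z (inject≤ i 4≤n)))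
        , (λ r≈r → inject≤-injective 4≤n 4≤n _ _ (punchIn-injective z _ _ (e-inj r≈r)))
        , (λ i r≈0 → punchInᵢ≢i z _ (e-inj (trans r≈0 (sym ez≈0))))

  cubic-zero : (ps : Vec.Vec Carrier 4) → (∀ t → ¬ (t ≈ 0#) → eval ps t ≈ 0#) → All (_≈ 0#) ps
  cubic-zero ps vanishes = let r , r-inj , r≉0 = fourNonzero in
    roots⇒zero ps r r-inj (λ i → vanishes (r i) (r≉0 i))

  -- Each coordinate of P(t) A is a cubic polynomial in t whose coefficients form a column of A.
  -- Identities between matrices thus reduce to identities between maps of parameters, which is how
  -- scaling and products of `sym³` are handled below.
  cubic-determines : ∀ {A B} → (∀ t j → (cube t 1# *ᵛ A) j ≈ (cube t 1# *ᵛ B) j) → A ≈ᴹ B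
  cubic-determines {A} {B} agree i j = pick i (cubic-zero
      (D 3F Vec.∷ D 2F Vec.∷ D 1F Vec.∷ D 0F Vec.∷ Vec.[]) λ t _ → modulo 1# (agree t j)
        (solve 9 (λ t a b c d a′ b′ c′ d′ →
            d :- d′ :+ t :* (c :- c′ :+ t :* (b :- b′ :+ t :* (a :- a′ :+ t :* :0)))
              := :0 :+ :1 :* (form t a b c d :- form t a′ b′ c′ d′))
          refl t (A 0F j) (A 1F j) (A 2F j) (A 3F j) (B 0F j) (B 1F j) (B 2F j) (B 3F j)))
    where
    D : Fin 4 → Carrier
    D i = A i j - B i j
    form : ∀ {n} → (t a b c d : Polynomial n) → Polynomial n
    form t a b c d = (Poly.cube t :1 0F) :* a :+ ((Poly.cube t :1 1F) :* b
                   :+ ((Poly.cube t :1 2F) :* c :+ ((Poly.cube t :1 3F) :* d :+ :0)))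
    pick : ∀ i → All (_≈ 0#) (D 3F Vec.∷ D 2F Vec.∷ D 1F Vec.∷ D 0F Vec.∷ Vec.[]) → A i j ≈ B i j
    pick 0F (_ All.∷ _ All.∷ _ All.∷ z All.∷ _) = -‿≈0⇒≈ z
    pick 1F (_ All.∷ _ All.∷ z All.∷ _ All.∷ _) = -‿≈0⇒≈ z
    pick 2F (_ All.∷ z All.∷ _ All.∷ _ All.∷ _) = -‿≈0⇒≈ z
    pick 3F (z All.∷ _ All.∷ _ All.∷ _ All.∷ _) = -‿≈0⇒≈ z

  ≈sym³ : ∀ {N} a b c d → (∀ t j → (cube t 1# *ᵛ N) j ≈ cube (a * t + b * 1#) (c * t + d * 1#) j) → N ≈ᴹ sym³ a b c d
  ≈sym³ a b c d e = cubic-determines (λ t j → trans (e t j) (sym (cube-sym³ t 1# a b c d j)))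

  sym³-cong : ∀ {a a′ b b′ c c′ d d′} → a ≈ a′ → b ≈ b′ → c ≈ c′ → d ≈ d′ → sym³ a b c d ≈ᴹ sym³ a′ b′ c′ d′
  sym³-cong {a} {a′} {b} {b′} {c} {c′} {d} {d′} a≈ b≈ c≈ d≈ = ≈sym³ a′ b′ c′ d′ λ t j →
    trans (cube-sym³ t 1# a b c d j)
      (cube-cong (+-cong (*-congʳ a≈) (*-congʳ b≈)) (+-cong (*-congʳ c≈) (*-congʳ d≈)) j)

  sym³-scale : ∀ k a b c d → ∀ i j → sym³ (k * a) (k * b) (k * c) (k * d) i j ≈ k ^ 3 * sym³ a b c d i j
  sym³-scale k a b c d = cubic-determines {B = λ i j → k ^ 3 * sym³ a b c d i j} λ t j → begin
    (cube t 1# *ᵛ sym³ (k * a) (k * b) (k * c) (k * d)) j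
      ≈⟨ cube-sym³ t 1# (k * a) (k * b) (k * c) (k * d) j ⟩
    cube (k * a * t + k * b * 1#) (k * c * t + k * d * 1#) j
      ≈⟨ cube-cong (pull a b t) (pull c d t) j ⟩
    cube (k * (a * t + b * 1#)) (k * (c * t + d * 1#)) j
      ≈⟨ cube-scale k (a * t + b * 1#) (c * t + d * 1#) j ⟩
    k ^ 3 * cube (a * t + b * 1#) (c * t + d * 1#) j
      ≈⟨ *-congˡ (cube-sym³ t 1# a b c d j) ⟨
    k ^ 3 * (cube t 1# *ᵛ sym³ a b c d) j
      ≈⟨ *ᵛ-scaleʳ (cube t 1#) (k ^ 3) (sym³ a b c d) j ⟨
    (cube t 1# *ᵛ (λ i j → k ^ 3 * sym³ a b c d i j)) j ∎
    where
    pull : ∀ a b t → k * a * t + k * b * 1# ≈ k * (a * t + b * 1#)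
    pull a b t = solve 4 (λ k a b t → k :* a :* t :+ k :* b :* :1 := k :* (a :* t :+ b :* :1)) refl k a b t

  -- Both matrices send the parameter (t, 1) to (δ t, δ). Only products that are scalar on
  -- parameters are treated, for use with the adjugate.
  sym³-*-scalar : ∀ {a b c d a′ b′ c′ d′ δ} → a′ * a + b′ * c ≈ δ → a′ * b + b′ * d ≈ 0# →
                  c′ * a + d′ * c ≈ 0# → c′ * b + d′ * d ≈ δ →
                  ∀ i j → (sym³ a b c d *ᴹ sym³ a′ b′ c′ d′) i j ≈ δ ^ 3 * 1ᴹ i j
  sym³-*-scalar {a} {b} {c} {d} {a′} {b′} {c′} {d′} {δ} e₁ e₂ e₃ e₄ = cubic-determines {B = λ i j → δ ^ 3 * 1ᴹ i j} λ t j → begin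
    (cube t 1# *ᵛ (sym³ a b c d *ᴹ sym³ a′ b′ c′ d′)) j
      ≈⟨ *ᵛ-assoc (cube t 1#) (sym³ a b c d) (sym³ a′ b′ c′ d′) j ⟩
    ((cube t 1# *ᵛ sym³ a b c d) *ᵛ sym³ a′ b′ c′ d′) j
      ≈⟨ *ᵛ-congˡ (sym³ a′ b′ c′ d′) (cube-sym³ t 1# a b c d) j ⟩
    (cube (a * t + b * 1#) (c * t + d * 1#) *ᵛ sym³ a′ b′ c′ d′) j
      ≈⟨ cube-sym³ (a * t + b * 1#) (c * t + d * 1#) a′ b′ c′ d′ j ⟩
    cube (a′ * (a * t + b * 1#) + b′ * (c * t + d * 1#)) (c′ * (a * t + b * 1#) + d′ * (c * t + d * 1#)) j
      ≈⟨ cube-cong (trans (regroup a′ b′ t) (+-cong (*-congʳ e₁) e₂)) (trans (regroup c′ d′ t) (+-cong (*-congʳ e₃) e₄)) j ⟩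
    cube (δ * t + 0#) (0# * t + δ) j
      ≈⟨ cube-cong (+-identityʳ (δ * t)) (solve 2 (λ δ t → :0 :* t :+ δ := δ :* :1) refl δ t) j ⟩
    cube (δ * t) (δ * 1#) j
      ≈⟨ cube-scale δ t 1# j ⟩
    δ ^ 3 * cube t 1# j
      ≈⟨ *ᵛ-scalar (δ ^ 3) (cube t 1#) {λ i j → δ ^ 3 * 1ᴹ i j} (λ _ _ → refl) j ⟨
    (cube t 1# *ᵛ (λ i j → δ ^ 3 * 1ᴹ i j)) j ∎
    where
    regroup : ∀ a′ b′ t → a′ * (a * t + b * 1#) + b′ * (c * t + d * 1#) ≈ (a′ * a + b′ * c) * t + (a′ * b + b′ * d)
    regroup a′ b′ t = solve 7 (λ a b c d a′ b′ t → a′ :* (a :* t :+ b :* :1) :+ b′ :* (c :* t :+ d :* :1)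
      := (a′ :* a :+ b′ :* c) :* t :+ (a′ :* b :+ b′ :* d)) refl a b c d a′ b′ t

  sym³-adjugateʳ : ∀ a b c d i j → (sym³ a b c d *ᴹ sym³ d (- b) (- c) a) i j ≈ det a b c d ^ 3 * 1ᴹ i j
  sym³-adjugateʳ a b c d = sym³-*-scalar
    (solve 4 (λ a b c d → d :* a :+ :- b :* c := a :* d :- b :* c) refl a b c d)
    (solve 2 (λ b d → d :* b :+ :- b :* d := :0) refl b d)
    (solve 2 (λ a c → :- c :* a :+ a :* c := :0) refl a c)
    (solve 4 (λ a b c d → :- c :* b :+ a :* d := a :* d :- b :* c) refl a b c d)

  sym³-adjugateˡ : ∀ a b c d i j → (sym³ d (- b) (- c) a *ᴹ sym³ a b c d) i j ≈ det a b c d ^ 3 * 1ᴹ i j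
  sym³-adjugateˡ a b c d = sym³-*-scalar
    (solve 4 (λ a b c d → a :* d :+ b :* :- c := a :* d :- b :* c) refl a b c d)
    (solve 2 (λ a b → a :* :- b :+ b :* a := :0) refl a b)
    (solve 2 (λ c d → c :* d :+ d :* :- c := :0) refl c d)
    (solve 4 (λ a b c d → c :* :- b :+ d :* a := a :* d :- b :* c) refl a b c d)

  undo : ∀ {k a b c d N} → (∀ i j → N i j ≈ k * sym³ a b c d i j) →
         ∀ v j → ((v *ᵛ N) *ᵛ sym³ d (- b) (- c) a) j ≈ k * det a b c d ^ 3 * v j
  undo {k} {a} {b} {c} {d} {N} e v j = begin
    ((v *ᵛ N) *ᵛ A) j                     ≈⟨ *ᵛ-congˡ A (λ i → trans (*ᵛ-congʳ v e i) (*ᵛ-scaleʳ v k S i)) j ⟩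
    ((λ i → k * (v *ᵛ S) i) *ᵛ A) j       ≈⟨ *ᵛ-scaleˡ k (v *ᵛ S) A j ⟩
    k * ((v *ᵛ S) *ᵛ A) j                 ≈⟨ *-congˡ (*ᵛ-assoc v S A j) ⟨
    k * (v *ᵛ (S *ᴹ A)) j                 ≈⟨ *-congˡ (*ᵛ-scalar _ v {S *ᴹ A} (sym³-adjugateʳ a b c d) j) ⟩
    k * (det a b c d ^ 3 * v j)           ≈⟨ *-assoc k _ _ ⟨
    k * det a b c d ^ 3 * v j             ∎
    where
    S = sym³ a b c d
    A = sym³ d (- b) (- c) a

  cubicProjectivity : ∀ a b c d → ¬ (det a b c d ≈ 0#) → Projectivity
  cubicProjectivity a b c d δ≉0 = projectivity S
      ( (λ i j → δ⁻³ * A i j)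
      , (λ i j → trans (*ᵛ-scaleˡ δ⁻³ (A i) S j) (trans (*-congˡ (sym³-adjugateˡ a b c d i j)) (unit i j)))
      , (λ i j → trans (*ᵛ-scaleʳ (S i) δ⁻³ A j) (trans (*-congˡ (sym³-adjugateʳ a b c d i j)) (unit i j))))
    where
    S = sym³ a b c d
    A = sym³ d (- b) (- c) a
    δ⁻³ = (det a b c d ^ 3) ⁻¹[ ^3-≉0 δ≉0 ]
    unit : ∀ i j → δ⁻³ * (det a b c d ^ 3 * 1ᴹ i j) ≈ 1ᴹ i j
    unit i j = trans (sym (*-assoc _ _ _)) (trans (*-congʳ (trans (*-comm _ _) (*-inverse (^3-≉0 δ≉0)))) (*-identityˡ _))

  homogeneous : Maybe Carrier → Carrier × Carrier
  homogeneous (just t) = t , 1#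
  homogeneous nothing  = 1# , 0#

  cube-homogeneous : ∀ p j → coords (cubicPoint p) j ≈ cube (proj₁ (homogeneous p)) (proj₂ (homogeneous p)) j
  cube-homogeneous (just t) = λ where
    0F → refl
    1F → sym (*-identityʳ _)
    2F → solve 1 (λ t → t := t :* (:1 :* (:1 :* :1))) refl t
    3F → solve 0 (:1 := :1 :* (:1 :* (:1 :* :1))) refl
  cube-homogeneous nothing = λ where
    0F → solve 0 (:1 := :1 :* (:1 :* (:1 :* :1))) refl
    1F → sym (zeroʳ _)
    2F → solve 0 (:0 := :1 :* (:0 :* (:0 :* :1))) refl
    3F → solve 0 (:0 := :0 :* (:0 :* (:0 :* :1))) refl

  homogeneous-nonzero : ∀ p → Nonzero² (proj₁ (homogeneous p)) (proj₂ (homogeneous p))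
  homogeneous-nonzero (just t) (_ , 1≈0) = 1≉0 1≈0
  homogeneous-nonzero nothing  (1≈0 , _) = 1≉0 1≈0

  -- `OnCubic` with a pair (s, t) in place of a parameter that may be ∞, so that linear
  -- substitutions act without case distinctions. The scalar k stays separate because rescaling (s,
  -- t) only changes it by cubes.
  OnCube : Vec₄ → Set _
  OnCube x = ∃ λ k → ∃₂ λ s t → ¬ (k ≈ 0#) × Nonzero² s t × (∀ j → x j ≈ k * cube s t j)

  OnCubic⇒OnCube : ∀ x → OnCubic x → OnCube (coords x)
  OnCubic⇒OnCube x (p , k , k≉0 , e) =
    k , _ , _ , k≉0 , homogeneous-nonzero p , λ j → trans (e j) (*-congˡ (cube-homogeneous p j))

  OnCube⇒OnCubic : ∀ x → OnCube (coords x) → OnCubic x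
  OnCube⇒OnCubic x (k , s , t , k≉0 , st≉0 , e) with t ≟ 0#
  ... | no t≉0 = just (s * t⁻¹) , k * t ^ 3 , *-≉0 k≉0 (^3-≉0 t≉0) , λ j → begin
      coords x j                          ≈⟨ e j ⟩
      k * cube s t j                      ≈⟨ *-congˡ (cube-cong s≈ (sym (*-identityʳ t)) j) ⟩
      k * cube (t * (s * t⁻¹)) (t * 1#) j ≈⟨ *-congˡ (cube-scale t (s * t⁻¹) 1# j) ⟩
      k * (t ^ 3 * cube (s * t⁻¹) 1# j)   ≈⟨ *-assoc _ _ _ ⟨
      k * t ^ 3 * cube (s * t⁻¹) 1# j     ≈⟨ *-congˡ (cube-homogeneous (just (s * t⁻¹)) j) ⟨
      k * t ^ 3 * coords (P (s * t⁻¹)) j  ∎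
    where
    t⁻¹ = t ⁻¹[ t≉0 ]
    s≈ : s ≈ t * (s * t⁻¹)
    s≈ = modulo (- s) (*-inverse t≉0) (solve 3 (λ s t i → s := t :* (s :* i) :+ :- s :* (t :* i :- :1)) refl s t t⁻¹)
  ... | yes t≈0 = nothing , k * s ^ 3 , *-≉0 k≉0 (^3-≉0 s≉0) , λ j → begin
      coords x j                          ≈⟨ e j ⟩
      k * cube s t j                      ≈⟨ *-congˡ (cube-cong (sym (*-identityʳ s)) (trans t≈0 (sym (zeroʳ s))) j) ⟩
      k * cube (s * 1#) (s * 0#) j        ≈⟨ *-congˡ (cube-scale s 1# 0# j) ⟩
      k * (s ^ 3 * cube 1# 0# j)          ≈⟨ *-assoc _ _ _ ⟨
      k * s ^ 3 * cube 1# 0# j            ≈⟨ *-congˡ (cube-homogeneous nothing j) ⟨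
      k * s ^ 3 * coords P∞ j             ∎
    where
    s≉0 : ¬ (s ≈ 0#)
    s≉0 s≈0 = st≉0 (s≈0 , t≈0)

  record IsCubic (N : Matrix) : Set (c Level.⊔ ℓ) where
    constructor isCubic
    field
      {k a b c′ d} : Carrier
      k≉0          : ¬ (k ≈ 0#)
      δ≉0          : ¬ (det a b c′ d ≈ 0#)
      N≈           : ∀ i j → N i j ≈ k * sym³ a b c′ d i j

  OnCube-map : ∀ {x N k a b c d} → ¬ (k ≈ 0#) → ¬ (det a b c d ≈ 0#) → (∀ i j → N i j ≈ k * sym³ a b c d i j) →
               OnCube x → OnCube (x *ᵛ N)
  OnCube-map {x} {N} {k} {a} {b} {c} {d} k≉0 δ≉0 N≈ (m , s , t , m≉0 , st≉0 , x≈) =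
    m * k , _ , _ , *-≉0 m≉0 k≉0 , Nonzero²-map δ≉0 st≉0 , λ j → begin
      (x *ᵛ N) j                                            ≈⟨ *ᵛ-congˡ N x≈ j ⟩
      ((λ i → m * cube s t i) *ᵛ N) j                       ≈⟨ *ᵛ-scaleˡ m (cube s t) N j ⟩
      m * (cube s t *ᵛ N) j                                 ≈⟨ *-congˡ (cube-cubic N≈ s t j) ⟩
      m * (k * cube (a * s + b * t) (c * s + d * t) j)      ≈⟨ *-assoc _ _ _ ⟨
      m * k * cube (a * s + b * t) (c * s + d * t) j        ∎

  OnCube-unscale : ∀ {x y k} → ¬ (k ≈ 0#) → (∀ j → y j ≈ k * x j) → OnCube y → OnCube x
  OnCube-unscale {x} {y} {k} k≉0 y≈kx (m , s , t , m≉0 , st≉0 , y≈) =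
    k⁻¹ * m , s , t , *-≉0 (⁻¹-≉0 k≉0) m≉0 , st≉0 , λ j → modulo (- x j) (*-inverse k≉0) (modulo k⁻¹ (trans (sym (y≈kx j)) (y≈ j))
      (solve 5 (λ x k i m e → x := i :* m :* e :+ :- x :* (k :* i :- :1) :+ i :* (k :* x :- m :* e)) refl (x j) k k⁻¹ m (cube s t j)))
    where k⁻¹ = k ⁻¹[ k≉0 ]

  det-adjugate : ∀ a b c d → det d (- b) (- c) a ≈ det a b c d
  det-adjugate = solve 4 (λ a b c d → d :* a :- :- b :* :- c := a :* d :- b :* c) refl

  IsCubic⇒InG : ∀ g → IsCubic (matrix g) → InG g
  IsCubic⇒InG g (isCubic {k} {a} {b} {c} {d} k≉0 δ≉0 N≈) x = mk⇔
    (λ x∈ → OnCube⇒OnCubic (act g x) (OnCube-map k≉0 δ≉0 N≈ (OnCubic⇒OnCube x x∈)))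
    -- Membership is pulled back along the adjugate, which undoes g up to the nonzero scalar k δ³.
    (λ xg∈ → OnCube⇒OnCubic x (OnCube-unscale (*-≉0 k≉0 (^3-≉0 δ≉0)) (undo N≈ (coords x))
      (OnCube-map 1≉0 (δ≉0 ∘ trans (sym (det-adjugate a b c d))) (λ _ _ → sym (*-identityˡ _)) (OnCubic⇒OnCube (act g x) xg∈))))

  *≈0⇒≈0ʳ : ∀ {x y} → ¬ (y ≈ 0#) → x * y ≈ 0# → x ≈ 0#
  *≈0⇒≈0ʳ y≉0 e = *≈0⇒≈0 y≉0 (trans (*-comm _ _) e)

  -- If L fixes P(∞), P(0) and P(1) and maps the cubic to itself, then the four coordinates of
  -- P(t) L are cubic polynomials in t, and the equations x₀x₂ = x₁² and x₁x₃ = x₂² of the cubic,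
  -- divided by t² and t, become polynomials of degree 3 with at least 4 roots.
  frame-fixing : ∀ {L : Matrix} {ν} →
    ¬ (L 0F 0F ≈ 0#) → L 0F 1F ≈ 0# → L 0F 2F ≈ 0# → L 0F 3F ≈ 0# →
    L 3F 0F ≈ 0# → L 3F 1F ≈ 0# → L 3F 2F ≈ 0# → ¬ (L 3F 3F ≈ 0#) →
    ¬ (ν ≈ 0#) → (∀ j → L 0F j + (L 1F j + (L 2F j + L 3F j)) ≈ ν) →
    (∀ t → ∃ λ k → ∃₂ λ s u → ∀ j → (cube t 1# *ᵛ L) j ≈ k * cube s u j) →
    ∀ i j → L i j ≈ ν * 1ᴹ i j
  frame-fixing {L} {ν} λ≉0 L₀₁ L₀₂ L₀₃ L₃₀ L₃₁ L₃₂ μ≉0 ν≉0 columns onCubic =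
    solution (cubic-zero ps₁ (λ t t≉0 → first t t≉0 (onCubic t))) (cubic-zero ps₂ (λ t t≉0 → second t t≉0 (onCubic t)))
    where
    l = L 0F 0F
    m = L 3F 3F
    p₀ = L 1F 0F
    p₁ = L 1F 1F
    p₂ = L 1F 2F
    p₃ = L 1F 3F
    q₀ = L 2F 0F
    q₁ = L 2F 1F
    q₂ = L 2F 2F
    q₃ = L 2F 3F

    ps₁ ps₂ : Vec.Vec Carrier 4
    ps₁ = (q₀ * q₂ - q₁ * q₁) Vec.∷ (p₀ * q₂ + q₀ * p₂ - (p₁ * q₁ + p₁ * q₁))
          Vec.∷ (l * q₂ + p₀ * p₂ - p₁ * p₁) Vec.∷ l * p₂ Vec.∷ Vec.[]
    ps₂ = q₁ * m Vec.∷ (p₁ * m + q₁ * q₃ - q₂ * q₂)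
          Vec.∷ (p₁ * q₃ + q₁ * p₃ - (p₂ * q₂ + p₂ * q₂)) Vec.∷ (p₁ * p₃ - p₂ * p₂) Vec.∷ Vec.[]

    column : ∀ {n} → (t a b c d : Polynomial n) → Polynomial n
    column t a b c d = (Poly.cube t :1 0F) :* a :+ ((Poly.cube t :1 1F) :* b
                     :+ ((Poly.cube t :1 2F) :* c :+ ((Poly.cube t :1 3F) :* d :+ :0)))

    x₀ : ∀ t → (cube t 1# *ᵛ L) 0F ≈ t * (t * (t * l) + t * p₀ + q₀)
    x₀ t = modulo 1# L₃₀ (solve 5 (λ t a b c d → column t a b c d := t :* (t :* (t :* a) :+ t :* b :+ c) :+ :1 :* (d :- :0))
      refl t l p₀ q₀ (L 3F 0F))

    x₁ : ∀ t → (cube t 1# *ᵛ L) 1F ≈ t * (t * p₁ + q₁)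
    x₁ t = modulo (t * t * t) L₀₁ (modulo 1# L₃₁ (solve 5 (λ t a b c d → column t a b c d
      := t :* (t :* b :+ c) :+ t :* t :* t :* (a :- :0) :+ :1 :* (d :- :0)) refl t (L 0F 1F) p₁ q₁ (L 3F 1F)))

    x₂ : ∀ t → (cube t 1# *ᵛ L) 2F ≈ t * (t * p₂ + q₂)
    x₂ t = modulo (t * t * t) L₀₂ (modulo 1# L₃₂ (solve 5 (λ t a b c d → column t a b c d
      := t :* (t :* b :+ c) :+ t :* t :* t :* (a :- :0) :+ :1 :* (d :- :0)) refl t (L 0F 2F) p₂ q₂ (L 3F 2F)))

    x₃ : ∀ t → (cube t 1# *ᵛ L) 3F ≈ t * (t * p₃) + t * q₃ + m
    x₃ t = modulo (t * t * t) L₀₃ (solve 5 (λ t a b c d → column t a b c d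
      := t :* (t :* b) :+ t :* c :+ d :+ t :* t :* t :* (a :- :0)) refl t (L 0F 3F) p₃ q₃ m)

    first : ∀ t → ¬ (t ≈ 0#) → (∃ λ k → ∃₂ λ s u → ∀ j → (cube t 1# *ᵛ L) j ≈ k * cube s u j) → eval ps₁ t ≈ 0#
    first t t≉0 (k , s , u , e) = *≈0⇒≈0 (*-≉0 t≉0 t≉0) (begin
      t * t * eval ps₁ t
        ≈⟨ solve 8 (λ t l p₀ p₁ p₂ q₀ q₁ q₂ →
             t :* t :* (q₀ :* q₂ :- q₁ :* q₁ :+ t :* (p₀ :* q₂ :+ q₀ :* p₂ :- (p₁ :* q₁ :+ p₁ :* q₁)
                :+ t :* (l :* q₂ :+ p₀ :* p₂ :- p₁ :* p₁ :+ t :* (l :* p₂ :+ t :* :0))))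
             := t :* (t :* (t :* l) :+ t :* p₀ :+ q₀) :* (t :* (t :* p₂ :+ q₂)) :- t :* (t :* p₁ :+ q₁) :* (t :* (t :* p₁ :+ q₁)))
             refl t l p₀ p₁ p₂ q₀ q₁ q₂ ⟩
      t * (t * (t * l) + t * p₀ + q₀) * (t * (t * p₂ + q₂)) - t * (t * p₁ + q₁) * (t * (t * p₁ + q₁))
        ≈⟨ +-cong (*-cong (trans (sym (x₀ t)) (e 0F)) (trans (sym (x₂ t)) (e 2F)))
                  (-‿cong (*-cong (trans (sym (x₁ t)) (e 1F)) (trans (sym (x₁ t)) (e 1F)))) ⟩
      k * cube s u 0F * (k * cube s u 2F) - k * cube s u 1F * (k * cube s u 1F)
        ≈⟨ solve 3 (λ k s u → k :* Poly.cube s u 0F :* (k :* Poly.cube s u 2F) :- k :* Poly.cube s u 1F :* (k :* Poly.cube s u 1F) := :0)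
             refl k s u ⟩
      0# ∎)

    second : ∀ t → ¬ (t ≈ 0#) → (∃ λ k → ∃₂ λ s u → ∀ j → (cube t 1# *ᵛ L) j ≈ k * cube s u j) → eval ps₂ t ≈ 0#
    second t t≉0 (k , s , u , e) = *≈0⇒≈0 t≉0 (begin
      t * eval ps₂ t
        ≈⟨ solve 8 (λ t m p₁ p₂ p₃ q₁ q₂ q₃ →
             t :* (q₁ :* m :+ t :* (p₁ :* m :+ q₁ :* q₃ :- q₂ :* q₂
                :+ t :* (p₁ :* q₃ :+ q₁ :* p₃ :- (p₂ :* q₂ :+ p₂ :* q₂) :+ t :* (p₁ :* p₃ :- p₂ :* p₂ :+ t :* :0))))
             := t :* (t :* p₁ :+ q₁) :* (t :* (t :* p₃) :+ t :* q₃ :+ m) :- t :* (t :* p₂ :+ q₂) :* (t :* (t :* p₂ :+ q₂)))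
             refl t m p₁ p₂ p₃ q₁ q₂ q₃ ⟩
      t * (t * p₁ + q₁) * (t * (t * p₃) + t * q₃ + m) - t * (t * p₂ + q₂) * (t * (t * p₂ + q₂))
        ≈⟨ +-cong (*-cong (trans (sym (x₁ t)) (e 1F)) (trans (sym (x₃ t)) (e 3F)))
                  (-‿cong (*-cong (trans (sym (x₂ t)) (e 2F)) (trans (sym (x₂ t)) (e 2F)))) ⟩
      k * cube s u 1F * (k * cube s u 3F) - k * cube s u 2F * (k * cube s u 2F)
        ≈⟨ solve 3 (λ k s u → k :* Poly.cube s u 1F :* (k :* Poly.cube s u 3F) :- k :* Poly.cube s u 2F :* (k :* Poly.cube s u 2F) := :0)
             refl k s u ⟩
      0# ∎)

    -- The extreme coefficients `l * p₂` and `q₁ * m` give `p₂` and `q₁`; the column sums then give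
    -- `q₂` and `p₁` the value ν. As `p₁` and `q₂` are nonzero, the other coefficients determine the
    -- remaining entries one after another.
    solution : All (_≈ 0#) ps₁ → All (_≈ 0#) ps₂ → ∀ i j → L i j ≈ ν * 1ᴹ i j
    solution (q₀q₂ All.∷ p₀q₂ All.∷ lq₂ All.∷ lp₂ All.∷ All.[]) (q₁m All.∷ p₁m All.∷ p₁q₃ All.∷ p₁p₃ All.∷ All.[]) = λ where
        0F → λ where 0F → diagonal l≈ν ; 1F → offDiagonal L₀₁ ; 2F → offDiagonal L₀₂ ; 3F → offDiagonal L₀₃
        1F → λ where 0F → offDiagonal p₀≈0 ; 1F → diagonal p₁≈ν ; 2F → offDiagonal p₂≈0 ; 3F → offDiagonal p₃≈0
        2F → λ where 0F → offDiagonal q₀≈0 ; 1F → offDiagonal q₁≈0 ; 2F → diagonal q₂≈ν ; 3F → offDiagonal q₃≈0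
        3F → λ where 0F → offDiagonal L₃₀ ; 1F → offDiagonal L₃₁ ; 2F → offDiagonal L₃₂ ; 3F → diagonal m≈ν
      where
      diagonal : ∀ {x} → x ≈ ν → x ≈ ν * 1#
      diagonal e = trans e (sym (*-identityʳ ν))
      offDiagonal : ∀ {x} → x ≈ 0# → x ≈ ν * 0#
      offDiagonal e = trans e (sym (zeroʳ ν))

      p₂≈0 : p₂ ≈ 0#
      p₂≈0 = *≈0⇒≈0 λ≉0 lp₂

      q₂≈ν : q₂ ≈ ν
      q₂≈ν = modulo 1# (columns 2F) (modulo (- 1#) L₀₂ (modulo (- 1#) L₃₂ (modulo (- 1#) p₂≈0
        (solve 5 (λ a p q d ν → q := ν :+ :1 :* (a :+ (p :+ (q :+ d)) :- ν) :+ :- :1 :* (a :- :0) :+ :- :1 :* (d :- :0) :+ :- :1 :* (p :- :0))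
          refl (L 0F 2F) p₂ q₂ (L 3F 2F) ν))))

      p₁²≈lν : p₁ * p₁ ≈ l * ν
      p₁²≈lν = modulo (- 1#) lq₂ (modulo l q₂≈ν (modulo p₀ p₂≈0
        (solve 6 (λ l ν p₀ p₁ p₂ q₂ → p₁ :* p₁ := l :* ν :+ :- :1 :* (l :* q₂ :+ p₀ :* p₂ :- p₁ :* p₁ :- :0) :+ l :* (q₂ :- ν) :+ p₀ :* (p₂ :- :0))
          refl l ν p₀ p₁ p₂ q₂)))

      p₁≉0 : ¬ (p₁ ≈ 0#)
      p₁≉0 = factorˡ-≉0 (λ e → *-≉0 λ≉0 ν≉0 (trans (sym p₁²≈lν) e))

      p₃≈0 : p₃ ≈ 0#
      p₃≈0 = *≈0⇒≈0 p₁≉0 (modulo 1# p₁p₃ (modulo p₂ p₂≈0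
        (solve 3 (λ p₁ p₂ p₃ → p₁ :* p₃ := :0 :+ :1 :* (p₁ :* p₃ :- p₂ :* p₂ :- :0) :+ p₂ :* (p₂ :- :0)) refl p₁ p₂ p₃)))

      q₁≈0 : q₁ ≈ 0#
      q₁≈0 = *≈0⇒≈0ʳ μ≉0 q₁m

      p₁≈ν : p₁ ≈ ν
      p₁≈ν = modulo 1# (columns 1F) (modulo (- 1#) L₀₁ (modulo (- 1#) L₃₁ (modulo (- 1#) q₁≈0
        (solve 5 (λ a p q d ν → p := ν :+ :1 :* (a :+ (p :+ (q :+ d)) :- ν) :+ :- :1 :* (a :- :0) :+ :- :1 :* (d :- :0) :+ :- :1 :* (q :- :0))
          refl (L 0F 1F) p₁ q₁ (L 3F 1F) ν))))

      q₃≈0 : q₃ ≈ 0#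
      q₃≈0 = *≈0⇒≈0 p₁≉0 (modulo 1# p₁q₃ (modulo (- p₃) q₁≈0 (modulo (q₂ + q₂) p₂≈0
        (solve 6 (λ p₁ p₂ p₃ q₁ q₂ q₃ → p₁ :* q₃ := :0 :+ :1 :* (p₁ :* q₃ :+ q₁ :* p₃ :- (p₂ :* q₂ :+ p₂ :* q₂) :- :0)
             :+ :- p₃ :* (q₁ :- :0) :+ (q₂ :+ q₂) :* (p₂ :- :0)) refl p₁ p₂ p₃ q₁ q₂ q₃))))

      q₂≉0 : ¬ (q₂ ≈ 0#)
      q₂≉0 e = ν≉0 (trans (sym q₂≈ν) e)

      q₀≈0 : q₀ ≈ 0#
      q₀≈0 = *≈0⇒≈0ʳ q₂≉0 (modulo 1# q₀q₂ (modulo q₁ q₁≈0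
        (solve 3 (λ q₀ q₁ q₂ → q₀ :* q₂ := :0 :+ :1 :* (q₀ :* q₂ :- q₁ :* q₁ :- :0) :+ q₁ :* (q₁ :- :0)) refl q₀ q₁ q₂)))

      p₀≈0 : p₀ ≈ 0#
      p₀≈0 = *≈0⇒≈0ʳ q₂≉0 (modulo 1# p₀q₂ (modulo (- q₀) p₂≈0 (modulo (p₁ + p₁) q₁≈0
        (solve 6 (λ p₀ p₁ p₂ q₀ q₁ q₂ → p₀ :* q₂ := :0 :+ :1 :* (p₀ :* q₂ :+ q₀ :* p₂ :- (p₁ :* q₁ :+ p₁ :* q₁) :- :0)
             :+ :- q₀ :* (p₂ :- :0) :+ (p₁ :+ p₁) :* (q₁ :- :0)) refl p₀ p₁ p₂ q₀ q₁ q₂))))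

      l≈ν : l ≈ ν
      l≈ν = *-cancelˡ ν≉0 (trans (*-comm ν l) (trans (sym p₁²≈lν) (*-cong p₁≈ν p₁≈ν)))

      m≈ν : m ≈ ν
      m≈ν = *-cancelˡ p₁≉0 (modulo 1# p₁m (modulo (- q₃) q₁≈0 (modulo (q₂ + ν) q₂≈ν (modulo (- ν) p₁≈ν
        (solve 6 (λ m ν p₁ q₁ q₂ q₃ → p₁ :* m := p₁ :* ν :+ :1 :* (p₁ :* m :+ q₁ :* q₃ :- q₂ :* q₂ :- :0)
             :+ :- q₃ :* (q₁ :- :0) :+ (q₂ :+ ν) :* (q₂ :- ν) :+ :- ν :* (p₁ :- ν)) refl m ν p₁ q₁ q₂ q₃)))))

  image : ∀ g → InG g → ∀ p → OnCube (cube (proj₁ (homogeneous p)) (proj₂ (homogeneous p)) *ᵛ matrix g)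
  image g g∈G p =
    let k , s , t , k≉0 , st≉0 , e = OnCubic⇒OnCube (act g (cubicPoint p))
          (Equivalence.to (g∈G (cubicPoint p)) (p , 1# , 1≉0 , λ _ → sym (*-identityˡ _)))
    in k , s , t , k≉0 , st≉0 , λ j → trans (sym (*ᵛ-congˡ (matrix g) (cube-homogeneous p) j)) (e j)

  preimage : ∀ g {v k x} → (∀ j → (v *ᵛ matrix g) j ≈ k * x j) →
             ∀ j → v j ≈ k * (x *ᵛ proj₁ (invertible g)) j
  preimage (projectivity M (N , _ , MN≈1)) {v} {k} {x} e j = begin
    v j                            ≈⟨ *ᵛ-1ᴹ v j ⟨
    (v *ᵛ 1ᴹ) j                    ≈⟨ *ᵛ-congʳ v MN≈1 j ⟨
    (v *ᵛ (M *ᴹ N)) j              ≈⟨ *ᵛ-assoc v M N j ⟩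
    ((v *ᵛ M) *ᵛ N) j              ≈⟨ *ᵛ-congˡ N e j ⟩
    ((λ i → k * x i) *ᵛ N) j       ≈⟨ *ᵛ-scaleˡ k x N j ⟩
    k * (x *ᵛ N) j                 ∎

  -- Proportional image parameters would pull back along the inverse matrix to proportional points,
  -- and `cube-∝` would make the original parameters equal. This keeps the three image points of the
  -- frame distinct.
  images-distinct : ∀ g {s t k x y s′ t′ k′ x′ y′} → Nonzero² s t → ¬ (k′ ≈ 0#) → Nonzero² x′ y′ →
    (∀ j → (cube s t *ᵛ matrix g) j ≈ k * cube x y j) →
    (∀ j → (cube s′ t′ *ᵛ matrix g) j ≈ k′ * cube x′ y′ j) →
    ¬ (s * t′ ≈ s′ * t) → ¬ (x * y′ ≈ x′ * y)
  images-distinct g {s} {t} {k} {x} {y} {s′} {t′} {k′} {x′} {y′} st≉0 k′≉0 xy′≉0 e e′ distinct xy′≈x′y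
    with m , x≈ , y≈ ← parallel _≟_ xy′≉0 xy′≈x′y = distinct (cube-∝ _≟_ {l = k * m ^ 3} k′≉0 st≉0 λ j → begin
      k′ * cube s t j
        ≈⟨ *-congˡ (preimage g {v = cube s t} {k = k} {x = λ i → m ^ 3 * cube x′ y′ i} (λ i → trans (e i)
             (*-congˡ (trans (cube-cong x≈ y≈ i) (cube-scale m x′ y′ i)))) j) ⟩
      k′ * (k * ((λ i → m ^ 3 * cube x′ y′ i) *ᵛ N) j)
        ≈⟨ *-congˡ (*-congˡ (*ᵛ-scaleˡ (m ^ 3) (cube x′ y′) N j)) ⟩
      k′ * (k * (m ^ 3 * (cube x′ y′ *ᵛ N) j))
        ≈⟨ solve 4 (λ k′ k m z → k′ :* (k :* (m :* z)) := k :* m :* (k′ :* z)) refl k′ k (m ^ 3) ((cube x′ y′ *ᵛ N) j) ⟩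
      k * m ^ 3 * (k′ * (cube x′ y′ *ᵛ N) j)
        ≈⟨ *-congˡ (preimage g {v = cube s′ t′} {k = k′} {x = cube x′ y′} e′ j) ⟨
      k * m ^ 3 * cube s′ t′ j ∎)
    where N = proj₁ (invertible g)

  -- The frame P(∞), P(0), P(1) is mapped to the same points as by the element of PGL(2,q) with
  -- rows (a, c) = [z,y] x and (b, d) = [x,z] y, whose sum is [x,y] z.
  InG⇒IsCubic : ∀ g → InG g → IsCubic (matrix g)
  InG⇒IsCubic g g∈G
    with kx , x₀ , x₁ , kx≉0 , x≉0 , ex ← image g g∈G nothing
       | ky , y₀ , y₁ , ky≉0 , y≉0 , ey ← image g g∈G (just 0#)
       | kz , z₀ , z₁ , kz≉0 , z≉0 , ez ← image g g∈G (just 1#) =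
    isCubic {k = ν * δ⁻³} {a} {b} {e} {d} (*-≉0 ν≉0 (⁻¹-≉0 (^3-≉0 δ≉0))) δ≉0 λ i j →
      modulo (- G i j) (*-inverse (^3-≉0 δ≉0)) (modulo δ⁻³ (δ³G≈νH i j)
        (solve 5 (λ g v i h δ³ → g := v :* i :* h :+ :- g :* (δ³ :* i :- :1) :+ i :* (δ³ :* g :- v :* h))
          refl (G i j) ν δ⁻³ (sym³ a b e d i j) (det a b e d ^ 3)))
    where
    G = matrix g
    [xy] = x₀ * y₁ - y₀ * x₁
    [xz] = x₀ * z₁ - z₀ * x₁
    [zy] = z₀ * y₁ - y₀ * z₁

    [xy]≉0 : ¬ ([xy] ≈ 0#)
    [xy]≉0 = images-distinct g (homogeneous-nonzero nothing) ky≉0 y≉0 ex ey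
      (λ eq → 1≉0 (trans (sym (*-identityʳ 1#)) (trans eq (zeroʳ 0#)))) ∘ -‿≈0⇒≈

    [xz]≉0 : ¬ ([xz] ≈ 0#)
    [xz]≉0 = images-distinct g (homogeneous-nonzero nothing) kz≉0 z≉0 ex ez
      (λ eq → 1≉0 (trans (sym (*-identityʳ 1#)) (trans eq (zeroʳ 1#)))) ∘ -‿≈0⇒≈

    [zy]≉0 : ¬ ([zy] ≈ 0#)
    [zy]≉0 = images-distinct g (homogeneous-nonzero (just 1#)) ky≉0 y≉0 ez ey
      (λ eq → 1≉0 (trans (sym (*-identityʳ 1#)) (trans eq (zeroˡ 1#)))) ∘ -‿≈0⇒≈

    a = [zy] * x₀
    e = [zy] * x₁
    b = [xz] * y₀
    d = [xz] * y₁

    δ≉0 : ¬ (det a b e d ≈ 0#)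
    δ≉0 eq = *-≉0 [zy]≉0 (*-≉0 [xz]≉0 [xy]≉0) (trans
      (solve 6 (λ p r x₀ x₁ y₀ y₁ → p :* (r :* (x₀ :* y₁ :- y₀ :* x₁)) := p :* x₀ :* (r :* y₁) :- r :* y₀ :* (p :* x₁))
        refl [zy] [xz] x₀ x₁ y₀ y₁) eq)

    δ⁻³ = (det a b e d ^ 3) ⁻¹[ ^3-≉0 δ≉0 ]
    A = sym³ d (- b) (- e) a
    L : Matrix
    L = G *ᴹ A
    -- The adjugate sends the pair z to (r, r) with r = [xz] [zy], so this is the scalar by which
    -- `L` multiplies the frame point P(1).
    ν = kz * ([xz] * [zy]) ^ 3

    ν≉0 : ¬ (ν ≈ 0#)
    ν≉0 = *-≉0 kz≉0 (^3-≉0 (*-≉0 [xz]≉0 [zy]≉0))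

    through : ∀ {v k s t} → (∀ j → (v *ᵛ G) j ≈ k * cube s t j) →
              ∀ j → (v *ᵛ L) j ≈ k * cube (d * s - b * t) (a * t - e * s) j
    through {v} {k} {s} {t} eq j = begin
      (v *ᵛ L) j                             ≈⟨ *ᵛ-assoc v G A j ⟩
      ((v *ᵛ G) *ᵛ A) j                      ≈⟨ *ᵛ-congˡ A eq j ⟩
      ((λ i → k * cube s t i) *ᵛ A) j        ≈⟨ *ᵛ-scaleˡ k (cube s t) A j ⟩
      k * (cube s t *ᵛ A) j                  ≈⟨ *-congˡ (cube-sym³-adjugate s t a b e d j) ⟩
      k * cube (d * s - b * t) (a * t - e * s) j ∎

    row₀ : ∀ j → L 0F j ≈ kx * cube ([xz] * [xy]) 0# j
    row₀ j = trans (solve 4 (λ p q r s → p := Poly.cube :1 :0 0F :* p :+ (Poly.cube :1 :0 1F :* q :+ (Poly.cube :1 :0 2F :* r :+ (Poly.cube :1 :0 3F :* s :+ :0))))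
                     refl (L 0F j) (L 1F j) (L 2F j) (L 3F j))
      (trans (through {v = cube 1# 0#} ex j) (*-congˡ (cube-cong
        (solve 5 (λ r x₀ x₁ y₀ y₁ → r :* y₁ :* x₀ :- r :* y₀ :* x₁ := r :* (x₀ :* y₁ :- y₀ :* x₁)) refl [xz] x₀ x₁ y₀ y₁)
        (solve 3 (λ p x₀ x₁ → p :* x₀ :* x₁ :- p :* x₁ :* x₀ := :0) refl [zy] x₀ x₁) j)))

    row₃ : ∀ j → L 3F j ≈ ky * cube 0# ([zy] * [xy]) j
    row₃ j = trans (solve 4 (λ p q r s → s := Poly.cube :0 :1 0F :* p :+ (Poly.cube :0 :1 1F :* q :+ (Poly.cube :0 :1 2F :* r :+ (Poly.cube :0 :1 3F :* s :+ :0))))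
                     refl (L 0F j) (L 1F j) (L 2F j) (L 3F j))
      (trans (through {v = cube 0# 1#} ey j) (*-congˡ (cube-cong
        (solve 3 (λ r y₀ y₁ → r :* y₁ :* y₀ :- r :* y₀ :* y₁ := :0) refl [xz] y₀ y₁)
        (solve 5 (λ p x₀ x₁ y₀ y₁ → p :* x₀ :* y₁ :- p :* x₁ :* y₀ := p :* (x₀ :* y₁ :- y₀ :* x₁)) refl [zy] x₀ x₁ y₀ y₁) j)))

    columns : ∀ j → L 0F j + (L 1F j + (L 2F j + L 3F j)) ≈ ν
    columns j = begin
      L 0F j + (L 1F j + (L 2F j + L 3F j))
        ≈⟨ solve 4 (λ p q r s → p :+ (q :+ (r :+ s)) := Poly.cube :1 :1 0F :* p :+ (Poly.cube :1 :1 1F :* q :+ (Poly.cube :1 :1 2F :* r :+ (Poly.cube :1 :1 3F :* s :+ :0))))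
             refl (L 0F j) (L 1F j) (L 2F j) (L 3F j) ⟩
      (cube 1# 1# *ᵛ L) j
        ≈⟨ through {v = cube 1# 1#} ez j ⟩
      kz * cube (d * z₀ - b * z₁) (a * z₁ - e * z₀) j
        ≈⟨ *-congˡ (trans (cube-cong
             (solve 5 (λ r z₀ z₁ y₀ y₁ → r :* y₁ :* z₀ :- r :* y₀ :* z₁ := r :* (z₀ :* y₁ :- y₀ :* z₁) :* :1) refl [xz] z₀ z₁ y₀ y₁)
             (solve 5 (λ p x₀ x₁ z₀ z₁ → p :* x₀ :* z₁ :- p :* x₁ :* z₀ := (x₀ :* z₁ :- z₀ :* x₁) :* p :* :1) refl [zy] x₀ x₁ z₀ z₁) j)
             (cube-scale ([xz] * [zy]) 1# 1# j)) ⟩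
      kz * (([xz] * [zy]) ^ 3 * cube 1# 1# j)
        ≈⟨ *-congˡ (trans (*-congˡ (cube-1-1 j)) (*-identityʳ _)) ⟩
      ν ∎
      where
      cube-1-1 : ∀ j → cube 1# 1# j ≈ 1#
      cube-1-1 = λ where
        0F → solve 0 (Poly.cube :1 :1 0F := :1) refl
        1F → solve 0 (Poly.cube :1 :1 1F := :1) refl
        2F → solve 0 (Poly.cube :1 :1 2F := :1) refl
        3F → solve 0 (Poly.cube :1 :1 3F := :1) refl

    cube-s-0 : ∀ k s → k * cube s 0# 1F ≈ 0# × k * cube s 0# 2F ≈ 0# × k * cube s 0# 3F ≈ 0#
    cube-s-0 k s = solve 2 (λ k s → k :* Poly.cube s :0 1F := :0) refl k s
                 , solve 2 (λ k s → k :* Poly.cube s :0 2F := :0) refl k s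
                 , solve 2 (λ k s → k :* Poly.cube s :0 3F := :0) refl k s

    cube-0-s : ∀ k s → k * cube 0# s 0F ≈ 0# × k * cube 0# s 1F ≈ 0# × k * cube 0# s 2F ≈ 0#
    cube-0-s k s = solve 2 (λ k s → k :* Poly.cube :0 s 0F := :0) refl k s
                 , solve 2 (λ k s → k :* Poly.cube :0 s 1F := :0) refl k s
                 , solve 2 (λ k s → k :* Poly.cube :0 s 2F := :0) refl k s

    L≈ν : ∀ i j → L i j ≈ ν * 1ᴹ i j
    L≈ν =
      let z₁ , z₂ , z₃ = cube-s-0 kx ([xz] * [xy])
          z₄ , z₅ , z₆ = cube-0-s ky ([zy] * [xy])
      in frame-fixing {L} {ν}
        (λ eq → *-≉0 kx≉0 (^3-≉0 (*-≉0 [xz]≉0 [xy]≉0)) (trans (sym (row₀ 0F)) eq))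
        (trans (row₀ 1F) z₁) (trans (row₀ 2F) z₂) (trans (row₀ 3F) z₃)
        (trans (row₃ 0F) z₄) (trans (row₃ 1F) z₅) (trans (row₃ 2F) z₆)
        (λ eq → *-≉0 ky≉0 (^3-≉0 (*-≉0 [zy]≉0 [xy]≉0)) (trans (sym (row₃ 3F)) eq))
        ν≉0 columns
        (λ t → let k , s , u , _ , _ , eq = image g g∈G (just t)
               in k , _ , _ , through {v = cube t 1#} eq)

    δ³G≈νH : ∀ i j → det a b e d ^ 3 * G i j ≈ ν * sym³ a b e d i j
    δ³G≈νH i j = begin
      det a b e d ^ 3 * G i j
        ≈⟨ *ᵛ-scalar (det a b e d ^ 3) (G i) {A *ᴹ sym³ a b e d} (sym³-adjugateˡ a b e d) j ⟨
      (G i *ᵛ (A *ᴹ sym³ a b e d)) j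
        ≈⟨ *ᵛ-assoc (G i) A (sym³ a b e d) j ⟩
      (L i *ᵛ sym³ a b e d) j
        ≈⟨ *ᵛ-congˡ (sym³ a b e d) (L≈ν i) j ⟩
      ((λ k → ν * 1ᴹ i k) *ᵛ sym³ a b e d) j
        ≈⟨ *ᵛ-scaleˡ ν (1ᴹ i) (sym³ a b e d) j ⟩
      ν * (1ᴹ i *ᵛ sym³ a b e d) j
        ≈⟨ *-congˡ (1ᴹ-*ᵛ i (sym³ a b e d) j) ⟩
      ν * sym³ a b e d i j ∎
      where
      1ᴹ-*ᵛ : ∀ i (N : Matrix) j → (1ᴹ i *ᵛ N) j ≈ N i j
      1ᴹ-*ᵛ 0F N j = solve 4 (λ x y z w → :1 :* x :+ (:0 :* y :+ (:0 :* z :+ (:0 :* w :+ :0))) := x) refl (N 0F j) (N 1F j) (N 2F j) (N 3F j)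
      1ᴹ-*ᵛ 1F N j = solve 4 (λ x y z w → :0 :* x :+ (:1 :* y :+ (:0 :* z :+ (:0 :* w :+ :0))) := y) refl (N 0F j) (N 1F j) (N 2F j) (N 3F j)
      1ᴹ-*ᵛ 2F N j = solve 4 (λ x y z w → :0 :* x :+ (:0 :* y :+ (:1 :* z :+ (:0 :* w :+ :0))) := z) refl (N 0F j) (N 1F j) (N 2F j) (N 3F j)
      1ᴹ-*ᵛ 3F N j = solve 4 (λ x y z w → :0 :* x :+ (:0 :* y :+ (:0 :* z :+ (:1 :* w :+ :0))) := w) refl (N 0F j) (N 1F j) (N 2F j) (N 3F j)

-- The quadratic extension: Frobenius, bases and conjugates, from cardinalities alone.

module QuadraticExtension
  {c ℓ c′ ℓ′} (q : ℕ) (2≤q : 2 ≤ q)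
  (F : Field c ℓ) (sizeF : HasSize (Field.setoid F) q)
  (K : Field c′ ℓ′) (sizeK : HasSize (Field.setoid K) (q ℕ.^ 2))
  (ι : Field.Carrier F → Field.Carrier K)
  (ι-hom : IsRingHomomorphism (Field.rawRing F) (Field.rawRing K) ι)
  where

  private
    module F where
      open Field F public
      open FieldProperties F public
      open Finite (Field.setoid F) sizeF public
  open Field K hiding (zero)
  open FieldProperties K
  open Finite setoid sizeK
  open Polynomials K
  open ImaginaryChords q F K ι using (InSubfield)
  open import Relation.Binary.Reasoning.Setoid setoid

  module ι = IsRingHomomorphism ι-hom

  ι-≈0 : ∀ {a} → ι a ≈ 0# → a F.≈ F.0#
  ι-≈0 {a} ιa≈0 = decidable-stable (a F.≟ F.0#) λ a≉0 → 1≉0 (begin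
    1#                        ≈⟨ ι.1#-homo ⟨
    ι F.1#                    ≈⟨ ι.⟦⟧-cong (F.*-inverse a≉0) ⟨
    ι (a F.* a F.⁻¹[ a≉0 ])   ≈⟨ ι.*-homo _ _ ⟩
    ι a * ι (a F.⁻¹[ a≉0 ])   ≈⟨ *-congʳ ιa≈0 ⟩
    0# * ι (a F.⁻¹[ a≉0 ])    ≈⟨ zeroˡ _ ⟩
    0#                        ∎)

  ι-sub : ∀ a b → ι (a F.- b) ≈ ι a - ι b
  ι-sub a b = trans (ι.+-homo a (F.- b)) (+-congˡ (ι.-‿homo b))

  ι-injective : ∀ {a b} → ι a ≈ ι b → a F.≈ b
  ι-injective {a} {b} e = F.-‿≈0⇒≈ (ι-≈0 (trans (ι-sub a b) (≈⇒-‿≈0 e)))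

  ι-^ : ∀ a n → ι (a F.^ n) ≈ ι a ^ n
  ι-^ a zero    = ι.1#-homo
  ι-^ a (suc n) = trans (ι.*-homo a (a F.^ n)) (*-congˡ (ι-^ a n))

  subfieldElement : Fin q → Carrier
  subfieldElement = ι ∘ F.element

  subfieldElement-injective : ∀ {i j} → subfieldElement i ≈ subfieldElement j → i ≡ j
  subfieldElement-injective = F.element-injective ∘ ι-injective

  ιa^q≈ιa : ∀ a → ι a ^ q ≈ ι a
  ιa^q≈ιa a = trans (sym (ι-^ a q)) (ι.⟦⟧-cong (FiniteField.x^q≈x F sizeF a))

  inSubfield? : ∀ x → Dec (InSubfield x)
  inSubfield? x = map′ (λ (i , e) → F.element i , e) (λ (a , e) → F.index a , trans (ι.⟦⟧-cong (F.element-index a)) e)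
    (any? (λ i → subfieldElement i ≟ x))

  -- (X + 1)^q - X^q - 1 has degree less than q but vanishes on the q elements of F.
  [x+1]^q≈x^q+1 : ∀ x → (x + 1#) ^ q ≈ x ^ q + 1#
  [x+1]^q≈x^q+1 x = let ps , e = difference 2≤q in
    -‿≈0⇒≈ (trans (sym (e x)) (eval-zero x (roots⇒zero ps subfieldElement subfieldElement-injective λ i →
      trans (e (subfieldElement i)) (≈⇒-‿≈0 (onSubfield (F.element i))))))
    where
    difference : ∀ {n} → 2 ≤ n → ∃ λ (ps : Vec.Vec Carrier n) → ∀ x → eval ps x ≈ (x + 1#) ^ n - (x ^ n + 1#)
    difference {suc n} _ with p Vec.∷ ps , e ← [x+1]^n-x^n (suc n) = (p - 1#) Vec.∷ ps , λ x →
      modulo (- 1#) (e x) (solve 5 (λ p x e y z → p :- :1 :+ x :* e := y :- (z :+ :1) :+ :- :1 :* (y :- (z :+ (p :+ x :* e))))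
        refl p x (eval ps x) ((x + 1#) ^ suc n) (x ^ suc n))

    onSubfield : ∀ a → (ι a + 1#) ^ q ≈ ι a ^ q + 1#
    onSubfield a = begin
      (ι a + 1#) ^ q         ≈⟨ ^-congˡ q ιa+1 ⟩
      ι (a F.+ F.1#) ^ q     ≈⟨ ιa^q≈ιa (a F.+ F.1#) ⟩
      ι (a F.+ F.1#)         ≈⟨ ιa+1 ⟨
      ι a + 1#               ≈⟨ +-congʳ (ιa^q≈ιa a) ⟨
      ι a ^ q + 1#           ∎
      where
      ιa+1 : ι a + 1# ≈ ι (a F.+ F.1#)
      ιa+1 = sym (trans (ι.+-homo a F.1#) (+-congˡ ι.1#-homo))

  0^q : 0# ^ q ≈ 0#
  0^q = trans (^-congˡ q (sym ι.0#-homo)) (trans (ιa^q≈ιa F.0#) ι.0#-homo)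

  -- For y ≠ 0 the case of x / y and 1 is multiplied by y^q; homogeneity replaces any appeal to q
  -- being a power of the characteristic.
  ^q-distrib-+ : ∀ x y → (x + y) ^ q ≈ x ^ q + y ^ q
  ^q-distrib-+ x y with y ≟ 0#
  ... | yes y≈0 = begin
      (x + y) ^ q      ≈⟨ ^-congˡ q (trans (+-congˡ y≈0) (+-identityʳ x)) ⟩
      x ^ q            ≈⟨ +-identityʳ _ ⟨
      x ^ q + 0#       ≈⟨ +-congˡ (trans (^-congˡ q y≈0) 0^q) ⟨
      x ^ q + y ^ q    ∎
  ... | no y≉0 = begin
      (x + y) ^ q                       ≈⟨ ^-congˡ q (trans (+-congʳ x≈) (sym (trans (distribˡ y _ _) (+-congˡ (*-identityʳ y))))) ⟩
      (y * (x * y⁻¹ + 1#)) ^ q          ≈⟨ ^-distrib-* y _ q ⟩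
      y ^ q * (x * y⁻¹ + 1#) ^ q        ≈⟨ *-congˡ ([x+1]^q≈x^q+1 _) ⟩
      y ^ q * ((x * y⁻¹) ^ q + 1#)      ≈⟨ trans (distribˡ _ _ _) (+-congˡ (*-identityʳ _)) ⟩
      y ^ q * (x * y⁻¹) ^ q + y ^ q     ≈⟨ +-congʳ (trans (^-congˡ q x≈) (^-distrib-* y _ q)) ⟨
      x ^ q + y ^ q                     ∎
    where
    y⁻¹ = y ⁻¹[ y≉0 ]
    x≈ : x ≈ y * (x * y⁻¹)
    x≈ = modulo (- x) (*-inverse y≉0) (solve 3 (λ x y i → x := y :* (x :* i) :+ :- x :* (y :* i :- :1)) refl x y y⁻¹)

  -- X^q - X has degree q, so that the elements of F are all its roots.
  x^q≈x⇒inSubfield : ∀ {x} → x ^ q ≈ x → InSubfield x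
  x^q≈x⇒inSubfield {x} x^q≈x = decidable-stable (inSubfield? x) λ x∉F →
    let ps , e = X^n-X 2≤q
        root : ∀ {y} → y ^ q ≈ y → eval (ps Vec.∷ʳ 1#) y ≈ 0#
        root {y} y^q≈y = trans (e y) (≈⇒-‿≈0 y^q≈y)
    -- The q + 1 roots, `x` and the elements of F, meet only q + 1 coefficients, so the leading
    -- coefficient 1 would vanish.
    in 1≉0 (last-zero ps (roots⇒zero (ps Vec.∷ʳ 1#) points (points-injective x∉F)
         λ { zero → root x^q≈x ; (suc i) → root (ιa^q≈ιa (F.element i)) }))
    where
    X^n-X : ∀ {n} → 2 ≤ n → ∃ λ (ps : Vec.Vec Carrier n) → ∀ y → eval (ps Vec.∷ʳ 1#) y ≈ y ^ n - y
    X^n-X {suc (suc n)} (s≤s (s≤s _)) = ps , λ y → begin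
      eval (ps Vec.∷ʳ 1#) y                              ≈⟨ eval-∷ʳ ps 1# y ⟩
      0# + y * (- 1# + y * eval (Vec.replicate n 0#) y) + 1# * y ^ suc (suc n)
        ≈⟨ +-congʳ (+-congˡ (*-congˡ (+-congˡ (*-congˡ (eval-replicate-0 n y))))) ⟩
      0# + y * (- 1# + y * 0#) + 1# * y ^ suc (suc n)
        ≈⟨ solve 2 (λ y z → :0 :+ y :* (:- :1 :+ y :* :0) :+ :1 :* z := z :- y) refl y (y ^ suc (suc n)) ⟩
      y ^ suc (suc n) - y                                ∎
      where ps = 0# Vec.∷ - 1# Vec.∷ Vec.replicate n 0#

    points : Fin (suc q) → Carrier
    points zero    = x
    points (suc i) = subfieldElement i

    points-injective : ¬ InSubfield x → ∀ {i j} → points i ≈ points j → i ≡ j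
    points-injective x∉F {zero}  {zero}  e = ≡.refl
    points-injective x∉F {zero}  {suc j} e = contradiction (F.element j , sym e) x∉F
    points-injective x∉F {suc i} {zero}  e = contradiction (F.element i , e) x∉F
    points-injective x∉F {suc i} {suc j} e = ≡.cong suc (subfieldElement-injective e)

  -- Otherwise taking preimages under `ι` would inject q² elements into q.
  exists-nonsubfield : ∃ λ t → ¬ InSubfield t
  exists-nonsubfield =
    let i , i∉F = ¬∀⟶∃¬ (q ℕ.^ 2) (InSubfield ∘ element) (inSubfield? ∘ element) λ all →
          ℕₚ.<⇒≱ (q<q^2 2≤q) (injective⇒≤ {f = λ i → F.index (proj₁ (all i))} λ {i} {j} e →
            element-injective (trans (sym (proj₂ (all i))) (trans (ι.⟦⟧-cong (F.index-injective e)) (proj₂ (all j)))))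
    in element i , i∉F
    where
    q<q^2 : ∀ {n} → 2 ≤ n → n ℕ.< n ℕ.^ 2
    q<q^2 {suc (suc n)} (s≤s (s≤s _)) = ℕₚ.m<m*n (suc (suc n)) (suc (suc n) ℕ.* 1) (s≤s (s≤s ℕ.z≤n))

  module Basis {t} (t∉F : ¬ InSubfield t) where

    independent : ∀ {a b} → ι a + ι b * t ≈ 0# → a F.≈ F.0# × b F.≈ F.0#
    independent {a} {b} e = a≈0 , b≈0
      where
      b≈0 : b F.≈ F.0#
      b≈0 = decidable-stable (b F.≟ F.0#) λ b≉0 → t∉F (F.- a F.* b F.⁻¹[ b≉0 ] , (begin
        ι (F.- a F.* b F.⁻¹[ b≉0 ])      ≈⟨ trans (ι.*-homo _ _) (*-congʳ (ι.-‿homo a)) ⟩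
        - ι a * ι (b F.⁻¹[ b≉0 ])
          ≈⟨ modulo t (trans (sym (ι.*-homo _ _)) (trans (ι.⟦⟧-cong (F.*-inverse b≉0)) ι.1#-homo)) (modulo (- ι (b F.⁻¹[ b≉0 ])) e
               (solve 4 (λ a b i t → :- a :* i := t :+ t :* (b :* i :- :1) :+ :- i :* (a :+ b :* t :- :0)) refl (ι a) (ι b) (ι (b F.⁻¹[ b≉0 ])) t)) ⟩
        t ∎))
      a≈0 : a F.≈ F.0#
      a≈0 = ι-≈0 (begin
        ι a               ≈⟨ solve 2 (λ a t → a := a :+ :0 :* t) refl (ι a) t ⟩
        ι a + 0# * t      ≈⟨ +-congˡ (*-congʳ (trans (ι.⟦⟧-cong b≈0) ι.0#-homo)) ⟨
        ι a + ι b * t     ≈⟨ e ⟩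
        0#                ∎)

    coefficients-unique : ∀ {a b a′ b′} → ι a + ι b * t ≈ ι a′ + ι b′ * t → a F.≈ a′ × b F.≈ b′
    coefficients-unique {a} {b} {a′} {b′} e =
      let a≈ , b≈ = independent {a F.- a′} {b F.- b′} (modulo 1# e (trans (+-cong (ι-sub a a′) (*-congʳ (ι-sub b b′)))
            (solve 5 (λ a b a′ b′ t → a :- a′ :+ (b :- b′) :* t := :0 :+ :1 :* (a :+ b :* t :- (a′ :+ b′ :* t)))
              refl (ι a) (ι b) (ι a′) (ι b′) t)))
      in F.-‿≈0⇒≈ a≈ , F.-‿≈0⇒≈ b≈

    -- The q * q combinations a + b t are distinct by `coefficients-unique`, and `K` has no more
    -- elements than that.
    spans : ∀ x → ∃₂ λ a b → x ≈ ι a + ι b * t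
    spans x =
      let i , e = Finite.injective⇒enumerates setoid sizeK′ value (λ {i} {j} → value-injective {i} {j}) x
      in F.element (proj₁ (remQuot {q} q i)) , F.element (proj₂ (remQuot {q} q i)) , sym e
      where
      sizeK′ : HasSize setoid (q ℕ.* q)
      sizeK′ = ≡.subst (HasSize setoid) (≡.cong (q ℕ.*_) (ℕₚ.*-identityʳ q)) sizeK

      value : Fin (q ℕ.* q) → Carrier
      value i = let j , k = remQuot {q} q i in ι (F.element j) + ι (F.element k) * t

      value-injective : ∀ {i j} → value i ≈ value j → i ≡ j
      value-injective {i} {j} e = let e₁ , e₂ = coefficients-unique e in
        ≡.trans (≡.sym (combine-remQuot {q} q i)) (≡.trans
          (≡.cong₂ combine (F.element-injective e₁) (F.element-injective e₂)) (combine-remQuot {q} q j))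

  Root : F.Carrier → F.Carrier → Carrier → Set ℓ′
  Root T N s = s * s ≈ ι T * s - ι N

  minimalPolynomial : ∀ {t} → ¬ InSubfield t → ∃₂ λ T N → Root T N t
  minimalPolynomial {t} t∉F = let a , b , e = Basis.spans t∉F (t * t) in
    b , F.- a , trans e (trans (solve 3 (λ a b t → a :+ b :* t := b :* t :- :- a) refl (ι a) (ι b) t)
      (+-congˡ (-‿cong (sym (ι.-‿homo a)))))

  root-^q : ∀ {T N s} → Root T N s → Root T N (s ^ q)
  root-^q {T} {N} {s} root = begin
    s ^ q * s ^ q                    ≈⟨ ^-distrib-* s s q ⟨
    (s * s) ^ q                      ≈⟨ ^-congˡ q (trans root (+-congˡ (sym (ι.-‿homo N)))) ⟩
    (ι T * s + ι (F.- N)) ^ q        ≈⟨ ^q-distrib-+ _ _ ⟩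
    (ι T * s) ^ q + ι (F.- N) ^ q    ≈⟨ +-cong (trans (^-distrib-* (ι T) s q) (*-congʳ (ιa^q≈ιa T)))
                                               (trans (ιa^q≈ιa (F.- N)) (ι.-‿homo N)) ⟩
    ι T * s ^ q - ι N                ∎

  module Conjugate {t} (t∉F : ¬ InSubfield t) {T N} (root : Root T N t) where

    conjugate≉ : ¬ (t - t ^ q ≈ 0#)
    conjugate≉ e = t∉F (x^q≈x⇒inSubfield (sym (-‿≈0⇒≈ e)))

    -- As t and t^q are distinct roots of the same polynomial, subtracting their equations leaves (t
    -- - t^q) (t + t^q - T) = 0 with a nonzero first factor.
    conjugate≈ : t ^ q ≈ ι T - t
    conjugate≈ = -‿≈0⇒≈ (*≈0⇒≈0 conjugate≉ (modulo 1# root (modulo (- 1#) (root-^q root)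
      (solve 4 (λ t u T N → (t :- u) :* (u :- (T :- t)) := :0 :+ :1 :* (t :* t :- (T :* t :- N)) :+ :- :1 :* (u :* u :- (T :* u :- N)))
        refl t (t ^ q) (ι T) (ι N)))))

    conjugate-norm : t * t ^ q ≈ ι N
    conjugate-norm = modulo t conjugate≈ (modulo (- 1#) root
      (solve 4 (λ t u T N → t :* u := N :+ t :* (u :- (T :- t)) :+ :- :1 :* (t :* t :- (T :* t :- N))) refl t (t ^ q) (ι T) (ι N)))

-- Characteristic 2 and the absolute trace.

module Characteristic2 {c ℓ} (F : Field c ℓ) where
  open Field F hiding (zero)
  open FieldProperties F hiding (_^_)
  open ProjectiveSpace F
  open Mult semiring using (×1-homo-*)
  open SemiringSum semiring using (sum-cong-≋)
  open import Relation.Binary.Reasoning.Setoid setoid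

  -- The multiple n · 1 does not change when n drops by two, and ending at n = 1 contradicts `1≉0`.
  -- With n = q this makes 2 invertible for odd q.
  2≈0∧n·1≈0⇒2∣n : 1# + 1# ≈ 0# → ∀ n → n · 1# ≈ 0# → 2 ∣ n
  2≈0∧n·1≈0⇒2∣n 2≈0 zero          _   = divides 0 ≡.refl
  2≈0∧n·1≈0⇒2∣n 2≈0 (suc zero)    1≈0 = contradiction (trans (sym (+-identityʳ 1#)) 1≈0) 1≉0
  2≈0∧n·1≈0⇒2∣n 2≈0 (suc (suc n)) e   = ∣m∣n⇒∣m+n ∣-refl (2≈0∧n·1≈0⇒2∣n 2≈0 n
    (modulo 1# e (modulo (- 1#) 2≈0
      (solve 1 (λ x → x := :0 :+ :1 :* (:1 :+ (:1 :+ x) :- :0) :+ :- :1 :* (:1 :+ :1 :- :0)) refl (n · 1#)))))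

  -- A nonzero 2 could be cancelled from 2^h · 1 = 0 until 1 = 0 remains. The double negation is
  -- removed later by the decidable equality of a finite field.
  2^h·1≈0⇒2≉≉0 : ∀ h → (2 ℕ.^ h) · 1# ≈ 0# → ¬ ¬ (1# + 1# ≈ 0#)
  2^h·1≈0⇒2≉≉0 zero    1≈0 2≉0 = 1≉0 (trans (sym (+-identityʳ 1#)) 1≈0)
  2^h·1≈0⇒2≉≉0 (suc h) e   2≉0 = 2^h·1≈0⇒2≉≉0 h (*≈0⇒≈0 2≉0 (begin
    (1# + 1#) * (2 ℕ.^ h) · 1#     ≈⟨ *-congʳ (+-congˡ (+-identityʳ 1#)) ⟨
    (2 · 1#) * ((2 ℕ.^ h) · 1#)    ≈⟨ ×1-homo-* 2 (2 ℕ.^ h) ⟨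
    (2 ℕ.* 2 ℕ.^ h) · 1#         ≈⟨ e ⟩
    0#                           ∎)) 2≉0

  trace-cong : ∀ h {x y} → x ≈ y → trace h x ≈ trace h y
  trace-cong h x≈y = sum-cong-≋ {h} (λ i → ^-congˡ (2 ℕ.^ toℕ i) x≈y)

  trace-suc : ∀ h x → trace (suc h) x ≈ x + trace h (x * x)
  trace-suc h x = +-cong (*-identityʳ x) (sum-cong-≋ {h} (λ i →
    trans (sym (^-assocʳ x 2 (2 ℕ.^ toℕ i))) (^-congˡ (2 ℕ.^ toℕ i) (*-congˡ (*-identityʳ x)))))

  -- The sum telescopes: after the first term x² + x the rest is the same sum for x², because (x² +
  -- x)² = x⁴ + x² in characteristic 2.
  trace-x²+x : 1# + 1# ≈ 0# → ∀ h x → trace h (x * x + x) ≈ x ^ (2 ℕ.^ h) + x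
  trace-x²+x 2≈0 zero    x = modulo (- x) 2≈0 (solve 1 (λ x → :0 := x :* :1 :+ x :+ :- x :* (:1 :+ :1 :- :0)) refl x)
  trace-x²+x 2≈0 (suc h) x = begin
    trace (suc h) (x * x + x)
      ≈⟨ trace-suc h (x * x + x) ⟩
    x * x + x + trace h ((x * x + x) * (x * x + x))
      ≈⟨ +-congˡ (trace-cong h (modulo (x * x * x) 2≈0
           (solve 1 (λ x → (x :* x :+ x) :* (x :* x :+ x) := x :* x :* (x :* x) :+ x :* x :+ x :* x :* x :* (:1 :+ :1 :- :0)) refl x))) ⟩
    x * x + x + trace h (x * x * (x * x) + x * x)
      ≈⟨ +-congˡ (trace-x²+x 2≈0 h (x * x)) ⟩
    x * x + x + ((x * x) ^ (2 ℕ.^ h) + x * x)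
      ≈⟨ modulo (x * x) 2≈0 (solve 2 (λ x y → x :* x :+ x :+ (y :+ x :* x) := y :+ x :+ x :* x :* (:1 :+ :1 :- :0)) refl x ((x * x) ^ (2 ℕ.^ h))) ⟩
    (x * x) ^ (2 ℕ.^ h) + x
      ≈⟨ +-congʳ (trans (^-congˡ (2 ℕ.^ h) (*-congˡ (sym (*-identityʳ x)))) (^-assocʳ x 2 (2 ℕ.^ h))) ⟩
    x ^ (2 ℕ.^ suc h) + x ∎

-- Roots in `K` of prescribed irreducible quadratics.

module QuadraticRoots
  {c ℓ c′ ℓ′} (q : ℕ) (2≤q : 2 ≤ q)
  (F : Field c ℓ) (sizeF : HasSize (Field.setoid F) q)
  (K : Field c′ ℓ′) (sizeK : HasSize (Field.setoid K) (q ℕ.^ 2))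
  (ι : Field.Carrier F → Field.Carrier K)
  (ι-hom : IsRingHomomorphism (Field.rawRing F) (Field.rawRing K) ι)
  where

  private
    module K where
      open Field K public
      open FieldProperties K public
      open Finite (Field.setoid K) sizeK public
  open Field F hiding (zero)
  open FieldProperties F hiding (_^_)
  open ProjectiveSpace F using (NonSquare; trace; _^_; _·_)
  open Finite setoid sizeF
  open FiniteField F sizeF
  open Characteristic2 F
  open ImaginaryChords q F K ι using (InSubfield)
  open QuadraticExtension q 2≤q F sizeF K sizeK ι ι-hom
  open import Relation.Binary.Reasoning.Setoid K.setoid

  split : ∀ {x y z} → (x - y) * (x - z) ≈ 0# → x ≈ y ⊎ x ≈ z
  split {x} {y} e with x - y ≟ 0#
  ... | yes x≈y = inj₁ (-‿≈0⇒≈ x≈y)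
  ... | no  x≉y = inj₂ (-‿≈0⇒≈ (*≈0⇒≈0 x≉y e))

  split⇒inSubfield : ∀ {t x y} → (t K.- ι x) K.* (t K.- ι y) K.≈ K.0# → InSubfield t
  split⇒inSubfield {t} {x} {y} e with (t K.- ι x) K.≟ K.0#
  ... | yes t≈x = x , K.sym (K.-‿≈0⇒≈ t≈x)
  ... | no  t≉x = y , K.sym (K.-‿≈0⇒≈ (K.*≈0⇒≈0 t≉x e))

  square≈⇒inSubfield : ∀ {t x} → t K.* t K.≈ ι (x * x) → InSubfield t
  square≈⇒inSubfield {t} {x} e = split⇒inSubfield (K.modulo K.1# (K.trans e (ι.*-homo x x)) (K.modulo (ι x K.- t) (ι.-‿homo x)
    (K.solve 3 (λ t x y → (t K.:- x) K.:* (t K.:- y) K.:= K.:0 K.:+ K.:1 K.:* (t K.:* t K.:- x K.:* x) K.:+ (x K.:- t) K.:* (y K.:- K.:- x)) K.refl t (ι x) (ι (- x)))))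

  odd⇒2≉0 : ¬ (2 ∣ q) → ¬ (1# + 1# ≈ 0#)
  odd⇒2≉0 2∤q 2≈0 = 2∤q (2≈0∧n·1≈0⇒2∣n 2≈0 q q·1≈0)

  -- Completing the square replaces t₀ by δ with δ² = ε in F; since δ is outside F, ε is a
  -- nonsquare. The pairing for the cover is x ↦ -x.
  module SquareRoot {t₀ T N} (t₀∉F : ¬ InSubfield t₀) (root : Root T N t₀)
                    (2∤q : ¬ (2 ∣ q)) {ρ} (ρ-nonsquare : NonSquare ρ) (ρ≉0 : ¬ (ρ ≈ 0#)) where

    private
      2≉0 = odd⇒2≉0 2∤q
      ½ = (1# + 1#) ⁻¹[ 2≉0 ]
      T/2 = T * ½
      δ = t₀ K.- ι T/2
      ε = T/2 * T/2 - N

      T≈ : ι T K.≈ ι T/2 K.+ ι T/2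
      T≈ = K.trans (ι.⟦⟧-cong (modulo (- T) (*-inverse 2≉0)
        (solve 2 (λ T h → T := T :* h :+ T :* h :+ :- T :* ((:1 :+ :1) :* h :- :1)) refl T ½))) (ι.+-homo T/2 T/2)

      δ²≈ε : δ K.* δ K.≈ ι ε
      δ²≈ε = K.trans (K.modulo K.1# root (K.modulo t₀ T≈
        (K.solve 4 (λ t T h N → (t K.:- h) K.:* (t K.:- h) K.:= h K.:* h K.:- N K.:+ K.:1 K.:* (t K.:* t K.:- (T K.:* t K.:- N)) K.:+ t K.:* (T K.:- (h K.:+ h)))
          K.refl t₀ (ι T) (ι T/2) (ι N))))
        (K.sym (K.trans (ι-sub (T/2 * T/2) N) (K.+-congʳ (ι.*-homo T/2 T/2))))

      ε-nonsquare : ∀ x → ¬ (ε ≈ x * x)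
      ε-nonsquare x ε≈x² =
        let a , a≈δ = square≈⇒inSubfield {x = x} (K.trans δ²≈ε (ι.⟦⟧-cong ε≈x²))
        in t₀∉F (a + T/2 , (begin
          ι (a + T/2)          ≈⟨ ι.+-homo a T/2 ⟩
          ι a K.+ ι T/2        ≈⟨ K.+-congʳ a≈δ ⟩
          δ K.+ ι T/2          ≈⟨ K.solve 2 (λ t h → t K.:- h K.:+ h K.:= t) K.refl t₀ (ι T/2) ⟩
          t₀                   ∎))

      ε≉0 : ¬ (ε ≈ 0#)
      ε≉0 ε≈0 = ε-nonsquare 0# (trans ε≈0 (sym (zeroˡ 0#)))

      fibre : ∀ x y → x * x ≈ y * y → x ≈ y ⊎ x ≈ - y
      fibre x y e = split (modulo 1# e (solve 2 (λ x y → (x :- y) :* (x :- :- y) := :0 :+ :1 :* (x :* x :- y :* y)) refl x y))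

      -- The hypothesis y ≠ -y excludes y = 0, the source of the common value 0; for y ≠ 0, ε would
      -- be the square of x / y.
      disjoint : ∀ x y → ¬ (y ≈ - y) → ¬ (x * x ≈ ε * (y * y))
      disjoint x y y≉-y e = ε-nonsquare (x * i) (modulo (- (ε * (y * i + 1#))) (*-inverse y≉0) (modulo (- (i * i)) e
        (solve 4 (λ x y ε i → ε := x :* i :* (x :* i) :+ :- (ε :* (y :* i :+ :1)) :* (y :* i :- :1) :+ :- (i :* i) :* (x :* x :- ε :* (y :* y)))
          refl x y ε i)))
        where
        y≉0 : ¬ (y ≈ 0#)
        y≉0 y≈0 = y≉-y (trans y≈0 (trans (sym -0#≈0#) (-‿cong (sym y≈0))))
        i = y ⁻¹[ y≉0 ]

      ρ⁻¹ = ρ ⁻¹[ ρ≉0 ]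

      scaled : ∀ x → ε * (x * x) ≈ ρ → ∃ λ t → ¬ InSubfield t × Root 0# (- ρ⁻¹) t
      scaled x εx²≈ρ = t , t∉F , K.trans t²≈ (K.sym (K.trans (K.+-cong
            (K.trans (K.*-congʳ ι.0#-homo) (K.zeroˡ t)) (K.-‿cong (ι.-‿homo ρ⁻¹)))
            (K.solve 1 (λ r → K.:0 K.:- K.:- r K.:= r) K.refl (ι ρ⁻¹))))
        where
        -- Scaled so that t² = ρ⁻² x² ε = ρ⁻¹; if t were in F, then ρ = (ρ t)² would be a square.
        t = ι (ρ⁻¹ * x) K.* δ

        t²≈ : t K.* t K.≈ ι ρ⁻¹
        t²≈ = begin
          t K.* t
            ≈⟨ K.solve 2 (λ r d → r K.:* d K.:* (r K.:* d) K.:= r K.:* r K.:* (d K.:* d)) K.refl (ι (ρ⁻¹ * x)) δ ⟩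
          ι (ρ⁻¹ * x) K.* ι (ρ⁻¹ * x) K.* (δ K.* δ)
            ≈⟨ K.*-cong (K.sym (ι.*-homo _ _)) δ²≈ε ⟩
          ι (ρ⁻¹ * x * (ρ⁻¹ * x)) K.* ι ε
            ≈⟨ ι.*-homo _ _ ⟨
          ι (ρ⁻¹ * x * (ρ⁻¹ * x) * ε)
            ≈⟨ ι.⟦⟧-cong (modulo (ρ⁻¹ * ρ⁻¹) εx²≈ρ (modulo ρ⁻¹ (*-inverse ρ≉0)
                 (solve 4 (λ r i x e → i :* x :* (i :* x) :* e := i :+ i :* i :* (e :* (x :* x) :- r) :+ i :* (r :* i :- :1)) refl ρ ρ⁻¹ x ε))) ⟩
          ι ρ⁻¹ ∎

        t∉F : ¬ InSubfield t
        t∉F (a , ιa≈t) = ρ-nonsquare (ρ * a , modulo (ρ * ρ) a²≈ (modulo ρ (*-inverse ρ≉0)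
          (solve 3 (λ r i a → r :* a :* (r :* a) := r :+ r :* r :* (a :* a :- i) :+ r :* (r :* i :- :1)) refl ρ ρ⁻¹ a)))
          where
          a²≈ : a * a ≈ ρ⁻¹
          a²≈ = ι-injective (K.trans (ι.*-homo a a) (K.trans (K.*-cong ιa≈t ιa≈t) t²≈))

    root-exists : ∃ λ t → ¬ InSubfield t × Root 0# (- ρ⁻¹) t
    root-exists = [ (λ ρ-square → contradiction ρ-square ρ-nonsquare) , (λ (x , εx²≈ρ) → scaled x εx²≈ρ) ]′
      (two-to-one-cover -_ (λ x → x * x) (λ x → ε * (x * x)) -‿cong
        (λ x → solve 1 (λ x → :- :- x := x) refl x)
        (λ e → *-cong e e) (λ e → *-congˡ (*-cong e e)) fibre
        (λ x y e → fibre x y (*-cancelˡ ε≉0 e)) disjoint ρ)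

  -- The root is one of ρ⁻¹ because P(t) lies on `ℓ₁ ρ` exactly when ρ t² = 1.
  squareRoot : ¬ (2 ∣ q) → ∀ {ρ} → NonSquare ρ → (ρ≉0 : ¬ (ρ ≈ 0#)) →
               ∃ λ t → ¬ InSubfield t × Root 0# (- ρ ⁻¹[ ρ≉0 ]) t
  squareRoot = let t₀ , t₀∉F = exists-nonsubfield
                   T , N , root = minimalPolynomial t₀∉F
               in SquareRoot.root-exists t₀∉F root

  module Even {h} (q≡2^h : q ≡ 2 ℕ.^ h) where

    2≈0 : 1# + 1# ≈ 0#
    2≈0 = decidable-stable ((1# + 1#) ≟ 0#)
      (2^h·1≈0⇒2≉≉0 h (trans (reflexive (≡.cong (_· 1#) (≡.sym q≡2^h))) q·1≈0))

    -- Otherwise the trace of η would telescope to x^q + x = 2 x = 0.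
    x²+x-trace : ∀ {x η} → trace h η ≈ 1# → ¬ (x * x + x ≈ η)
    x²+x-trace {x} {η} trace≈1 e = 1≉0 (trans (sym trace≈1) (trans (trace-cong h (sym e)) (trans (trace-x²+x 2≈0 h x)
      (modulo x 2≈0 (modulo 1# (trans (reflexive (≡.cong (x ^_) (≡.sym q≡2^h))) (x^q≈x x))
        (solve 2 (λ x y → y :+ x := :0 :+ x :* (:1 :+ :1 :- :0) :+ :1 :* (y :- x)) refl x (x ^ (2 ℕ.^ h))))))))

    -- Dividing t₀ by T gives u with u² = u + ε, the counterpart of completing the square in
    -- characteristic 2. The pairing for the cover is x ↦ x + 1, and the root sought is u + x.
    module ArtinSchreierRoot {t₀ T N} (t₀∉F : ¬ InSubfield t₀) (root : Root T N t₀)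
                             {η} (trace≈1 : trace h η ≈ 1#) where

      private
        2≈0ᴷ : K.1# K.+ K.1# K.≈ K.0#
        2≈0ᴷ = K.trans (K.sym (K.trans (ι.+-homo 1# 1#) (K.+-cong ι.1#-homo ι.1#-homo))) (K.trans (ι.⟦⟧-cong 2≈0) ι.0#-homo)

        square-injective : ∀ {x y} → x * x ≈ y * y → x ≈ y
        square-injective {x} {y} e = [ (λ z → z) , (λ z → z) ]′ (split (modulo 1# e (modulo (y * y - x * y) 2≈0
          (solve 2 (λ x y → (x :- y) :* (x :- y) := :0 :+ :1 :* (x :* x :- y :* y) :+ (y :* y :- x :* y) :* (:1 :+ :1 :- :0)) refl x y))))

        -- For T = 0, t₀ would be a square root of -N. Squaring is injective on F in characteristic
        -- 2, hence onto by counting, so t₀ would lie in F.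
        T≉0 : ¬ (T ≈ 0#)
        T≉0 T≈0 =
          let i , e = injective⇒enumerates (λ i → element i * element i) (λ e → element-injective (square-injective e)) (- N)
          in t₀∉F (square≈⇒inSubfield {x = element i} (begin
            t₀ K.* t₀                        ≈⟨ root ⟩
            ι T K.* t₀ K.- ι N               ≈⟨ K.+-cong (K.trans (K.*-congʳ (K.trans (ι.⟦⟧-cong T≈0) ι.0#-homo)) (K.zeroˡ t₀)) (K.sym (ι.-‿homo N)) ⟩
            K.0# K.+ ι (- N)                 ≈⟨ K.+-identityˡ _ ⟩
            ι (- N)                          ≈⟨ ι.⟦⟧-cong e ⟨
            ι (element i * element i)        ∎))

        T⁻¹ = T ⁻¹[ T≉0 ]
        ε = - (T⁻¹ * T⁻¹ * N)
        u = ι T⁻¹ K.* t₀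

        TT⁻¹≈1 : ι T K.* ι T⁻¹ K.≈ K.1#
        TT⁻¹≈1 = K.trans (K.sym (ι.*-homo T T⁻¹)) (K.trans (ι.⟦⟧-cong (*-inverse T≉0)) ι.1#-homo)

        u²≈u+ε : u K.* u K.≈ u K.+ ι ε
        u²≈u+ε = K.trans (K.modulo (ι T⁻¹ K.* ι T⁻¹) root (K.modulo (ι T⁻¹ K.* t₀) TT⁻¹≈1
          (K.solve 4 (λ t T i N → i K.:* t K.:* (i K.:* t) K.:= i K.:* t K.:- i K.:* i K.:* N
               K.:+ i K.:* i K.:* (t K.:* t K.:- (T K.:* t K.:- N)) K.:+ i K.:* t K.:* (T K.:* i K.:- K.:1))
            K.refl t₀ (ι T) (ι T⁻¹) (ι N))))
          (K.+-congˡ (K.sym (K.trans (ι.-‿homo _) (K.-‿cong (K.trans (ι.*-homo _ N) (K.*-congʳ (ι.*-homo T⁻¹ T⁻¹)))))))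

        u∉F : ¬ InSubfield u
        u∉F (a , ιa≈u) = t₀∉F (T * a , (begin
          ι (T * a)                  ≈⟨ ι.*-homo T a ⟩
          ι T K.* ι a                ≈⟨ K.*-congˡ ιa≈u ⟩
          ι T K.* (ι T⁻¹ K.* t₀)     ≈⟨ K.*-assoc _ _ _ ⟨
          ι T K.* ι T⁻¹ K.* t₀       ≈⟨ K.*-congʳ TT⁻¹≈1 ⟩
          K.1# K.* t₀                ≈⟨ K.*-identityˡ t₀ ⟩
          t₀                         ∎))

        -- For ε = z² - z the polynomial X² - X - ε splits as (X - z) (X - (1 - z)), which would put
        -- u in F.
        ε-nonimage : ∀ z → ¬ (ε ≈ z * z - z)
        ε-nonimage z e = u∉F (split⇒inSubfield {u} {z} {1# - z} (K.modulo K.1# u²≈u+ε (K.modulo K.1# ιε≈ (K.modulo (ι z K.- u) ι1-z≈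
          (K.solve 4 (λ u z w e → (u K.:- z) K.:* (u K.:- w) K.:= K.:0 K.:+ K.:1 K.:* (u K.:* u K.:- (u K.:+ e))
               K.:+ K.:1 K.:* (e K.:- (z K.:* z K.:- z)) K.:+ (z K.:- u) K.:* (w K.:- (K.:1 K.:- z))) K.refl u (ι z) (ι (1# - z)) (ι ε))))))
          where
          ι1-z≈ : ι (1# - z) K.≈ K.1# K.- ι z
          ι1-z≈ = K.trans (ι-sub 1# z) (K.+-congʳ ι.1#-homo)
          ιε≈ : ι ε K.≈ ι z K.* ι z K.- ι z
          ιε≈ = K.trans (ι.⟦⟧-cong e) (K.trans (ι-sub (z * z) z) (K.+-congʳ (ι.*-homo z z)))

        fibre : ∀ x y → x * x + x ≈ y * y + y → x ≈ y ⊎ x ≈ y + 1#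
        fibre x y e = split (modulo 1# e (modulo (- (x * (y + 1#)) + y * (y + 1#)) 2≈0
          (solve 2 (λ x y → (x :- y) :* (x :- (y :+ :1)) := :0 :+ :1 :* (x :* x :+ x :- (y :* y :+ y))
             :+ (:- (x :* (y :+ :1)) :+ y :* (y :+ :1)) :* (:1 :+ :1 :- :0)) refl x y)))

        disjoint : ∀ x y → ¬ (x * x + x ≈ y * y + y + ε)
        disjoint x y e = ε-nonimage (x - y) (modulo (- 1#) e (modulo (x * y - y * y + x - y) 2≈0
          (solve 3 (λ x y ε → ε := (x :- y) :* (x :- y) :- (x :- y) :+ :- :1 :* (x :* x :+ x :- (y :* y :+ y :+ ε))
              :+ (x :* y :- y :* y :+ x :- y) :* (:1 :+ :1 :- :0)) refl x y ε)))

        translated : ∀ x → x * x + x + ε ≈ η → ∃ λ t → ¬ InSubfield t × Root 1# (- η) t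
        translated x e = t , t∉F , K.trans t²≈ (K.sym (K.+-cong (K.trans (K.*-congʳ ι.1#-homo) (K.*-identityˡ t))
              (K.trans (K.-‿cong (ι.-‿homo η)) (K.solve 1 (λ r → K.:- K.:- r K.:= r) K.refl (ι η)))))
          where
          t = u K.+ ι x

          ιη≈ : ι η K.≈ ι x K.* ι x K.+ ι x K.+ ι ε
          ιη≈ = K.trans (ι.⟦⟧-cong (sym e)) (K.trans (ι.+-homo _ ε) (K.+-congʳ (K.trans (ι.+-homo _ x) (K.+-congʳ (ι.*-homo x x)))))

          t²≈ : t K.* t K.≈ t K.+ ι η
          t²≈ = K.modulo K.1# u²≈u+ε (K.modulo (K.- K.1#) ιη≈ (K.modulo (u K.* ι x K.- ι x) 2≈0ᴷ
            (K.solve 4 (λ u x e η → (u K.:+ x) K.:* (u K.:+ x) K.:= u K.:+ x K.:+ η K.:+ K.:1 K.:* (u K.:* u K.:- (u K.:+ e))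
                K.:+ K.:- K.:1 K.:* (η K.:- (x K.:* x K.:+ x K.:+ e)) K.:+ (u K.:* x K.:- x) K.:* (K.:1 K.:+ K.:1 K.:- K.:0))
              K.refl u (ι x) (ι ε) (ι η))))

          t∉F : ¬ InSubfield t
          t∉F (a , ιa≈t) = x²+x-trace {a} trace≈1 (modulo 1# a²≈ (modulo a 2≈0
            (solve 2 (λ a η → a :* a :+ a := η :+ :1 :* (a :* a :- (a :+ η)) :+ a :* (:1 :+ :1 :- :0)) refl a η)))
            where
            a²≈ : a * a ≈ a + η
            a²≈ = ι-injective (K.trans (ι.*-homo a a) (K.trans (K.*-cong ιa≈t ιa≈t) (K.trans t²≈
              (K.trans (K.+-congʳ (K.sym ιa≈t)) (K.sym (ι.+-homo a η))))))

      root-exists : ∃ λ t → ¬ InSubfield t × Root 1# (- η) t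
      root-exists = [ (λ (x , e) → contradiction e (x²+x-trace trace≈1)) , (λ (x , e) → translated x e) ]′
        (two-to-one-cover (_+ 1#) (λ x → x * x + x) (λ x → x * x + x + ε) +-congʳ
          (λ x → modulo 1# 2≈0 (solve 1 (λ x → x :+ :1 :+ :1 := x :+ :1 :* (:1 :+ :1 :- :0)) refl x))
          (λ e → +-cong (*-cong e e) e) (λ e → +-congʳ (+-cong (*-cong e e) e)) fibre
          (λ x y e → fibre x y (modulo 1# e (solve 3 (λ x y ε → x := y :+ :1 :* (x :+ ε :- (y :+ ε))) refl (x * x + x) (y * y + y) ε)))
          (λ x y _ → disjoint x y) η)

    artinSchreierRoot : ∀ {η} → trace h η ≈ 1# → ∃ λ t → ¬ InSubfield t × Root 1# (- η) t
    artinSchreierRoot = let t₀ , t₀∉F = exists-nonsubfield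
                            T , N , root = minimalPolynomial t₀∉F
                        in ArtinSchreierRoot.root-exists t₀∉F root

-- The matrices of the statement as symmetric cubes.

-- The matrices oddForm and evenForm over any semiring, for use with the ring solver.
module FormFormulas {a ℓ} (R : RawSemiring a ℓ) where
  open import Data.Vec.Functional using (Vector; []; _∷_)
  open RawSemiring R
  open RawSemiringDefinitions R using (_^_) renaming (_×_ to _·_)

  odd : (ρ α b d : Carrier) → Vector (Vector Carrier 4) 4
  odd ρ α b d =
      (α * d ^ 3 ∷ α * ρ * b * d ^ 2 ∷ α * ρ ^ 2 * b ^ 2 * d ∷ α * ρ ^ 3 * b ^ 3 ∷ [])
    ∷ (3 · (b * d ^ 2) ∷ d ^ 3 + 2 · (ρ * b ^ 2 * d) ∷ ρ ^ 2 * b ^ 3 + 2 · (ρ * b * d ^ 2) ∷ 3 · (ρ ^ 2 * b ^ 2 * d) ∷ [])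
    ∷ (3 · (α * b ^ 2 * d) ∷ α * ρ * b ^ 3 + 2 · (α * b * d ^ 2) ∷ α * d ^ 3 + 2 · (α * ρ * b ^ 2 * d) ∷ 3 · (α * ρ * b * d ^ 2) ∷ [])
    ∷ (b ^ 3 ∷ b ^ 2 * d ∷ b * d ^ 2 ∷ d ^ 3 ∷ [])
    ∷ []

  even : (A B c d : Carrier) → Vector (Vector Carrier 4) 4
  even A B c d =
      (A ^ 3 ∷ c * A ^ 2 ∷ c ^ 2 * A ∷ c ^ 3 ∷ [])
    ∷ (A ^ 2 * B ∷ d * A ^ 2 ∷ c ^ 2 * B ∷ c ^ 2 * d ∷ [])
    ∷ (A * B ^ 2 ∷ c * B ^ 2 ∷ A * d ^ 2 ∷ c * d ^ 2 ∷ [])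
    ∷ (B ^ 3 ∷ d * B ^ 2 ∷ d ^ 2 * B ∷ d ^ 3 ∷ [])
    ∷ []

module Forms {c ℓ} (F : Field c ℓ) {q} (size : HasSize (Field.setoid F) q) (5≤q : 5 ≤ q) where
  open Field F hiding (zero)
  open FieldProperties F hiding (_^_)
  open ProjectiveSpace F
  open TwistedCubic F
  open CubicGroup F size 5≤q

  private module Form {n} = FormFormulas (polynomialRawSemiring n)

  -- `oddForm` is `sym³` of (α d, b; α ρ b, d) with powers of α reduced by α² = 1. The solver sees
  -- this only for a numeral α, hence one lemma for each sign.
  oddForm-1 : ∀ ρ b d → oddForm ρ 1# b d ≈ᴹ sym³ (1# * d) b (1# * (ρ * b)) d
  oddForm-1 ρ b d = ≈sym³ (1# * d) b (1# * (ρ * b)) d λ t → λ where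
      0F → solve 4 (λ ρ b d t → lhs ρ b d t 0F := rhs ρ b d t 0F) refl ρ b d t
      1F → solve 4 (λ ρ b d t → lhs ρ b d t 1F := rhs ρ b d t 1F) refl ρ b d t
      2F → solve 4 (λ ρ b d t → lhs ρ b d t 2F := rhs ρ b d t 2F) refl ρ b d t
      3F → solve 4 (λ ρ b d t → lhs ρ b d t 3F := rhs ρ b d t 3F) refl ρ b d t
    where
    lhs rhs : ∀ {n} (ρ b d t : Polynomial n) → Fin 4 → Polynomial n
    lhs ρ b d t = Poly.cube t :1 Poly.⊛ Form.odd ρ :1 b d
    rhs ρ b d t = Poly.cube (:1 :* d :* t :+ b :* :1) (:1 :* (ρ :* b) :* t :+ d :* :1)

  oddForm--1 : ∀ ρ b d → oddForm ρ (- 1#) b d ≈ᴹ sym³ (- 1# * d) b (- 1# * (ρ * b)) d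
  oddForm--1 ρ b d = ≈sym³ (- 1# * d) b (- 1# * (ρ * b)) d λ t → λ where
      0F → solve 4 (λ ρ b d t → lhs ρ b d t 0F := rhs ρ b d t 0F) refl ρ b d t
      1F → solve 4 (λ ρ b d t → lhs ρ b d t 1F := rhs ρ b d t 1F) refl ρ b d t
      2F → solve 4 (λ ρ b d t → lhs ρ b d t 2F := rhs ρ b d t 2F) refl ρ b d t
      3F → solve 4 (λ ρ b d t → lhs ρ b d t 3F := rhs ρ b d t 3F) refl ρ b d t
    where
    lhs rhs : ∀ {n} (ρ b d t : Polynomial n) → Fin 4 → Polynomial n
    lhs ρ b d t = Poly.cube t :1 Poly.⊛ Form.odd ρ (:- :1) b d
    rhs ρ b d t = Poly.cube (:- :1 :* d :* t :+ b :* :1) (:- :1 :* (ρ :* b) :* t :+ d :* :1)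

  -- The coefficients 3 and 2 of sym³ become 1 and 0.
  evenForm≈ : 1# + 1# ≈ 0# → ∀ η α c d → sym³ (α * c + d) (η * c + (α + 1#) * d) c d ≈ᴹ evenForm η α c d
  evenForm≈ 2≈0 η α c d = λ where
      0F → λ where
        0F → refl
        1F → *-comm _ _
        2F → *-comm _ _
        3F → refl
      1F → λ where
        0F → modulo (A * A * B) 2≈0 (solve 4 (λ A B c d → Poly.sym³ A B c d 1F 0F := Form.even A B c d 1F 0F :+ A :* A :* B :* (:1 :+ :1 :- :0)) refl A B c d)
        1F → modulo (A * B * c) 2≈0 (solve 4 (λ A B c d → Poly.sym³ A B c d 1F 1F := Form.even A B c d 1F 1F :+ A :* B :* c :* (:1 :+ :1 :- :0)) refl A B c d)
        2F → modulo (A * c * d) 2≈0 (solve 4 (λ A B c d → Poly.sym³ A B c d 1F 2F := Form.even A B c d 1F 2F :+ A :* c :* d :* (:1 :+ :1 :- :0)) refl A B c d)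
        3F → modulo (c * c * d) 2≈0 (solve 4 (λ A B c d → Poly.sym³ A B c d 1F 3F := Form.even A B c d 1F 3F :+ c :* c :* d :* (:1 :+ :1 :- :0)) refl A B c d)
      2F → λ where
        0F → modulo (A * B * B) 2≈0 (solve 4 (λ A B c d → Poly.sym³ A B c d 2F 0F := Form.even A B c d 2F 0F :+ A :* B :* B :* (:1 :+ :1 :- :0)) refl A B c d)
        1F → modulo (A * B * d) 2≈0 (solve 4 (λ A B c d → Poly.sym³ A B c d 2F 1F := Form.even A B c d 2F 1F :+ A :* B :* d :* (:1 :+ :1 :- :0)) refl A B c d)
        2F → modulo (B * c * d) 2≈0 (solve 4 (λ A B c d → Poly.sym³ A B c d 2F 2F := Form.even A B c d 2F 2F :+ B :* c :* d :* (:1 :+ :1 :- :0)) refl A B c d)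
        3F → modulo (c * d * d) 2≈0 (solve 4 (λ A B c d → Poly.sym³ A B c d 2F 3F := Form.even A B c d 2F 3F :+ c :* d :* d :* (:1 :+ :1 :- :0)) refl A B c d)
      3F → λ where
        0F → refl
        1F → *-comm _ _
        2F → *-comm _ _
        3F → refl
    where
    A = α * c + d
    B = η * c + (α + 1#) * d

-- Equations of imaginary chords.

module Chords
  {c ℓ c′ ℓ′} (q : ℕ) (5≤q : 5 ≤ q)
  (F : Field c ℓ) (sizeF : HasSize (Field.setoid F) q)
  (K : Field c′ ℓ′) (sizeK : HasSize (Field.setoid K) (q ℕ.^ 2))
  (ι : Field.Carrier F → Field.Carrier K)
  (ι-hom : IsRingHomomorphism (Field.rawRing F) (Field.rawRing K) ι)
  where

  2≤q : 2 ≤ q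
  2≤q = ℕₚ.≤-trans (s≤s (s≤s ℕ.z≤n)) 5≤q

  private
    module F where
      open Field F public
      open FieldProperties F public
      open Finite (Field.setoid F) sizeF public
      open TwistedCubic F public
      open ProjectiveSpace F public hiding (_^_)
      open CubicGroup F sizeF 5≤q public
  open Field K hiding (zero)
  open FieldProperties K
  open Finite setoid sizeK
  open TwistedCubic K
  open ProjectiveSpace K using (Vec₄; Matrix; _*ᵛ_; InSpan; P; coords) renaming (_·_ to _·ᴷ_)
  open ImaginaryChords q F K ι
  open QuadraticExtension q 2≤q F sizeF K sizeK ι ι-hom
  open QuadraticRoots q 2≤q F sizeF K sizeK ι ι-hom using (squareRoot; module Even)
  open Forms F sizeF 5≤q
  open import Relation.Binary.Reasoning.Setoid setoid

  private
    infix 4 _≉ꟳ0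
    _≉ꟳ0 : F.Carrier → Set ℓ
    x ≉ꟳ0 = ¬ (x F.≈ F.0#)

  -- The plane equations of the chord joining the points whose parameters are the roots of X² - T X + N.
  record Equations (T N : F.Carrier) (x : F.Vec₄) : Set ℓ where
    constructor equations
    field
      eq₀ : x 0F F.≈ T F.* x 1F F.- N F.* x 2F
      eq₁ : x 1F F.≈ T F.* x 2F F.- N F.* x 3F

  record Equationsᴷ (T N : F.Carrier) (x : Vec₄) : Set ℓ′ where
    constructor equations
    field
      eq₀ : x 0F ≈ ι T * x 1F - ι N * x 2F
      eq₁ : x 1F ≈ ι T * x 2F - ι N * x 3F

  ι-combination : ∀ T x N y → ι (T F.* x F.- N F.* y) ≈ ι T * ι x - ι N * ι y
  ι-combination T x N y = trans (ι-sub _ _) (+-cong (ι.*-homo T x) (-‿cong (ι.*-homo N y)))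

  Equations⇒ᴷ : ∀ {T N x} → Equations T N x → Equationsᴷ T N (ι ∘ x)
  Equations⇒ᴷ (equations e₀ e₁) = equations
    (trans (ι.⟦⟧-cong e₀) (ι-combination _ _ _ _)) (trans (ι.⟦⟧-cong e₁) (ι-combination _ _ _ _))

  Equationsᴷ⇒ : ∀ {T N x} → Equationsᴷ T N (ι ∘ x) → Equations T N x
  Equationsᴷ⇒ (equations e₀ e₁) = equations
    (ι-injective (trans e₀ (sym (ι-combination _ _ _ _)))) (ι-injective (trans e₁ (sym (ι-combination _ _ _ _))))

  Equationsᴷ-cong : ∀ {T N} {x y : Vec₄} → (∀ j → x j ≈ y j) → Equationsᴷ T N x → Equationsᴷ T N y
  Equationsᴷ-cong e (equations e₀ e₁) = equations
    (trans (sym (e 0F)) (trans e₀ (+-cong (*-congˡ (e 1F)) (-‿cong (*-congˡ (e 2F))))))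
    (trans (sym (e 1F)) (trans e₁ (+-cong (*-congˡ (e 2F)) (-‿cong (*-congˡ (e 3F))))))

  Equationsᴷ-span : ∀ {T N} {x y : Vec₄} a b → Equationsᴷ T N x → Equationsᴷ T N y → Equationsᴷ T N (λ j → a * x j + b * y j)
  Equationsᴷ-span {T} {N} {x} {y} a b (equations x₀ x₁) (equations y₀ y₁) = equations (collect x₀ y₀) (collect x₁ y₁)
    where
    collect : ∀ {p p₁ p₂ r r₁ r₂} → p ≈ ι T * p₁ - ι N * p₂ → r ≈ ι T * r₁ - ι N * r₂ →
              a * p + b * r ≈ ι T * (a * p₁ + b * r₁) - ι N * (a * p₂ + b * r₂)
    collect {p} {p₁} {p₂} {r} {r₁} {r₂} e e′ = modulo a e (modulo b e′
      (solve 10 (λ T N a b p p₁ p₂ r r₁ r₂ → a :* p :+ b :* r := T :* (a :* p₁ :+ b :* r₁) :- N :* (a :* p₂ :+ b :* r₂)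
           :+ a :* (p :- (T :* p₁ :- N :* p₂)) :+ b :* (r :- (T :* r₁ :- N :* r₂)))
        refl (ι T) (ι N) a b p p₁ p₂ r r₁ r₂))

  Equationsᴷ-unscale : ∀ {T N} {x : Vec₄} {k} → ¬ (k ≈ 0#) → Equationsᴷ T N (λ j → k * x j) → Equationsᴷ T N x
  Equationsᴷ-unscale {T} {N} {x} {k} k≉0 (equations e₀ e₁) = equations (unscale e₀) (unscale e₁)
    where
    unscale : ∀ {p p₁ p₂} → k * p ≈ ι T * (k * p₁) - ι N * (k * p₂) → p ≈ ι T * p₁ - ι N * p₂
    unscale {p} {p₁} {p₂} e = *-cancelˡ k≉0 (trans e
      (solve 5 (λ T N k p₁ p₂ → T :* (k :* p₁) :- N :* (k :* p₂) := k :* (T :* p₁ :- N :* p₂)) refl (ι T) (ι N) k p₁ p₂))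

  Equationsᴷ-unmix : ∀ {T N} {x y : Vec₄} a b e d → ¬ (a * d - b * e ≈ 0#) →
    Equationsᴷ T N (λ j → a * x j + b * y j) → Equationsᴷ T N (λ j → e * x j + d * y j) → Equationsᴷ T N x
  Equationsᴷ-unmix {x = x} {y} a b e d δ≉0 v w = Equationsᴷ-unscale δ≉0
    (Equationsᴷ-cong (λ j → solve 6 (λ a b e d x y → d :* (a :* x :+ b :* y) :+ :- b :* (e :* x :+ d :* y) := (a :* d :- b :* e) :* x)
        refl a b e d (x j) (y j))
      (Equationsᴷ-span d (- b) v w))

  -- (u : w) is the parameter of one of the two points of the chord on the cubic.
  Null : F.Carrier → F.Carrier → Carrier → Carrier → Set ℓ′
  Null T N u w = u * u ≈ ι T * (u * w) - ι N * (w * w)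

  -- On `cube u w` the two plane equations are u times and w times the quadratic relation; in the
  -- converse direction one of u, w is nonzero and can be cancelled.
  Null⇒Equationsᴷ : ∀ {T N u w} → Null T N u w → Equationsᴷ T N (cube u w)
  Null⇒Equationsᴷ {T} {N} {u} {w} e = equations
    (modulo u e (solve 4 (λ T N u w → Poly.cube u w 0F := T :* Poly.cube u w 1F :- N :* Poly.cube u w 2F
        :+ u :* (u :* u :- (T :* (u :* w) :- N :* (w :* w)))) refl (ι T) (ι N) u w))
    (modulo w e (solve 4 (λ T N u w → Poly.cube u w 1F := T :* Poly.cube u w 2F :- N :* Poly.cube u w 3F
        :+ w :* (u :* u :- (T :* (u :* w) :- N :* (w :* w)))) refl (ι T) (ι N) u w))

  Equationsᴷ⇒Null : ∀ {T N u w} → Nonzero² u w → Equationsᴷ T N (cube u w) → Null T N u w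
  Equationsᴷ⇒Null {T} {N} {u} {w} uw≉0 (equations e₀ e₁) with u ≟ 0#
  ... | no u≉0 = -‿≈0⇒≈ (*≈0⇒≈0 u≉0 (modulo 1# e₀
          (solve 4 (λ T N u w → u :* (u :* u :- (T :* (u :* w) :- N :* (w :* w)))
            := :0 :+ :1 :* (Poly.cube u w 0F :- (T :* Poly.cube u w 1F :- N :* Poly.cube u w 2F))) refl (ι T) (ι N) u w)))
  ... | yes u≈0 = -‿≈0⇒≈ (*≈0⇒≈0 (λ w≈0 → uw≉0 (u≈0 , w≈0)) (modulo 1# e₁
          (solve 4 (λ T N u w → w :* (u :* u :- (T :* (u :* w) :- N :* (w :* w)))
            := :0 :+ :1 :* (Poly.cube u w 1F :- (T :* Poly.cube u w 2F :- N :* Poly.cube u w 3F))) refl (ι T) (ι N) u w)))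

  root⇒Null : ∀ {T N r u w} → Root T N r → u ≈ r * w → Null T N u w
  root⇒Null {T} {N} {r} {u} {w} root e = modulo (w * w) root (modulo (u + r * w - ι T * w) e
    (solve 5 (λ T N r u w → u :* u := T :* (u :* w) :- N :* (w :* w) :+ w :* w :* (r :* r :- (T :* r :- N))
         :+ (u :+ r :* w :- T :* w) :* (u :- r :* w)) refl (ι T) (ι N) r u w))

  cube-root-equations : ∀ {T N r} → Root T N r → Equationsᴷ T N (cube r 1#)
  cube-root-equations root = Null⇒Equationsᴷ (root⇒Null root (sym (*-identityʳ _)))

  -- By the trace and norm of s the relation factors over `K` as (u - s w) (u - s^q w) = 0.
  Null⇒root : ∀ {T N s} (s∉F : ¬ InSubfield s) → Root T N s → ∀ {u w} → Null T N u w →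
              u ≈ s * w ⊎ u ≈ s ^ q * w
  Null⇒root {T} {N} {s} s∉F root {u} {w} e = split
    (modulo 1# e (modulo (- (u * w)) conjugate≈ (modulo (w * w) conjugate-norm
      (solve 6 (λ T N s s̄ u w → (u :- s :* w) :* (u :- s̄ :* w) := :0 :+ :1 :* (u :* u :- (T :* (u :* w) :- N :* (w :* w)))
           :+ :- (u :* w) :* (s̄ :- (T :- s)) :+ w :* w :* (s :* s̄ :- N)) refl (ι T) (ι N) s (s ^ q) u w))))
    where
    open Conjugate s∉F root
    split : (u - s * w) * (u - s ^ q * w) ≈ 0# → u ≈ s * w ⊎ u ≈ s ^ q * w
    split e with u - s * w ≟ 0#
    ... | yes u≈ = inj₁ (-‿≈0⇒≈ u≈)
    ... | no  u≉ = inj₂ (-‿≈0⇒≈ (*≈0⇒≈0 u≉ e))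

  cube-P : ∀ t j → coords (P t) j ≈ cube t 1# j
  cube-P t = λ where
    0F → refl
    1F → sym (*-identityʳ _)
    2F → solve 1 (λ t → t := t :* (:1 :* (:1 :* :1))) refl t
    3F → solve 0 (:1 := :1 :* (:1 :* (:1 :* :1))) refl

  P₁∈ : ∀ l → F.P₁ l F.∈ˡ l
  P₁∈ l = F.1# , F.0# , λ i → F.solve 2 (λ x y → x F.:= F.:1 F.:* x F.:+ F.:0 F.:* y) F.refl (F.coords (F.P₁ l) i) (F.coords (F.P₂ l) i)

  P₂∈ : ∀ l → F.P₂ l F.∈ˡ l
  P₂∈ l = F.0# , F.1# , λ i → F.solve 2 (λ x y → y F.:= F.:0 F.:* x F.:+ F.:1 F.:* y) F.refl (F.coords (F.P₁ l) i) (F.coords (F.P₂ l) i)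

  Equations-combine : ∀ {T N} {x y z : F.Vec₄} a b → Equations T N x → Equations T N y →
                      (∀ i → z i F.≈ a F.* x i F.+ b F.* y i) → Equations T N z
  Equations-combine {T} {N} {x} {y} {z} a b ex ey z≈ = Equationsᴷ⇒ (Equationsᴷ-cong
    (λ j → sym (trans (ι.⟦⟧-cong (z≈ j)) (trans (ι.+-homo _ _) (+-cong (ι.*-homo _ _) (ι.*-homo _ _)))))
    (Equationsᴷ-span (ι a) (ι b) (Equations⇒ᴷ ex) (Equations⇒ᴷ ey)))

  -- The equations express coordinate 1 through 2 and 3, then coordinate 0 through 1 and 2.
  Equationsᴷ-determined : ∀ {T N} {x y : Vec₄} → Equationsᴷ T N x → Equationsᴷ T N y →
                          x 2F ≈ y 2F → x 3F ≈ y 3F → ∀ i → x i ≈ y i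
  Equationsᴷ-determined {T} {N} {x} {y} (equations x₀ x₁) (equations y₀ y₁) e₂ e₃ = λ where
      0F → same x₀ y₀ e₁ e₂
      1F → e₁
      2F → e₂
      3F → e₃
    where
    same : ∀ {p p₁ p₂ r r₁ r₂} → p ≈ ι T * p₁ - ι N * p₂ → r ≈ ι T * r₁ - ι N * r₂ → p₁ ≈ r₁ → p₂ ≈ r₂ → p ≈ r
    same ep er e₁ e₂ = trans ep (trans (+-cong (*-congˡ e₁) (-‿cong (*-congˡ e₂))) (sym er))
    e₁ = same x₁ y₁ e₂ e₃

  Equations-determined : ∀ {T N} {x y : F.Vec₄} → Equations T N x → Equations T N y →
                         x 2F F.≈ y 2F → x 3F F.≈ y 3F → ∀ i → x i F.≈ y i
  Equations-determined ex ey e₂ e₃ i = ι-injective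
    (Equationsᴷ-determined (Equations⇒ᴷ ex) (Equations⇒ᴷ ey) (ι.⟦⟧-cong e₂) (ι.⟦⟧-cong e₃) i)

  module ChordPoints {t} (t∉F : ¬ InSubfield t) {T N} (root : Root T N t) (l : F.Line)
                     (t∈l : OnExtension (P t) l) (t^q∈l : OnExtension (P (t ^ q)) l) where

    open Conjugate t∉F root

    private
      p = F.coords (F.P₁ l)
      r = F.coords (F.P₂ l)
      a = proj₁ t∈l
      b = proj₁ (proj₂ t∈l)
      e = proj₁ t^q∈l
      d = proj₁ (proj₂ t^q∈l)

      onCube : ∀ {s} (s∈l : OnExtension (P s) l) j →
               cube s 1# j ≈ proj₁ s∈l * ι (p j) + proj₁ (proj₂ s∈l) * ι (r j)
      onCube {s} s∈l j = trans (sym (cube-P s j)) (proj₂ (proj₂ s∈l) j)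

      -- The left side is the determinant of coordinates 2 and 3 of P(t) and P(t^q). As it is
      -- nonzero, both factors are: the first lets the equations pass from the two cubic points to
      -- the spanning points of `l`, the second lets a point of the line be recovered from its last
      -- two coordinates.
      minor : t - t ^ q ≈ (a * d - b * e) * (ι (p 2F) * ι (r 3F) - ι (r 2F) * ι (p 3F))
      minor = trans
        (+-cong (trans (sym (*-identityʳ t)) (*-cong (proj₂ (proj₂ t∈l) 2F) (proj₂ (proj₂ t^q∈l) 3F)))
                (-‿cong (trans (sym (*-identityʳ (t ^ q))) (*-cong (proj₂ (proj₂ t^q∈l) 2F) (proj₂ (proj₂ t∈l) 3F)))))
        (solve 8 (λ a b e d p₂ p₃ r₂ r₃ → (a :* p₂ :+ b :* r₂) :* (e :* p₃ :+ d :* r₃) :- (e :* p₂ :+ d :* r₂) :* (a :* p₃ :+ b :* r₃)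
            := (a :* d :- b :* e) :* (p₂ :* r₃ :- r₂ :* p₃))
          refl a b e d (ι (p 2F)) (ι (p 3F)) (ι (r 2F)) (ι (r 3F)))

      minor≉0 : ¬ ((a * d - b * e) * (ι (p 2F) * ι (r 3F) - ι (r 2F) * ι (p 3F)) ≈ 0#)
      minor≉0 eq = conjugate≉ (trans minor eq)

      D = p 2F F.* r 3F F.- r 2F F.* p 3F

      D≉0 : ¬ (D F.≈ F.0#)
      D≉0 eq = factorʳ-≉0 minor≉0 (trans
        (trans (+-cong (sym (ι.*-homo _ _)) (-‿cong (sym (ι.*-homo _ _)))) (sym (ι-sub _ _)))
        (trans (ι.⟦⟧-cong eq) ι.0#-homo))

      spanned₁ : Equationsᴷ T N (λ j → a * ι (p j) + b * ι (r j))
      spanned₁ = Equationsᴷ-cong (onCube t∈l) (cube-root-equations root)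

      spanned₂ : Equationsᴷ T N (λ j → e * ι (p j) + d * ι (r j))
      spanned₂ = Equationsᴷ-cong (onCube t^q∈l) (cube-root-equations (root-^q root))

      equations-p : Equations T N p
      equations-p = Equationsᴷ⇒ (Equationsᴷ-unmix a b e d (factorˡ-≉0 minor≉0) spanned₁ spanned₂)

      equations-r : Equations T N r
      equations-r = Equationsᴷ⇒ (Equationsᴷ-unmix b a d e
        (λ eq → factorˡ-≉0 minor≉0 (trans
          (solve 4 (λ a b e d → a :* d :- b :* e := :- (b :* e :- a :* d)) refl a b e d)
          (trans (-‿cong eq) -0#≈0#)))
        (Equationsᴷ-cong (λ j → +-comm (a * ι (p j)) (b * ι (r j))) spanned₁)
        (Equationsᴷ-cong (λ j → +-comm (e * ι (p j)) (d * ι (r j))) spanned₂))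

    ∈⇒equations : ∀ x → x F.∈ˡ l → Equations T N (F.coords x)
    ∈⇒equations x (f , g , x≈) = Equations-combine f g equations-p equations-r x≈

    equations⇒∈ : ∀ x → Equations T N (F.coords x) → x F.∈ˡ l
    equations⇒∈ x ex = f , g , Equations-determined ex
        (Equations-combine f g equations-p equations-r (λ _ → F.refl))
        (F.modulo (F.- x₂) (F.*-inverse D≉0) (F.solve 7 (λ x₂ x₃ p₂ p₃ r₂ r₃ i → x₂ F.:=
          i F.:* (x₂ F.:* r₃ F.:- x₃ F.:* r₂) F.:* p₂ F.:+ i F.:* (x₃ F.:* p₂ F.:- x₂ F.:* p₃) F.:* r₂
            F.:+ F.:- x₂ F.:* ((p₂ F.:* r₃ F.:- r₂ F.:* p₃) F.:* i F.:- F.:1)) F.refl x₂ x₃ (p 2F) (p 3F) (r 2F) (r 3F) i))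
        (F.modulo (F.- x₃) (F.*-inverse D≉0) (F.solve 7 (λ x₂ x₃ p₂ p₃ r₂ r₃ i → x₃ F.:=
          i F.:* (x₂ F.:* r₃ F.:- x₃ F.:* r₂) F.:* p₃ F.:+ i F.:* (x₃ F.:* p₂ F.:- x₂ F.:* p₃) F.:* r₃
            F.:+ F.:- x₃ F.:* ((p₂ F.:* r₃ F.:- r₂ F.:* p₃) F.:* i F.:- F.:1)) F.refl x₂ x₃ (p 2F) (p 3F) (r 2F) (r 3F) i))
      where
      i = D F.⁻¹[ D≉0 ]
      x₂ = F.coords x 2F
      x₃ = F.coords x 3F
      -- Cramer's rule for coordinates 2 and 3; the equations take care of the other two.
      f = i F.* (x₂ F.* r 3F F.- x₃ F.* r 2F)
      g = i F.* (x₃ F.* p 2F F.- x₂ F.* p 3F)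

  -- The action of the group on chords through their parameters over `K`.

  ι-* : ∀ {a b a′ b′} → ι a ≈ a′ → ι b ≈ b′ → ι (a F.* b) ≈ a′ * b′
  ι-* e e′ = trans (ι.*-homo _ _) (*-cong e e′)

  ι-+ : ∀ {a b a′ b′} → ι a ≈ a′ → ι b ≈ b′ → ι (a F.+ b) ≈ a′ + b′
  ι-+ e e′ = trans (ι.+-homo _ _) (+-cong e e′)

  ι-· : ∀ n {a a′} → ι a ≈ a′ → ι (n F.· a) ≈ n ·ᴷ a′
  ι-· zero    e = ι.0#-homo
  ι-· (suc n) e = ι-+ e (ι-· n e)

  ι-*ᵛ : ∀ x G j → ι ((x F.*ᵛ G) j) ≈ ((ι ∘ x) *ᵛ (λ i j → ι (G i j))) j
  ι-*ᵛ x G j = ι-+ (ι.*-homo _ _) (ι-+ (ι.*-homo _ _) (ι-+ (ι.*-homo _ _) (ι-+ (ι.*-homo _ _) ι.0#-homo)))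

  ι-cube : ∀ s t j → ι (F.cube s t j) ≈ cube (ι s) (ι t) j
  ι-cube s t = λ where
    0F → ι-^ s 3
    1F → ι-* (ι-^ s 2) refl
    2F → ι-* refl (ι-^ t 2)
    3F → ι-^ t 3

  ι-sym³ : ∀ a b c d i j → ι (F.sym³ a b c d i j) ≈ sym³ (ι a) (ι b) (ι c) (ι d) i j
  ι-sym³ a b c d = λ where
      0F → ι-cube a c
      1F → λ where
        0F → ι-· 3 (ι-* (ι-^ a 2) refl)
        1F → ι-+ (ι-* (ι-^ a 2) refl) (ι-· 2 (ι-* (ι-* refl refl) refl))
        2F → ι-+ (ι-* refl (ι-^ c 2)) (ι-· 2 (ι-* (ι-* refl refl) refl))
        3F → ι-· 3 (ι-* (ι-^ c 2) refl)
      2F → λ where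
        0F → ι-· 3 (ι-* refl (ι-^ b 2))
        1F → ι-+ (ι-* (ι-^ b 2) refl) (ι-· 2 (ι-* (ι-* refl refl) refl))
        2F → ι-+ (ι-* refl (ι-^ d 2)) (ι-· 2 (ι-* (ι-* refl refl) refl))
        3F → ι-· 3 (ι-* refl (ι-^ d 2))
      3F → ι-cube b d

  ι-cubic : ∀ {G : F.Matrix} {k a b c d} → (∀ i j → G i j F.≈ k F.* F.sym³ a b c d i j) →
            ∀ i j → ι (G i j) ≈ ι k * sym³ (ι a) (ι b) (ι c) (ι d) i j
  ι-cubic G≈ i j = trans (ι.⟦⟧-cong (G≈ i j)) (ι-* refl (ι-sym³ _ _ _ _ i j))

  moebius-^q : ∀ a b t → (ι a * t + ι b) ^ q ≈ ι a * t ^ q + ι b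
  moebius-^q a b t = trans (^q-distrib-+ _ _) (+-cong (trans (^-distrib-* _ _ q) (*-congʳ (ιa^q≈ιa a))) (ιa^q≈ιa b))

  ι-det : ∀ {a b c d} → ¬ (F.det a b c d F.≈ F.0#) → ¬ (det (ι a) (ι b) (ι c) (ι d) ≈ 0#)
  ι-det δ≉0 e = δ≉0 (ι-≈0 (trans (ι-sub _ _) (trans (+-cong (ι.*-homo _ _) (-‿cong (ι.*-homo _ _))) e)))

  -- x is a K-combination of P(t) and its conjugate, whose images P(r) and its conjugate lie on the target.
  transport : ∀ {t T N} → ¬ InSubfield t → Root T N t → ∀ {r T′ N′} → Root T′ N′ r →
    ∀ {G : F.Matrix} {k a b c d} → (∀ i j → G i j F.≈ k F.* F.sym³ a b c d i j) →
    ι a * t + ι b ≈ r * (ι c * t + ι d) →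
    ∀ {x : F.Vec₄} → Equations T N x → Equations T′ N′ (x F.*ᵛ G)
  transport {t} {T} {N} t∉F root {r} {T′} {N′} root′ {G} {k} {a} {b} {c} {d} G≈ maps {x} ex =
    Equationsᴷ⇒ (Equationsᴷ-unscale conjugate≉ (Equationsᴷ-cong (λ j → sym (begin
        (t - t ^ q) * ι ((x F.*ᵛ G) j)
          ≈⟨ *-congˡ (ι-*ᵛ x G j) ⟩
        (t - t ^ q) * ((ι ∘ x) *ᵛ Gᴷ) j
          ≈⟨ *ᵛ-scaleˡ (t - t ^ q) (ι ∘ x) Gᴷ j ⟨
        ((λ i → (t - t ^ q) * ι (x i)) *ᵛ Gᴷ) j
          ≈⟨ *ᵛ-congˡ Gᴷ decompose j ⟩
        ((λ i → y * cube t 1# i + ȳ * cube (t ^ q) 1# i) *ᵛ Gᴷ) j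
          ≈⟨ *ᵛ-combine y (cube t 1#) ȳ (cube (t ^ q) 1#) Gᴷ j ⟩
        y * (cube t 1# *ᵛ Gᴷ) j + ȳ * (cube (t ^ q) 1# *ᵛ Gᴷ) j
          ≈⟨ +-cong (*-congˡ (cube-cubic (ι-cubic {G} G≈) t 1# j)) (*-congˡ (cube-cubic (ι-cubic {G} G≈) (t ^ q) 1# j)) ⟩
        y * (ι k * cube (u t) (w t) j) + ȳ * (ι k * cube (u (t ^ q)) (w (t ^ q)) j)
          ≈⟨ +-cong (*-assoc _ _ _) (*-assoc _ _ _) ⟨
        y * ι k * cube (u t) (w t) j + ȳ * ι k * cube (u (t ^ q)) (w (t ^ q)) j ∎))
      (Equationsᴷ-span (y * ι k) (ȳ * ι k) (Null⇒Equationsᴷ null) (Null⇒Equationsᴷ null̄))))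
    where
    open Conjugate t∉F root
    Gᴷ : Matrix
    Gᴷ i j = ι (G i j)
    -- Coefficients of (t - t^q) x on P(t) and P(t^q), read off from its last two coordinates; the
    -- factor t - t^q avoids a division and is cancelled at the end.
    y = ι (x 2F) - t ^ q * ι (x 3F)
    ȳ = t * ι (x 3F) - ι (x 2F)
    u w : Carrier → Carrier
    u s = ι a * s + ι b * 1#
    w s = ι c * s + ι d * 1#

    maps₁ : u t ≈ r * w t
    maps₁ = trans (+-congˡ (*-identityʳ _)) (trans maps (*-congˡ (+-congˡ (sym (*-identityʳ _)))))

    null : Null T′ N′ (u t) (w t)
    null = root⇒Null root′ maps₁

    -- Raising the relation for t to the q-th power gives the one for t^q, as a, b, c, d lie in F.
    null̄ : Null T′ N′ (u (t ^ q)) (w (t ^ q))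
    null̄ = root⇒Null (root-^q root′) (begin
      ι a * t ^ q + ι b * 1#               ≈⟨ +-congˡ (*-identityʳ _) ⟩
      ι a * t ^ q + ι b                    ≈⟨ moebius-^q a b t ⟨
      (ι a * t + ι b) ^ q                  ≈⟨ ^-congˡ q maps ⟩
      (r * (ι c * t + ι d)) ^ q            ≈⟨ ^-distrib-* _ _ q ⟩
      r ^ q * (ι c * t + ι d) ^ q          ≈⟨ *-congˡ (moebius-^q c d t) ⟩
      r ^ q * (ι c * t ^ q + ι d)          ≈⟨ *-congˡ (+-congˡ (*-identityʳ _)) ⟨
      r ^ q * (ι c * t ^ q + ι d * 1#)     ∎)

    decompose : ∀ i → (t - t ^ q) * ι (x i) ≈ y * cube t 1# i + ȳ * cube (t ^ q) 1# i
    decompose = Equationsᴷ-determined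
      (Equationsᴷ-cong (λ j → trans (+-congˡ (zeroˡ (ι (x j)))) (+-identityʳ _))
        (Equationsᴷ-span (t - t ^ q) 0# (Equations⇒ᴷ ex) (Equations⇒ᴷ ex)))
      (Equationsᴷ-span y ȳ (cube-root-equations root) (cube-root-equations (root-^q root)))
      (solve 4 (λ t t̄ x₂ x₃ → (t :- t̄) :* x₂ := (x₂ :- t̄ :* x₃) :* Poly.cube t :1 2F :+ (t :* x₃ :- x₂) :* Poly.cube t̄ :1 2F)
        refl t (t ^ q) (ι (x 2F)) (ι (x 3F)))
      (solve 4 (λ t t̄ x₂ x₃ → (t :- t̄) :* x₃ := (x₂ :- t̄ :* x₃) :* Poly.cube t :1 3F :+ (t :* x₃ :- x₂) :* Poly.cube t̄ :1 3F)
        refl t (t ^ q) (ι (x 2F)) (ι (x 3F)))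

  conjugate∉F : ∀ {t} → ¬ InSubfield t → ∀ {T N} → Root T N t → ¬ InSubfield (t ^ q)
  conjugate∉F {t} t∉F {T} {N} root (a , ιa≈) = t∉F (T F.- a , trans (ι-sub T a)
    (modulo (- 1#) ιa≈ (modulo (- 1#) conjugate≈
      (solve 4 (λ t u T a → T :- a := t :+ :- :1 :* (a :- u) :+ :- :1 :* (u :- (T :- t))) refl t (t ^ q) (ι T) (ι a)))))
    where open Conjugate t∉F root

  record Chord (l : F.Line) : Set (c Level.⊔ ℓ Level.⊔ c′ Level.⊔ ℓ′) where
    constructor chord
    field
      {t}    : Carrier
      {T N}  : F.Carrier
      t∉F    : ¬ InSubfield t
      root   : Root T N t
      t∈l    : OnExtension (P t) l
      t^q∈l  : OnExtension (P (t ^ q)) l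
    open ChordPoints t∉F root l t∈l t^q∈l public
    open Conjugate t∉F root public
    open Basis t∉F public

  toChord : ∀ {l} → IsImaginaryChord l → Chord l
  toChord (t , t∉F , t∈l , t^q∈l) = let _ , _ , root = minimalPolynomial t∉F in chord t∉F root t∈l t^q∈l

  Equations-unscale : ∀ {T N k} {x y : F.Vec₄} → k ≉ꟳ0 → (∀ j → y j F.≈ k F.* x j) → Equations T N y → Equations T N x
  Equations-unscale k≉0 y≈kx ey = Equationsᴷ⇒ (Equationsᴷ-unscale (k≉0 ∘ ι-≈0)
    (Equationsᴷ-cong (λ j → trans (ι.⟦⟧-cong (y≈kx j)) (ι.*-homo _ _)) (Equations⇒ᴷ ey)))

  module _ {l m} (C : Chord l) (D : Chord m) (g : F.Projectivity) {k a b c d}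
           (k≉0 : k ≉ꟳ0) (δ≉0 : F.det a b c d ≉ꟳ0)
           (G≈ : ∀ i j → F.matrix g i j F.≈ k F.* F.sym³ a b c d i j) where

    private
      module C = Chord C
      module D = Chord D

    -- Leaving `r` free among the roots covers both ways of matching the two pairs of conjugate
    -- points. The converse inclusion is again `transport`, along the adjugate, which takes r back
    -- to the parameter of the first chord.
    carries : ∀ {r} → ¬ InSubfield r → Root D.T D.N r → ι a * C.t + ι b ≈ r * (ι c * C.t + ι d) → F.CarriesLine g l m
    carries {r} r∉F root maps x = mk⇔
      (λ x∈l → D.equations⇒∈ (F.act g x) (transport C.t∉F C.root root G≈ maps (C.∈⇒equations x x∈l)))
      (λ xg∈m → C.equations⇒∈ x (Equations-unscale (F.*-≉0 k≉0 (F.^3-≉0 δ≉0)) (F.undo G≈ (F.coords x))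
        (transport r∉F root C.root (λ _ _ → F.sym (F.*-identityˡ _)) maps⁻¹ (D.∈⇒equations (F.act g x) xg∈m))))
      where
      maps⁻¹ : ι d * r + ι (F.- b) ≈ C.t * (ι (F.- c) * r + ι a)
      maps⁻¹ = trans (+-congˡ (ι.-‿homo b)) (trans
        (modulo (- 1#) maps (solve 6 (λ a b c d r t → d :* r :+ :- b := t :* (:- c :* r :+ a) :+ :- :1 :* (a :* t :+ b :- r :* (c :* t :+ d)))
          refl (ι a) (ι b) (ι c) (ι d) r C.t))
        (*-congˡ (+-congʳ (*-congʳ (sym (ι.-‿homo c))))))

    -- The image of P(t) is a `K`-combination of the images of the points spanning `l`, so it
    -- satisfies the equations of `m`; being on the cubic over `K`, its parameter is one of the two
    -- roots.
    carries-only : F.CarriesLine g l m →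
      ι a * C.t + ι b ≈ D.t * (ι c * C.t + ι d) ⊎ ι a * C.t + ι b ≈ D.t ^ q * (ι c * C.t + ι d)
    carries-only g-carries = Sum.map tidy tidy
      (Null⇒root D.t∉F D.root (Equationsᴷ⇒Null (Nonzero²-map (ι-det δ≉0) (1≉0 ∘ proj₂))
        (Equationsᴷ-unscale (k≉0 ∘ ι-≈0) (Equationsᴷ-cong image
          (Equationsᴷ-span α β (onTarget {F.P₁ l} (P₁∈ l)) (onTarget {F.P₂ l} (P₂∈ l)))))))
      where
      α = proj₁ C.t∈l
      β = proj₁ (proj₂ C.t∈l)
      Gᴷ : Matrix
      Gᴷ i j = ι (F.matrix g i j)
      x₁ = F.coords (F.P₁ l)
      x₂ = F.coords (F.P₂ l)

      tidy : ∀ {s} → ι a * C.t + ι b * 1# ≈ s * (ι c * C.t + ι d * 1#) → ι a * C.t + ι b ≈ s * (ι c * C.t + ι d)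
      tidy e = trans (+-congˡ (sym (*-identityʳ _))) (trans e (*-congˡ (+-congˡ (*-identityʳ _))))

      onTarget : ∀ {x} → x F.∈ˡ l → Equationsᴷ D.T D.N (ι ∘ (F.coords x F.*ᵛ F.matrix g))
      onTarget {x} x∈l = Equations⇒ᴷ (D.∈⇒equations (F.act g x) (Equivalence.to (g-carries x) x∈l))

      image : ∀ j → α * ι ((x₁ F.*ᵛ F.matrix g) j) + β * ι ((x₂ F.*ᵛ F.matrix g) j)
                    ≈ ι k * cube (ι a * C.t + ι b * 1#) (ι c * C.t + ι d * 1#) j
      image j = begin
        α * ι ((x₁ F.*ᵛ F.matrix g) j) + β * ι ((x₂ F.*ᵛ F.matrix g) j)
          ≈⟨ +-cong (*-congˡ (ι-*ᵛ x₁ (F.matrix g) j)) (*-congˡ (ι-*ᵛ x₂ (F.matrix g) j)) ⟩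
        α * ((ι ∘ x₁) *ᵛ Gᴷ) j + β * ((ι ∘ x₂) *ᵛ Gᴷ) j
          ≈⟨ *ᵛ-combine α (ι ∘ x₁) β (ι ∘ x₂) Gᴷ j ⟨
        ((λ i → α * ι (x₁ i) + β * ι (x₂ i)) *ᵛ Gᴷ) j
          ≈⟨ *ᵛ-congˡ Gᴷ (λ i → trans (sym (cube-P C.t i)) (proj₂ (proj₂ C.t∈l) i)) j ⟨
        (cube C.t 1# *ᵛ Gᴷ) j
          ≈⟨ cube-cubic (ι-cubic {F.matrix g} G≈) C.t 1# j ⟩
        ι k * cube (ι a * C.t + ι b * 1#) (ι c * C.t + ι d * 1#) j ∎

  -- The imaginary chords form one orbit.

  open import Data.Vec.Functional using ([]; _∷_)

  -- The spanning points solve the plane equations with last coordinates (1, 0) and (0, 1), so that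
  -- P(s) is s times the first plus the second for each root s.
  chordLine : F.Carrier → F.Carrier → F.Line
  chordLine T N = F.line
    (F.point (T F.* T F.- N ∷ T ∷ F.1# ∷ F.0# ∷ []) (λ z → F.1≉0 (z 2F)))
    (F.point (F.- (T F.* N) ∷ F.- N ∷ F.0# ∷ F.1# ∷ []) (λ z → F.1≉0 (z 3F)))
    (λ (k , _ , e) → F.1≉0 (F.trans (e 2F) (F.zeroʳ k)))

  root∈chordLine : ∀ {T N s} → Root T N s → OnExtension (P s) (chordLine T N)
  root∈chordLine {T} {N} {s} root = s , 1# , λ where
      0F → trans (modulo (s + ι T) root (solve 3 (λ T N s → Poly.cube s :1 0F :* :1
             := s :* (T :* T :- N) :+ :1 :* (:- (T :* N)) :+ (s :+ T) :* (s :* s :- (T :* s :- N))) refl (ι T) (ι N) s) ∘′ cube-P s 0F)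
             (+-cong (*-congˡ (sym (trans (ι-sub _ _) (+-congʳ (ι.*-homo T T))))) (*-congˡ (sym (trans (ι.-‿homo _) (-‿cong (ι.*-homo T N))))))
      1F → trans (modulo 1# root (solve 3 (λ T N s → s :* (s :* :1) := s :* T :+ :1 :* (:- N) :+ :1 :* (s :* s :- (T :* s :- N))) refl (ι T) (ι N) s))
             (+-congˡ (*-congˡ (sym (ι.-‿homo N))))
      2F → trans (solve 1 (λ s → s := s :* :1 :+ :1 :* :0) refl s) (+-cong (*-congˡ (sym ι.1#-homo)) (*-congˡ (sym ι.0#-homo)))
      3F → trans (solve 1 (λ s → :1 := s :* :0 :+ :1 :* :1) refl s) (+-cong (*-congˡ (sym ι.0#-homo)) (*-congˡ (sym ι.1#-homo)))
    where
    _∘′_ : ∀ {x y z} → x * 1# ≈ z → y ≈ x → y ≈ z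
    _∘′_ e e′ = trans e′ (trans (sym (*-identityʳ _)) e)

  InSpan-combine : ∀ {u v x y z} a b → InSpan u v x → InSpan u v y → (∀ i → z i ≈ a * x i + b * y i) → InSpan u v z
  InSpan-combine {u} {v} {x} {y} {z} a b (f , g , x≈) (f′ , g′ , y≈) z≈ = a * f + b * f′ , a * g + b * g′ , λ i →
    trans (z≈ i) (trans (+-cong (*-congˡ (x≈ i)) (*-congˡ (y≈ i)))
      (solve 8 (λ a b f g f′ g′ u v → a :* (f :* u :+ g :* v) :+ b :* (f′ :* u :+ g′ :* v) := (a :* f :+ b :* f′) :* u :+ (a :* g :+ b :* g′) :* v)
        refl a b f g f′ g′ (u i) (v i)))

  ∈⇒InSpan : ∀ {l} x → x F.∈ˡ l → InSpan (ι ∘ F.coords (F.P₁ l)) (ι ∘ F.coords (F.P₂ l)) (ι ∘ F.coords x)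
  ∈⇒InSpan x (f , g , x≈) = ι f , ι g , λ i → trans (ι.⟦⟧-cong (x≈ i)) (ι-+ (ι.*-homo _ _) (ι.*-homo _ _))

  -- `CarriesLine` speaks of points over F only. Applied to the two spanning points it extends
  -- linearly to `K`, and the factor k (c t + d)³ relates the image of P(t) to P(s).
  OnExtension-map : ∀ {l m} g {k a b c d} → k ≉ꟳ0 → (∀ i j → F.matrix g i j F.≈ k F.* F.sym³ a b c d i j) →
    F.CarriesLine g l m → ∀ {t s} → OnExtension (P t) l → ¬ (ι c * t + ι d ≈ 0#) → ι a * t + ι b ≈ s * (ι c * t + ι d) →
    OnExtension (P s) m
  OnExtension-map {l} {m} g {k} {a} {b} {c} {d} k≉0 G≈ g-carries {t} {s} (α , β , t≈) w≉0 maps =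
    InSpan-combine (κ⁻¹ * α) (κ⁻¹ * β)
      (∈⇒InSpan {m} (F.act g (F.P₁ l)) (Equivalence.to (g-carries (F.P₁ l)) (P₁∈ l)))
      (∈⇒InSpan {m} (F.act g (F.P₂ l)) (Equivalence.to (g-carries (F.P₂ l)) (P₂∈ l)))
      λ j → trans (cube-P s j) (*-cancelˡ κ≉0 (begin
        κ * cube s 1# j
          ≈⟨ *-assoc _ _ _ ⟩
        ι k * (w ^ 3 * cube s 1# j)
          ≈⟨ *-congˡ (cube-scale w s 1# j) ⟨
        ι k * cube (w * s) (w * 1#) j
          ≈⟨ *-congˡ (cube-cong (trans (*-comm w s) (trans (sym maps) (+-congˡ (sym (*-identityʳ (ι b))))))
                                (trans (*-identityʳ w) (+-congˡ (sym (*-identityʳ (ι d))))) j) ⟩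
        ι k * cube (ι a * t + ι b * 1#) (ι c * t + ι d * 1#) j
          ≈⟨ cube-cubic (ι-cubic {F.matrix g} G≈) t 1# j ⟨
        (cube t 1# *ᵛ Gᴷ) j
          ≈⟨ *ᵛ-congˡ Gᴷ (λ i → trans (sym (cube-P t i)) (t≈ i)) j ⟩
        ((λ i → α * ι (x₁ i) + β * ι (x₂ i)) *ᵛ Gᴷ) j
          ≈⟨ *ᵛ-combine α (ι ∘ x₁) β (ι ∘ x₂) Gᴷ j ⟩
        α * ((ι ∘ x₁) *ᵛ Gᴷ) j + β * ((ι ∘ x₂) *ᵛ Gᴷ) j
          ≈⟨ +-cong (*-congˡ (ι-*ᵛ x₁ (F.matrix g) j)) (*-congˡ (ι-*ᵛ x₂ (F.matrix g) j)) ⟨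
        α * y₁ j + β * y₂ j
          ≈⟨ modulo (- (α * y₁ j + β * y₂ j)) (*-inverse κ≉0)
               (solve 6 (λ α β y z κ i → α :* y :+ β :* z := κ :* (i :* α :* y :+ i :* β :* z) :+ :- (α :* y :+ β :* z) :* (κ :* i :- :1))
                 refl α β (y₁ j) (y₂ j) κ κ⁻¹) ⟩
        κ * (κ⁻¹ * α * y₁ j + κ⁻¹ * β * y₂ j) ∎))
    where
    w = ι c * t + ι d
    κ = ι k * w ^ 3
    κ≉0 : ¬ (κ ≈ 0#)
    κ≉0 = *-≉0 (k≉0 ∘ ι-≈0) (^3-≉0 w≉0)
    κ⁻¹ = κ ⁻¹[ κ≉0 ]
    Gᴷ : Matrix
    Gᴷ i j = ι (F.matrix g i j)
    x₁ = F.coords (F.P₁ l)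
    x₂ = F.coords (F.P₂ l)
    y₁ y₂ : Vec₄
    y₁ j = ι ((x₁ F.*ᵛ F.matrix g) j)
    y₂ j = ι ((x₂ F.*ᵛ F.matrix g) j)

  moebius-≉0 : ∀ {t} → ¬ InSubfield t → ∀ {a b c d} → F.det a b c d ≉ꟳ0 → ¬ (ι c * t + ι d ≈ 0#)
  moebius-≉0 t∉F {a} {b} {c} {d} δ≉0 e =
    let d≈0 , c≈0 = Basis.independent t∉F (trans (+-comm _ _) e)
    in δ≉0 (F.trans (F.+-cong (F.trans (F.*-congˡ d≈0) (F.zeroʳ a)) (F.-‿cong (F.trans (F.*-congˡ c≈0) (F.zeroʳ b)))) (F.-‿inverseʳ F.0#))

  -- If s were some r in F, comparing coefficients of 1 and t would give (a, b) = r (c, d) and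
  -- determinant zero.
  moebius∉F : ∀ {t} → ¬ InSubfield t → ∀ {a b c d} → F.det a b c d ≉ꟳ0 → ∀ {s} →
              ι a * t + ι b ≈ s * (ι c * t + ι d) → ¬ InSubfield s
  moebius∉F {t} t∉F {a} {b} {c} {d} δ≉0 {s} maps (r , ιr≈s) =
    let b≈ , a≈ = Basis.coefficients-unique t∉F {b} {a} {r F.* d} {r F.* c} (begin
          ι b + ι a * t                    ≈⟨ +-comm _ _ ⟩
          ι a * t + ι b                    ≈⟨ maps ⟩
          s * (ι c * t + ι d)              ≈⟨ *-congʳ ιr≈s ⟨
          ι r * (ι c * t + ι d)            ≈⟨ solve 4 (λ r c d t → r :* (c :* t :+ d) := r :* d :+ r :* c :* t) refl (ι r) (ι c) (ι d) t ⟩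
          ι r * ι d + ι r * ι c * t        ≈⟨ +-cong (ι.*-homo r d) (*-congʳ (ι.*-homo r c)) ⟨
          ι (r F.* d) + ι (r F.* c) * t    ∎)
    in δ≉0 (F.trans (F.+-cong (F.*-congʳ a≈) (F.-‿cong (F.*-congʳ b≈)))
         (F.solve 3 (λ r c d → r F.:* c F.:* d F.:- r F.:* d F.:* c F.:= F.:0) F.refl r c d))

  image-of-chord : ∀ {l m} → Chord l → ∀ g → F.IsCubic (F.matrix g) → F.CarriesLine g l m → IsImaginaryChord m
  image-of-chord {l} {m} C g (F.isCubic {k} {a} {b} {c} {d} k≉0 δ≉0 G≈) g-carries =
    s , moebius∉F t∉F δ≉0 maps
      , OnExtension-map {l} {m} g k≉0 G≈ g-carries t∈l w≉0 maps
      , OnExtension-map {l} {m} g k≉0 G≈ g-carries t^q∈l (moebius-≉0 (conjugate∉F t∉F root) δ≉0) (begin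
          ι a * t ^ q + ι b              ≈⟨ moebius-^q a b t ⟨
          (ι a * t + ι b) ^ q            ≈⟨ ^-congˡ q maps ⟩
          (s * w) ^ q                    ≈⟨ ^-distrib-* s w q ⟩
          s ^ q * w ^ q                  ≈⟨ *-congˡ (moebius-^q c d t) ⟩
          s ^ q * (ι c * t ^ q + ι d)    ∎)
    where
    open Chord C
    w = ι c * t + ι d
    w≉0 = moebius-≉0 t∉F δ≉0
    s = (ι a * t + ι b) * w ⁻¹[ w≉0 ]
    maps : ι a * t + ι b ≈ s * w
    maps = modulo (- (ι a * t + ι b)) (*-inverse w≉0)
      (solve 3 (λ u w i → u := u :* i :* w :+ :- u :* (w :* i :- :1)) refl (ι a * t + ι b) w (w ⁻¹[ w≉0 ]))

  -- Every element of K outside F is an affine image of t.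
  chord-to-chord : ∀ {l m} → Chord l → Chord m → ∃ λ g → F.InG g × F.CarriesLine g l m
  chord-to-chord {l} {m} C D = affine (C.spans D.t)
    where
    module C = Chord C
    module D = Chord D
    affine : (∃₂ λ e f → D.t ≈ ι e + ι f * C.t) → ∃ λ g → F.InG g × F.CarriesLine g l m
    affine (e , f , s≈) = g , F.IsCubic⇒InG g (F.isCubic F.1≉0 δ≉0 G≈) , carries C D g F.1≉0 δ≉0 G≈ D.t∉F D.root maps
      where
      δ≉0 : F.det f e F.0# F.1# ≉ꟳ0
      δ≉0 eq = D.t∉F (e , sym (trans s≈ (trans (+-congˡ (trans (*-congʳ (trans (ι.⟦⟧-cong f≈0) ι.0#-homo)) (zeroˡ C.t))) (+-identityʳ _))))
        where
        f≈0 : f F.≈ F.0#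
        f≈0 = F.trans (F.solve 2 (λ e f → f F.:= f F.:* F.:1 F.:- e F.:* F.:0) F.refl e f) eq
      g = F.cubicProjectivity f e F.0# F.1# δ≉0
      G≈ : ∀ i j → F.matrix g i j F.≈ F.1# F.* F.sym³ f e F.0# F.1# i j
      G≈ _ _ = F.sym (F.*-identityˡ _)
      maps : ι f * C.t + ι e ≈ D.t * (ι F.0# * C.t + ι F.1#)
      maps = trans (+-comm _ _) (trans (sym s≈) (trans (solve 2 (λ s t → s := s :* (:0 :* t :+ :1)) refl D.t C.t)
        (*-congˡ (+-cong (*-congʳ (sym ι.0#-homo)) (sym ι.1#-homo)))))

  orbit-of-chord : ∀ {l} → Chord l → F.IsOrbit IsImaginaryChord
  orbit-of-chord {l} C = l , λ m → mk⇔
    (λ m-chord → chord-to-chord {l} {m} C (toChord m-chord))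
    (λ (g , g∈G , g-carries) → image-of-chord {l} {m} C g (F.InG⇒IsCubic g g∈G) g-carries)

  root⇒chord : ∀ {t} → ¬ InSubfield t → ∀ {T N} → Root T N t → Chord (chordLine T N)
  root⇒chord t∉F root = chord t∉F root (root∈chordLine root) (root∈chordLine (root-^q root))

  imaginaryChords-orbit : F.IsOrbit IsImaginaryChord
  imaginaryChords-orbit =
    let t , t∉F      = exists-nonsubfield
        T , N , root = minimalPolynomial t∉F
    in orbit-of-chord (root⇒chord t∉F root)

  -- The stabiliser of an imaginary chord and its size.

  -- The elements of PGL(2,q) fixing (0F) and interchanging (1F) the roots of X² - T X + N.
  module Symmetries (T N : F.Carrier) where

    A B : Fin 2 → (c d : F.Carrier) → F.Carrier
    A 0F c d = c F.* T F.+ d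
    A 1F c d = F.- d
    B 0F c d = F.- (c F.* N)
    B 1F c d = c F.* N F.+ d F.* T

    symmetry : Fin 2 → (c d : F.Carrier) → F.Matrix
    symmetry σ c d = F.sym³ (A σ c d) (B σ c d) c d

    -- For a root t outside F this is the norm (c t + d) (c t^q + d) of c t + d; up to sign it is
    -- the determinant of both kinds of symmetry.
    norm : (c d : F.Carrier) → F.Carrier
    norm c d = d F.* d F.+ c F.* d F.* T F.+ c F.* c F.* N

    det-symmetry : ∀ σ c d → F.det (A σ c d) (B σ c d) c d ≉ꟳ0 ⇔ norm c d ≉ꟳ0
    det-symmetry 0F c d = mk⇔ (λ δ≉0 e → δ≉0 (F.trans eq e)) (λ n≉0 e → n≉0 (F.trans (F.sym eq) e))
      where
      eq = F.solve 4 (λ T N c d → (c F.:* T F.:+ d) F.:* d F.:- F.:- (c F.:* N) F.:* c F.:= d F.:* d F.:+ c F.:* d F.:* T F.:+ c F.:* c F.:* N) F.refl T N c d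
    det-symmetry 1F c d = mk⇔ (λ δ≉0 e → δ≉0 (F.trans eq (F.trans (F.-‿cong e) F.-0#≈0#)))
                              (λ n≉0 e → n≉0 (F.trans eq′ (F.trans (F.-‿cong e) F.-0#≈0#)))
      where
      eq = F.solve 4 (λ T N c d → F.:- d F.:* d F.:- (c F.:* N F.:+ d F.:* T) F.:* c F.:= F.:- (d F.:* d F.:+ c F.:* d F.:* T F.:+ c F.:* c F.:* N)) F.refl T N c d
      eq′ = F.solve 4 (λ T N c d → d F.:* d F.:+ c F.:* d F.:* T F.:+ c F.:* c F.:* N F.:= F.:- (F.:- d F.:* d F.:- (c F.:* N F.:+ d F.:* T) F.:* c)) F.refl T N c d

    A-scale : ∀ σ k c d → A σ (k F.* c) (k F.* d) F.≈ k F.* A σ c d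
    A-scale 0F k c d = F.solve 4 (λ T k c d → k F.:* c F.:* T F.:+ k F.:* d F.:= k F.:* (c F.:* T F.:+ d)) F.refl T k c d
    A-scale 1F k c d = F.solve 2 (λ k d → F.:- (k F.:* d) F.:= k F.:* F.:- d) F.refl k d

    B-scale : ∀ σ k c d → B σ (k F.* c) (k F.* d) F.≈ k F.* B σ c d
    B-scale 0F k c d = F.solve 3 (λ N k c → F.:- (k F.:* c F.:* N) F.:= k F.:* F.:- (c F.:* N)) F.refl N k c
    B-scale 1F k c d = F.solve 5 (λ T N k c d → k F.:* c F.:* N F.:+ k F.:* d F.:* T F.:= k F.:* (c F.:* N F.:+ d F.:* T)) F.refl T N k c d

    A-cong : ∀ σ {c c′ d d′} → c F.≈ c′ → d F.≈ d′ → A σ c d F.≈ A σ c′ d′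
    A-cong 0F c≈ d≈ = F.+-cong (F.*-congʳ c≈) d≈
    A-cong 1F c≈ d≈ = F.-‿cong d≈

    B-cong : ∀ σ {c c′ d d′} → c F.≈ c′ → d F.≈ d′ → B σ c d F.≈ B σ c′ d′
    B-cong 0F c≈ d≈ = F.-‿cong (F.*-congʳ c≈)
    B-cong 1F c≈ d≈ = F.+-cong (F.*-congʳ c≈) (F.*-congʳ d≈)

    symmetry-scale : ∀ σ {k c d c′ d′} → c F.≈ k F.* c′ → d F.≈ k F.* d′ →
                     ∀ i j → symmetry σ c d i j F.≈ k F.^ 3 F.* symmetry σ c′ d′ i j
    symmetry-scale σ {k} {c} {d} {c′} {d′} c≈ d≈ i j = F.trans
      (F.sym³-cong (F.trans (A-cong σ c≈ d≈) (A-scale σ k c′ d′)) (F.trans (B-cong σ c≈ d≈) (B-scale σ k c′ d′)) c≈ d≈ i j)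
      (F.sym³-scale k (A σ c′ d′) (B σ c′ d′) c′ d′ i j)

  module ChordStabilizer {l} (C : Chord l) where
    open Chord C
    open Symmetries T N

    parameter : Fin 2 → Carrier
    parameter 0F = t
    parameter 1F = t ^ q

    parameter∉F : ∀ σ → ¬ InSubfield (parameter σ)
    parameter∉F 0F = t∉F
    parameter∉F 1F = conjugate∉F t∉F root

    parameter-root : ∀ σ → Root T N (parameter σ)
    parameter-root 0F = root
    parameter-root 1F = root-^q root

    norm≉0 : ∀ {c d} → F.Nonzero² c d → norm c d ≉ꟳ0
    norm≉0 {c} {d} cd≉0 n≈0 = *-≉0 (linear≉0 t∉F) (linear≉0 (conjugate∉F t∉F root)) (begin
      (ι c * t + ι d) * (ι c * t ^ q + ι d)
        ≈⟨ modulo (ι c * ι c) conjugate-norm (modulo (ι c * ι d) conjugate≈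
             (solve 6 (λ t u T N c d → (c :* t :+ d) :* (c :* u :+ d) := d :* d :+ c :* d :* T :+ c :* c :* N
                 :+ c :* c :* (t :* u :- N) :+ c :* d :* (u :- (T :- t))) refl t (t ^ q) (ι T) (ι N) (ι c) (ι d))) ⟩
      ι d * ι d + ι c * ι d * ι T + ι c * ι c * ι N
        ≈⟨ ι-+ (ι-+ (ι.*-homo _ _) (ι-* (ι.*-homo _ _) refl)) (ι-* (ι.*-homo _ _) refl) ⟨
      ι (norm c d)
        ≈⟨ trans (ι.⟦⟧-cong n≈0) ι.0#-homo ⟩
      0# ∎)
      where
      linear≉0 : ∀ {s} → ¬ InSubfield s → ¬ (ι c * s + ι d ≈ 0#)
      linear≉0 s∉F e = let d≈0 , c≈0 = Basis.independent s∉F (trans (+-comm _ _) e) in cd≉0 (c≈0 , d≈0)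

    symmetry-maps : ∀ σ c d → ι (A σ c d) * t + ι (B σ c d) ≈ parameter σ * (ι c * t + ι d)
    symmetry-maps 0F c d = trans (+-cong (*-congʳ (ι-+ (ι.*-homo c T) refl)) (trans (ι.-‿homo _) (-‿cong (ι.*-homo c N))))
      (modulo (- ι c) root (solve 5 (λ t T N c d → (c :* T :+ d) :* t :+ :- (c :* N) := t :* (c :* t :+ d) :+ :- c :* (t :* t :- (T :* t :- N)))
        refl t (ι T) (ι N) (ι c) (ι d)))
    symmetry-maps 1F c d = trans (+-cong (*-congʳ (ι.-‿homo d)) (ι-+ (ι.*-homo c N) (ι.*-homo d T)))
      (modulo (- ι c) conjugate-norm (modulo (- ι d) conjugate≈
        (solve 6 (λ t u T N c d → :- d :* t :+ (c :* N :+ d :* T) := u :* (c :* t :+ d) :+ :- c :* (t :* u :- N) :+ :- d :* (u :- (T :- t)))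
          refl t (t ^ q) (ι T) (ι N) (ι c) (ι d))))

    -- Since 1 and t form a basis, c, d and the choice of the root leave a single possibility for a
    -- and b.
    maps⇒symmetry : ∀ σ {a b c d} → ι a * t + ι b ≈ parameter σ * (ι c * t + ι d) → a F.≈ A σ c d × b F.≈ B σ c d
    maps⇒symmetry σ {a} {b} {c} {d} maps =
      let b≈ , a≈ = coefficients-unique {b} {a} {B σ c d} {A σ c d}
            (trans (+-comm _ _) (trans maps (trans (sym (symmetry-maps σ c d)) (+-comm _ _))))
      in a≈ , b≈

    stabilizer-form : ∀ g → F.InStabilizer l g → ∃ λ σ → ∃₂ λ c d → F.Nonzero² c d × F.matrix g F.∼ᴹ symmetry σ c d
    stabilizer-form g (g∈G , g-carries) = form (F.InG⇒IsCubic g g∈G)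
      where
      form : F.IsCubic (F.matrix g) → ∃ λ σ → ∃₂ λ c d → F.Nonzero² c d × F.matrix g F.∼ᴹ symmetry σ c d
      form (F.isCubic {k} {a} {b} {c} {d} k≉0 δ≉0 G≈) = [ of-type 0F , of-type 1F ]′ (carries-only C C g k≉0 δ≉0 G≈ g-carries)
        where
        cd≉0 : F.Nonzero² c d
        cd≉0 (c≈0 , d≈0) = δ≉0 (F.trans (F.+-cong (F.trans (F.*-congˡ d≈0) (F.zeroʳ a)) (F.-‿cong (F.trans (F.*-congˡ c≈0) (F.zeroʳ b)))) (F.-‿inverseʳ F.0#))
        of-type : ∀ σ → ι a * t + ι b ≈ parameter σ * (ι c * t + ι d) →
                  ∃ λ σ → ∃₂ λ c d → F.Nonzero² c d × F.matrix g F.∼ᴹ symmetry σ c d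
        of-type σ maps = let a≈ , b≈ = maps⇒symmetry σ maps in
          σ , c , d , cd≉0 , k , k≉0 , λ i j → F.trans (G≈ i j) (F.*-congˡ (F.sym³-cong a≈ b≈ F.refl F.refl i j))

    symmetryProjectivity : ∀ σ {c d} → F.Nonzero² c d → ∃ (F.InStabilizer l)
    symmetryProjectivity σ {c} {d} cd≉0 = g , F.IsCubic⇒InG g (F.isCubic F.1≉0 δ≉0 G≈) ,
      carries C C g F.1≉0 δ≉0 G≈ (parameter∉F σ) (parameter-root σ) (symmetry-maps σ c d)
      where
      δ≉0 : F.det (A σ c d) (B σ c d) c d ≉ꟳ0
      δ≉0 = Equivalence.from (det-symmetry σ c d) (norm≉0 cd≉0)
      g = F.cubicProjectivity (A σ c d) (B σ c d) c d δ≉0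
      G≈ : ∀ i j → F.matrix g i j F.≈ F.1# F.* symmetry σ c d i j
      G≈ _ _ = F.sym (F.*-identityˡ _)

    -- Representatives (1, x) and (0, 1) of the q + 1 points of the projective line; scaling (c, d)
    -- by k only scales the symmetry, by k³.
    direction : Fin q ⊎ Fin 1 → F.Carrier × F.Carrier
    direction (inj₁ i) = F.1# , F.element i
    direction (inj₂ _) = F.0# , F.1#

    direction≉0 : ∀ p → F.Nonzero² (proj₁ (direction p)) (proj₂ (direction p))
    direction≉0 (inj₁ _) (1≈0 , _) = F.1≉0 1≈0
    direction≉0 (inj₂ _) (_ , 1≈0) = F.1≉0 1≈0

    symmetryAt : Fin 2 → Fin q ⊎ Fin 1 → F.Matrix
    symmetryAt σ p = symmetry σ (proj₁ (direction p)) (proj₂ (direction p))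

    direction-onto : ∀ {c d} → F.Nonzero² c d →
      ∃₂ λ k p → k ≉ꟳ0 × c F.≈ k F.* proj₁ (direction p) × d F.≈ k F.* proj₂ (direction p)
    direction-onto {c} {d} cd≉0 with c F.≟ F.0#
    ... | yes c≈0 = d , inj₂ zero , (λ d≈0 → cd≉0 (c≈0 , d≈0)) , F.trans c≈0 (F.sym (F.zeroʳ d)) , F.sym (F.*-identityʳ d)
    ... | no  c≉0 = c , inj₁ (F.index (d F.* c F.⁻¹[ c≉0 ])) , c≉0 , F.sym (F.*-identityʳ c) ,
          F.trans (F.modulo (F.- d) (F.*-inverse c≉0) (F.solve 3 (λ c d i → d F.:= c F.:* (d F.:* i) F.:+ F.:- d F.:* (c F.:* i F.:- F.:1)) F.refl c d (c F.⁻¹[ c≉0 ])))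
            (F.*-congˡ (F.sym (F.element-index _)))

    -- The image of P(t) over `K` tells whether t is sent to t or to t^q, and these differ; this
    -- fixes σ. The first row is `cube (A σ c d) c`, so it fixes A : c and thereby c : d.
    symmetry-injective : ∀ σ p σ′ p′ → symmetryAt σ p F.∼ᴹ symmetryAt σ′ p′ → σ ≡ σ′ × p ≡ p′
    symmetry-injective σ p σ′ p′ (k , k≉0 , M≈) = σ≡σ′ , same-direction σ≡σ′ p p′ first-row
      where
      c₁ = proj₁ (direction p)
      d₁ = proj₂ (direction p)
      c₂ = proj₁ (direction p′)
      d₂ = proj₂ (direction p′)
      δ₁ = Equivalence.from (det-symmetry σ c₁ d₁) (norm≉0 (direction≉0 p))

      first-row : A σ c₁ d₁ F.* c₂ F.≈ A σ′ c₂ d₂ F.* c₁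
      first-row = F.cube-∝ F._≟_ {F.1#} {k} F.1≉0
        (λ (a≈0 , c≈0) → δ₁ (F.trans (F.+-cong (F.trans (F.*-congʳ a≈0) (F.zeroˡ d₁)) (F.-‿cong (F.trans (F.*-congˡ c≈0) (F.zeroʳ (B σ c₁ d₁))))) (F.-‿inverseʳ F.0#)))
        (λ j → F.trans (F.*-identityˡ _) (M≈ 0F j))

      u₁ = ι (A σ c₁ d₁) * t + ι (B σ c₁ d₁) * 1#
      w₁ = ι c₁ * t + ι d₁ * 1#
      u₂ = ι (A σ′ c₂ d₂) * t + ι (B σ′ c₂ d₂) * 1#
      w₂ = ι c₂ * t + ι d₂ * 1#

      images : u₁ * w₂ ≈ u₂ * w₁
      images = cube-∝ _≟_ {1#} {ι k} 1≉0 (Nonzero²-map (ι-det δ₁) (1≉0 ∘ proj₂)) λ j → begin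
        1# * cube u₁ w₁ j
          ≈⟨ *-identityˡ _ ⟩
        cube u₁ w₁ j
          ≈⟨ cube-sym³ t 1# _ _ _ _ j ⟨
        (cube t 1# *ᵛ sym³ (ι (A σ c₁ d₁)) (ι (B σ c₁ d₁)) (ι c₁) (ι d₁)) j
          ≈⟨ *ᵛ-congʳ (cube t 1#) (λ i j → trans (sym (ι-sym³ (A σ c₁ d₁) (B σ c₁ d₁) c₁ d₁ i j)) (ι-cubic {symmetryAt σ p} M≈ i j)) j ⟩
        (cube t 1# *ᵛ (λ i j → ι k * sym³ (ι (A σ′ c₂ d₂)) (ι (B σ′ c₂ d₂)) (ι c₂) (ι d₂) i j)) j
          ≈⟨ cube-cubic {k = ι k} (λ _ _ → refl) t 1# j ⟩
        ι k * cube u₂ w₂ j ∎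

      tidy-maps : ∀ σ c d → ι (A σ c d) * t + ι (B σ c d) * 1# ≈ parameter σ * (ι c * t + ι d * 1#)
      tidy-maps σ c d = trans (+-congˡ (*-identityʳ _)) (trans (symmetry-maps σ c d) (*-congˡ (+-congˡ (sym (*-identityʳ _)))))

      linear≉0 : ∀ p → ¬ (ι (proj₁ (direction p)) * t + ι (proj₂ (direction p)) * 1# ≈ 0#)
      linear≉0 p e = let d≈0 , c≈0 = independent (trans (+-comm _ _) (trans (+-congˡ (sym (*-identityʳ _))) e)) in direction≉0 p (c≈0 , d≈0)

      parameters≈ : parameter σ ≈ parameter σ′
      parameters≈ = *-cancelˡ (*-≉0 (linear≉0 p) (linear≉0 p′)) (begin
        w₁ * w₂ * parameter σ       ≈⟨ solve 3 (λ a b s → a :* b :* s := s :* a :* b) refl w₁ w₂ (parameter σ) ⟩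
        parameter σ * w₁ * w₂       ≈⟨ *-congʳ (tidy-maps σ c₁ d₁) ⟨
        u₁ * w₂                     ≈⟨ images ⟩
        u₂ * w₁                     ≈⟨ *-congʳ (tidy-maps σ′ c₂ d₂) ⟩
        parameter σ′ * w₂ * w₁      ≈⟨ solve 3 (λ a b s → s :* b :* a := a :* b :* s) refl w₁ w₂ (parameter σ′) ⟩
        w₁ * w₂ * parameter σ′      ∎)

      same-type : ∀ σ σ′ → parameter σ ≈ parameter σ′ → σ ≡ σ′
      same-type 0F 0F e = ≡.refl
      same-type 1F 1F e = ≡.refl
      same-type 0F 1F e = contradiction (≈⇒-‿≈0 e) conjugate≉
      same-type 1F 0F e = contradiction (≈⇒-‿≈0 (sym e)) conjugate≉

      σ≡σ′ = same-type σ σ′ parameters≈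

      A-injective : ∀ σ {d d′} → A σ F.1# d F.≈ A σ F.1# d′ → d F.≈ d′
      A-injective 0F {d} {d′} e = F.modulo F.1# e (F.solve 3 (λ T d d′ → d F.:= d′ F.:+ F.:1 F.:* (F.:1 F.:* T F.:+ d F.:- (F.:1 F.:* T F.:+ d′))) F.refl T d d′)
      A-injective 1F {d} {d′} e = F.modulo (F.- F.1#) e (F.solve 2 (λ d d′ → d F.:= d′ F.:+ F.:- F.:1 F.:* (F.:- d F.:- F.:- d′)) F.refl d d′)

      A-0-1 : ∀ σ → A σ F.0# F.1# ≉ꟳ0
      A-0-1 0F e = F.1≉0 (F.trans (F.solve 1 (λ T → F.:1 F.:= F.:0 F.:* T F.:+ F.:1) F.refl T) e)
      A-0-1 1F e = F.1≉0 (F.trans (F.solve 0 (F.:1 F.:= F.:- F.:- F.:1) F.refl) (F.trans (F.-‿cong e) F.-0#≈0#))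

      same-direction : ∀ {σ σ′} → σ ≡ σ′ → ∀ p p′ →
        A σ (proj₁ (direction p)) (proj₂ (direction p)) F.* proj₁ (direction p′)
          F.≈ A σ′ (proj₁ (direction p′)) (proj₂ (direction p′)) F.* proj₁ (direction p) → p ≡ p′
      same-direction {σ} ≡.refl (inj₁ i) (inj₁ j) e = ≡.cong inj₁ (F.element-injective (A-injective σ
        (F.trans (F.sym (F.*-identityʳ _)) (F.trans e (F.*-identityʳ _)))))
      same-direction {σ} ≡.refl (inj₁ i) (inj₂ _) e = contradiction
        (F.trans (F.sym (F.*-identityʳ _)) (F.trans (F.sym e) (F.zeroʳ _))) (A-0-1 σ)
      same-direction {σ} ≡.refl (inj₂ _) (inj₁ j) e = contradiction
        (F.trans (F.sym (F.*-identityʳ _)) (F.trans e (F.zeroʳ _))) (A-0-1 σ)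
      same-direction ≡.refl (inj₂ zero) (inj₂ zero) e = ≡.refl

    stabilizer-size : HasSize (F.stabilizerSetoid l) (2 ℕ.* (q ℕ.+ 1))
    stabilizer-size = enumeration⇒HasSize (F.stabilizerSetoid l) enumerate enumerate-injective
        (λ (g , g∈Stab) → enumerate-surjective g (stabilizer-form g g∈Stab))
      where
      decode : Fin (2 ℕ.* (q ℕ.+ 1)) → Fin 2 × (Fin q ⊎ Fin 1)
      decode n = proj₁ (remQuot {2} (q ℕ.+ 1) n) , splitAt q (proj₂ (remQuot {2} (q ℕ.+ 1) n))

      encode : Fin 2 × (Fin q ⊎ Fin 1) → Fin (2 ℕ.* (q ℕ.+ 1))
      encode (σ , p) = combine σ (join q 1 p)

      encode-decode : ∀ n → encode (decode n) ≡ n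
      encode-decode n = ≡.trans (≡.cong (combine (proj₁ (decode n))) (join-splitAt q 1 (proj₂ (remQuot {2} (q ℕ.+ 1) n)))) (combine-remQuot {2} (q ℕ.+ 1) n)

      decode-encode : ∀ σp → decode (encode σp) ≡ σp
      decode-encode (σ , p) = ≡.cong₂ _,_
        (≡.cong proj₁ (remQuot-combine σ (join q 1 p)))
        (≡.trans (≡.cong (splitAt q ∘ proj₂) (remQuot-combine σ (join q 1 p))) (splitAt-join q 1 p))

      enumerateᵖ : Fin 2 × (Fin q ⊎ Fin 1) → ∃ (F.InStabilizer l)
      enumerateᵖ (σ , p) = symmetryProjectivity σ (direction≉0 p)

      enumerate : Fin (2 ℕ.* (q ℕ.+ 1)) → ∃ (F.InStabilizer l)
      enumerate = enumerateᵖ ∘ decode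

      enumerate-injective : ∀ m n → symmetryAt (proj₁ (decode m)) (proj₂ (decode m)) F.∼ᴹ symmetryAt (proj₁ (decode n)) (proj₂ (decode n)) → m ≡ n
      enumerate-injective m n e =
        let σ≡ , p≡ = symmetry-injective (proj₁ (decode m)) (proj₂ (decode m)) (proj₁ (decode n)) (proj₂ (decode n)) e
        in ≡.trans (≡.sym (encode-decode m)) (≡.trans (≡.cong encode (≡.cong₂ _,_ σ≡ p≡)) (encode-decode n))

      enumerate-surjective : ∀ g → (∃ λ σ → ∃₂ λ c d → F.Nonzero² c d × F.matrix g F.∼ᴹ symmetry σ c d) →
        ∃ λ n → F.matrix (proj₁ (enumerate n)) F.∼ᴹ F.matrix g
      enumerate-surjective g (σ , c , d , cd≉0 , g∼) = scale (direction-onto cd≉0)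
        where
        module S = Setoid F.projectivitySetoid
        scale : (∃₂ λ k p → k ≉ꟳ0 × c F.≈ k F.* proj₁ (direction p) × d F.≈ k F.* proj₂ (direction p)) →
                ∃ λ n → F.matrix (proj₁ (enumerate n)) F.∼ᴹ F.matrix g
        scale (k , p , k≉0 , c≈ , d≈) = encode (σ , p) ,
          ≡.subst (λ σp → F.matrix (proj₁ (enumerateᵖ σp)) F.∼ᴹ F.matrix g) (≡.sym (decode-encode (σ , p)))
            (S.sym {g} {proj₁ (enumerateᵖ (σ , p))} (S.trans {g} {proj₁ (symmetryProjectivity σ cd≉0)} {proj₁ (enumerateᵖ (σ , p))} g∼
              (k F.^ 3 , F.^3-≉0 k≉0 , symmetry-scale σ c≈ d≈)))

  -- The lines `ℓ₁` and `ℓ₂` and the matrices fixing them.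

  root∈ℓ₁ : ∀ {ρ} (ρ≉0 : ρ ≉ꟳ0) {s} → Root F.0# (F.- ρ F.⁻¹[ ρ≉0 ]) s → OnExtension (P s) (F.ℓ₁ ρ)
  -- The first two coordinates of the spanning points form the identity matrix, so the coefficients
  -- are those of P(s); the other two coordinates ask for ρ s² = 1.
  root∈ℓ₁ {ρ} ρ≉0 {s} root = s ^ 3 , s ^ 2 , λ where
      0F → trans (solve 2 (λ x y → x := x :* :1 :+ y :* :0) refl (s ^ 3) (s ^ 2)) (+-cong (*-congˡ (sym ι.1#-homo)) (*-congˡ (sym ι.0#-homo)))
      1F → trans (solve 2 (λ x y → y := x :* :0 :+ y :* :1) refl (s ^ 3) (s ^ 2)) (+-cong (*-congˡ (sym ι.0#-homo)) (*-congˡ (sym ι.1#-homo)))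
      2F → trans (modulo (- s) s²ρ≈1 (solve 2 (λ s r → s := s :* (s :* (s :* :1)) :* r :+ s :* (s :* :1) :* :0 :+ :- s :* (s :* s :* r :- :1)) refl s (ι ρ)))
             (+-congˡ (*-congˡ (sym ι.0#-homo)))
      3F → trans (modulo (- 1#) s²ρ≈1 (solve 2 (λ s r → :1 := s :* (s :* (s :* :1)) :* :0 :+ s :* (s :* :1) :* r :+ :- :1 :* (s :* s :* r :- :1)) refl s (ι ρ)))
             (+-congʳ (*-congˡ (sym ι.0#-homo)))
    where
    ρ⁻¹ = ρ F.⁻¹[ ρ≉0 ]
    s²ρ≈1 : s * s * ι ρ ≈ 1#
    s²ρ≈1 = modulo (ι ρ) root (modulo (ι ρ * s) ι.0#-homo (modulo (- ι ρ) (ι.-‿homo ρ⁻¹)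
      (modulo 1# (trans (sym (ι.*-homo ρ ρ⁻¹)) (trans (ι.⟦⟧-cong (F.*-inverse ρ≉0)) ι.1#-homo))
      (solve 5 (λ s r z i m → s :* s :* r := :1 :+ r :* (s :* s :- (z :* s :- m)) :+ r :* s :* (z :- :0) :+ :- r :* (m :- :- i) :+ :1 :* (r :* i :- :1))
        refl s (ι ρ) (ι F.0#) (ι ρ⁻¹) (ι (F.- ρ⁻¹))))))

  root∈ℓ₂ : ∀ {η s} → Root F.1# (F.- η) s → OnExtension (P s) (F.ℓ₂ η)
  -- Here the last two coordinates form the identity matrix, and the first two reduce to s² = s + η.
  root∈ℓ₂ {η} {s} root = s , 1# , λ where
      0F → trans (modulo (s + 1#) s²≈ (solve 2 (λ s e → s :* (s :* (s :* :1)) := s :* (e :+ :1) :+ :1 :* e :+ (s :+ :1) :* (s :* s :- (s :+ e))) refl s (ι η)))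
             (+-congʳ (*-congˡ (sym (trans (ι.+-homo η F.1#) (+-congˡ ι.1#-homo)))))
      1F → trans (modulo 1# s²≈ (solve 2 (λ s e → s :* (s :* :1) := s :* :1 :+ :1 :* e :+ :1 :* (s :* s :- (s :+ e))) refl s (ι η)))
             (+-congʳ (*-congˡ (sym ι.1#-homo)))
      2F → trans (solve 1 (λ s → s := s :* :1 :+ :1 :* :0) refl s) (+-cong (*-congˡ (sym ι.1#-homo)) (*-congˡ (sym ι.0#-homo)))
      3F → trans (solve 1 (λ s → :1 := s :* :0 :+ :1 :* :1) refl s) (+-cong (*-congˡ (sym ι.0#-homo)) (*-congˡ (sym ι.1#-homo)))
    where
    s²≈ : s * s ≈ s + ι η
    s²≈ = trans root (+-cong (trans (*-congʳ ι.1#-homo) (*-identityˡ s))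
      (trans (-‿cong (ι.-‿homo η)) (solve 1 (λ e → :- :- e := e) refl (ι η))))

  chord⇒imaginary : ∀ {l} → Chord l → IsImaginaryChord l
  chord⇒imaginary C = t , t∉F , t∈l , t^q∈l
    where open Chord C

  OddConclusion : F.Carrier → Set _
  OddConclusion ρ = IsImaginaryChord (F.ℓ₁ ρ)
    × (∀ g → F.InStabilizer (F.ℓ₁ ρ) g →
        ∃ λ α → ∃ λ b → ∃ λ d →
          (α F.≈ F.- F.1# ⊎ α F.≈ F.1#) × ¬ (b F.≈ F.0# × d F.≈ F.0#) × F.matrix g F.∼ᴹ F.oddForm ρ α b d)

  -- The form of the statement results from b = α c / ρ: α = 1 belongs to the symmetries fixing the
  -- two conjugate points, α = -1 to those interchanging them.
  ℓ₁-chord : ∀ {ρ} (ρ≉0 : ρ ≉ꟳ0) {t} → ¬ InSubfield t → Root F.0# (F.- ρ F.⁻¹[ ρ≉0 ]) t → OddConclusion ρ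
  ℓ₁-chord {ρ} ρ≉0 {t} t∉F root = chord⇒imaginary C , λ g g∈Stab → form g (ChordStabilizer.stabilizer-form C g g∈Stab)
    where
    ρ⁻¹ = ρ F.⁻¹[ ρ≉0 ]
    C : Chord (F.ℓ₁ ρ)
    C = chord t∉F root (root∈ℓ₁ ρ≉0 root) (root∈ℓ₁ ρ≉0 (root-^q root))
    open Symmetries F.0# (F.- ρ⁻¹)

    odd-nonzero : ∀ {α b c d} → F.Nonzero² c d → c F.≈ α F.* (ρ F.* b) → ¬ (b F.≈ F.0# × d F.≈ F.0#)
    odd-nonzero {α} cd≉0 c≈ (b≈0 , d≈0) = cd≉0
      (F.trans c≈ (F.trans (F.*-congˡ (F.trans (F.*-congˡ b≈0) (F.zeroʳ ρ))) (F.zeroʳ α)) , d≈0)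

    form : ∀ g → (∃ λ σ → ∃₂ λ c d → F.Nonzero² c d × F.matrix g F.∼ᴹ symmetry σ c d) →
      ∃ λ α → ∃ λ b → ∃ λ d →
        (α F.≈ F.- F.1# ⊎ α F.≈ F.1#) × ¬ (b F.≈ F.0# × d F.≈ F.0#) × F.matrix g F.∼ᴹ F.oddForm ρ α b d
    form g (0F , c , d , cd≉0 , k , k≉0 , g≈) = F.1# , c F.* ρ⁻¹ , d , inj₂ F.refl , odd-nonzero cd≉0 c≈ , k , k≉0 , λ i j →
        F.trans (g≈ i j) (F.*-congˡ (F.trans (F.sym³-cong a≈ b≈ c≈ F.refl i j) (F.sym (oddForm-1 ρ (c F.* ρ⁻¹) d i j))))
      where
      a≈ : c F.* F.0# F.+ d F.≈ F.1# F.* d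
      a≈ = F.solve 2 (λ c d → c F.:* F.:0 F.:+ d F.:= F.:1 F.:* d) F.refl c d
      b≈ : F.- (c F.* F.- ρ⁻¹) F.≈ c F.* ρ⁻¹
      b≈ = F.solve 2 (λ c i → F.:- (c F.:* F.:- i) F.:= c F.:* i) F.refl c ρ⁻¹
      c≈ : c F.≈ F.1# F.* (ρ F.* (c F.* ρ⁻¹))
      c≈ = F.modulo (F.- c) (F.*-inverse ρ≉0) (F.solve 3 (λ r c i → c F.:= F.:1 F.:* (r F.:* (c F.:* i)) F.:+ F.:- c F.:* (r F.:* i F.:- F.:1)) F.refl ρ c ρ⁻¹)
    form g (1F , c , d , cd≉0 , k , k≉0 , g≈) = F.- F.1# , F.- (c F.* ρ⁻¹) , d , inj₁ F.refl , odd-nonzero cd≉0 c≈ , k , k≉0 , λ i j →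
        F.trans (g≈ i j) (F.*-congˡ (F.trans (F.sym³-cong a≈ b≈ c≈ F.refl i j) (F.sym (oddForm--1 ρ (F.- (c F.* ρ⁻¹)) d i j))))
      where
      a≈ : F.- d F.≈ F.- F.1# F.* d
      a≈ = F.solve 1 (λ d → F.:- d F.:= F.:- F.:1 F.:* d) F.refl d
      b≈ : c F.* F.- ρ⁻¹ F.+ d F.* F.0# F.≈ F.- (c F.* ρ⁻¹)
      b≈ = F.solve 3 (λ c d i → c F.:* F.:- i F.:+ d F.:* F.:0 F.:= F.:- (c F.:* i)) F.refl c d ρ⁻¹
      c≈ : c F.≈ F.- F.1# F.* (ρ F.* F.- (c F.* ρ⁻¹))
      c≈ = F.modulo (F.- c) (F.*-inverse ρ≉0) (F.solve 3 (λ r c i → c F.:= F.:- F.:1 F.:* (r F.:* F.:- (c F.:* i)) F.:+ F.:- c F.:* (r F.:* i F.:- F.:1)) F.refl ρ c ρ⁻¹)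

  odd-chord : ¬ (2 ∣ q) → ∀ ρ → F.NonSquare ρ → OddConclusion ρ
  odd-chord 2∤q ρ ρ-nonsquare =
    let t , t∉F , root = squareRoot 2∤q ρ-nonsquare ρ≉0 in ℓ₁-chord ρ≉0 t∉F root
    where
    ρ≉0 : ρ ≉ꟳ0
    ρ≉0 ρ≈0 = ρ-nonsquare (F.0# , F.trans (F.zeroˡ F.0#) (F.sym ρ≈0))

  EvenConclusion : F.Carrier → Set _
  EvenConclusion η = IsImaginaryChord (F.ℓ₂ η)
    × (∀ g → F.InStabilizer (F.ℓ₂ η) g →
        ∃ λ α → ∃ λ c → ∃ λ d →
          (α F.≈ F.0# ⊎ α F.≈ F.1#) × ¬ (c F.≈ F.0# × d F.≈ F.0#) × F.matrix g F.∼ᴹ F.evenForm η α c d)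

  -- In characteristic 2 the signs disappear and both kinds of symmetry fit one formula: α = 1,
  -- where α + 1 vanishes, fixes the conjugate points and α = 0 interchanges them.
  ℓ₂-chord : F.1# F.+ F.1# F.≈ F.0# → ∀ {η t} → ¬ InSubfield t → Root F.1# (F.- η) t → EvenConclusion η
  ℓ₂-chord 2≈0 {η} {t} t∉F root = chord⇒imaginary C , λ g g∈Stab → form g (ChordStabilizer.stabilizer-form C g g∈Stab)
    where
    C : Chord (F.ℓ₂ η)
    C = chord t∉F root (root∈ℓ₂ root) (root∈ℓ₂ (root-^q root))
    open Symmetries F.1# (F.- η)

    form : ∀ g → (∃ λ σ → ∃₂ λ c d → F.Nonzero² c d × F.matrix g F.∼ᴹ symmetry σ c d) →
      ∃ λ α → ∃ λ c → ∃ λ d →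
        (α F.≈ F.0# ⊎ α F.≈ F.1#) × ¬ (c F.≈ F.0# × d F.≈ F.0#) × F.matrix g F.∼ᴹ F.evenForm η α c d
    form g (0F , c , d , cd≉0 , k , k≉0 , g≈) = F.1# , c , d , inj₂ F.refl , cd≉0 , k , k≉0 , λ i j →
        F.trans (g≈ i j) (F.*-congˡ (F.trans (F.sym³-cong a≈ b≈ F.refl F.refl i j) (evenForm≈ 2≈0 η F.1# c d i j)))
      where
      a≈ : c F.* F.1# F.+ d F.≈ F.1# F.* c F.+ d
      a≈ = F.+-congʳ (F.*-comm c F.1#)
      b≈ : F.- (c F.* F.- η) F.≈ η F.* c F.+ (F.1# F.+ F.1#) F.* d
      b≈ = F.modulo (F.- d) 2≈0 (F.solve 3 (λ e c d → F.:- (c F.:* F.:- e) F.:= e F.:* c F.:+ (F.:1 F.:+ F.:1) F.:* d F.:+ F.:- d F.:* (F.:1 F.:+ F.:1 F.:- F.:0)) F.refl η c d)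
    form g (1F , c , d , cd≉0 , k , k≉0 , g≈) = F.0# , c , d , inj₁ F.refl , cd≉0 , k , k≉0 , λ i j →
        F.trans (g≈ i j) (F.*-congˡ (F.trans (F.sym³-cong a≈ b≈ F.refl F.refl i j) (evenForm≈ 2≈0 η F.0# c d i j)))
      where
      a≈ : F.- d F.≈ F.0# F.* c F.+ d
      a≈ = F.modulo (F.- d) 2≈0 (F.solve 2 (λ c d → F.:- d F.:= F.:0 F.:* c F.:+ d F.:+ F.:- d F.:* (F.:1 F.:+ F.:1 F.:- F.:0)) F.refl c d)
      b≈ : c F.* F.- η F.+ d F.* F.1# F.≈ η F.* c F.+ (F.0# F.+ F.1#) F.* d
      b≈ = F.modulo (F.- (η F.* c)) 2≈0 (F.solve 3 (λ e c d → c F.:* F.:- e F.:+ d F.:* F.:1 F.:= e F.:* c F.:+ (F.:0 F.:+ F.:1) F.:* d F.:+ F.:- (e F.:* c) F.:* (F.:1 F.:+ F.:1 F.:- F.:0)) F.refl η c d)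

  even-chord : ∀ h → q ≡ 2 ℕ.^ h → ∀ η → F.trace h η F.≈ F.1# → EvenConclusion η
  even-chord h q≡2^h η trace≈1 =
    let t , t∉F , root = Even.artinSchreierRoot {h} q≡2^h trace≈1 in ℓ₂-chord (Even.2≈0 {h} q≡2^h) t∉F root

theorem5p7 :
    ∀ {c ℓ c′ ℓ′} (q : ℕ) → 5 ≤ q →
    (F : Field c ℓ) → HasSize (Field.setoid F) q →
    (K : Field c′ ℓ′) → HasSize (Field.setoid K) (q ^ℕ 2) →
    (ι : Field.Carrier F → Field.Carrier K) →
    IsRingHomomorphism (Field.rawRing F) (Field.rawRing K) ι →
    let open Field F
        open ProjectiveSpace F
        open ImaginaryChords q F K ι
    in
    IsOrbit IsImaginaryChord
    × (∀ l → IsImaginaryChord l → HasSize (stabilizerSetoid l) (2 *ℕ (q +ℕ 1)))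
    × (¬ (2 ∣ q) → ∀ ρ → NonSquare ρ →
        IsImaginaryChord (ℓ₁ ρ)
        × (∀ g → InStabilizer (ℓ₁ ρ) g →
            ∃ λ α → ∃ λ b → ∃ λ d →
              (α ≈ - 1# ⊎ α ≈ 1#) × ¬ (b ≈ 0# × d ≈ 0#) × matrix g ∼ᴹ oddForm ρ α b d))
    × (∀ h → q ≡ 2 ^ℕ h → ∀ η → trace h η ≈ 1# →
        IsImaginaryChord (ℓ₂ η)
        × (∀ g → InStabilizer (ℓ₂ η) g →
            ∃ λ α → ∃ λ c → ∃ λ d →
              (α ≈ 0# ⊎ α ≈ 1#) × ¬ (c ≈ 0# × d ≈ 0#) × matrix g ∼ᴹ evenForm η α c d))
theorem5p7 q 5≤q F sizeF K sizeK ι ι-hom =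
    imaginaryChords-orbit
  , (λ l l-chord → ChordStabilizer.stabilizer-size {l} (toChord l-chord))
  , odd-chord
  , even-chord
  where open Chords q 5≤q F sizeF K sizeK ι ι-hom
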